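{- Let $n$ be a positive integer coprime with $6$, and let $M$ be either $n-1$ or $(n-1)/2$. Then \[ \sum_{k=0}^{M}[8k+1] \frac{(q;q^2)_k^2\, (q;q^2)_{2k}\, (q^{ -3};q^6)_k} {(q^2;q^2)_{2k}\,(q^6;q^6)_k\, (q^{ -3},q^6;q^2)_{k} }\, q^{2k} \equiv 0 \pmod{[n]^2}. \]
   Context: Here $q$ is an indeterminate. For $x$ and a base $p$ (a power of $q$), $(x;p)_k=\prod_{j=0}^{k-1}(1-xp^j)$ and $(x_1,x_2;p)_k=(x_1;p)_k(x_2;p)_k$. The $q$-integer is $[j]=1+q+\cdots+q^{j-1}$. For rational functions $A(q),B(q)$ and a polynomial $P(q)$, $A\equiv B\pmod{P}$ means that the numerator of the reduced form of $A-B$ is divisible by $P$ in $\mathbb{Z}[q]$. -}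

module Defs where

open import Data.Nat as ℕ using (ℕ; zero; suc)
open import Data.Integer as ℤ using (ℤ; +_; -[1+_])
open import Data.List using (List; []; _∷_; map; replicate; _++_; foldr; upTo)
open import Data.Product using (Σ; ∃; _×_; _,_)
open import Relation.Binary.PropositionalEquality using (_≡_)
open import Relation.Nullary using (¬_)

-- Polynomials in ℤ[q], as coefficient lists (lowest degree first).

Poly : Set
Poly = List ℤ

coeff : Poly → ℕ → ℤ
coeff []      _       = + 0
coeff (a ∷ p) zero    = a
coeff (a ∷ p) (suc i) = coeff p i

-- equality of polynomials (trailing zeros irrelevant)
_≈ₚ_ : Poly → Poly → Set
p ≈ₚ r = ∀ i → coeff p i ≡ coeff r i

infix 4 _≈ₚ_ _∣ₚ_
infixl 6 _+ₚ_ _-ₚ_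
infixl 7 _*ₚ_

0ₚ : Poly
0ₚ = []

1ₚ : Poly
1ₚ = + 1 ∷ []

_+ₚ_ : Poly → Poly → Poly
[]      +ₚ r       = r
(a ∷ p) +ₚ []      = a ∷ p
(a ∷ p) +ₚ (b ∷ r) = (a ℤ.+ b) ∷ (p +ₚ r)

negₚ : Poly → Poly
negₚ = map (λ a → ℤ.- a)

_-ₚ_ : Poly → Poly → Poly
p -ₚ r = p +ₚ negₚ r

_*ₚ_ : Poly → Poly → Poly
[]      *ₚ r = []
(a ∷ p) *ₚ r = map (a ℤ.*_) r +ₚ (+ 0 ∷ (p *ₚ r))

X^ : ℕ → Poly
X^ m = replicate m (+ 0) ++ (+ 1 ∷ [])

_∣ₚ_ : Poly → Poly → Set
d ∣ₚ a = ∃ λ c → d *ₚ c ≈ₚ a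

CoprimeₚP : Poly → Poly → Set
CoprimeₚP a b = ∀ c → c ∣ₚ a → c ∣ₚ b → c ∣ₚ 1ₚ

qint : ℕ → Poly
qint j = foldr (λ i acc → X^ i +ₚ acc) 0ₚ (upTo j)

-- Rational functions in q, as (unreduced) fractions num / den.

record Frac : Set where
  constructor _/_
  field
    num : Poly
    den : Poly
open Frac public

infixl 6 _+f_ _-f_
infixl 7 _*f_ _÷f_

fromPoly : Poly → Frac
fromPoly p = p / 1ₚ

0f 1f : Frac
0f = fromPoly 0ₚ
1f = fromPoly 1ₚ

_+f_ : Frac → Frac → Frac
(a / b) +f (c / d) = (a *ₚ d +ₚ c *ₚ b) / (b *ₚ d)

_-f_ : Frac → Frac → Frac
(a / b) -f (c / d) = (a *ₚ d -ₚ c *ₚ b) / (b *ₚ d)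

_*f_ : Frac → Frac → Frac
(a / b) *f (c / d) = (a *ₚ c) / (b *ₚ d)

_÷f_ : Frac → Frac → Frac
(a / b) ÷f (c / d) = (a *ₚ d) / (b *ₚ c)

qpow : ℤ → Frac
qpow (+ m)      = fromPoly (X^ m)
qpow -[1+ m ]   = 1ₚ / X^ (suc m)

_^f_ : Frac → ℕ → Frac
x ^f zero    = 1f
x ^f (suc k) = (x ^f k) *f x

poch : Frac → Frac → ℕ → Frac
poch x p zero    = 1f
poch x p (suc k) = poch x p k *f (1f -f x *f (p ^f k))

sumTo : ℕ → (ℕ → Frac) → Frac
sumTo zero    f = f 0
sumTo (suc M) f = sumTo M f +f f (suc M)

-- A ≡ B (mod P): the numerator of the reduced form of A - B is divisible
-- by P in ℤ[q].  The reduced form N'/D' of A - B = N/D is any pair with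
-- D' ≠ 0, N'/D' = N/D (i.e. N'·D = N·D'), and gcd(N', D') = 1 in ℤ[q]
-- (it is unique up to the units ±1, which do not affect divisibility).
_≡_[modₚ_] : Frac → Frac → Poly → Set
A ≡ B [modₚ P ] =
  let N = num (A -f B) ; D = den (A -f B) in
  ∃ λ N' → ∃ λ D' → ¬ (D' ≈ₚ 0ₚ) × (N' *ₚ D ≈ₚ N *ₚ D')
                    × CoprimeₚP N' D' × (P ∣ₚ N')

q : ℤ → Frac
q = qpow

term : ℕ → Frac
term k =
  ((fromPoly (qint (8 ℕ.* k ℕ.+ 1))
     *f (poch (q (+ 1)) (q (+ 2)) k ^f 2)
     *f poch (q (+ 1)) (q (+ 2)) (2 ℕ.* k)
     *f poch (q -[1+ 2 ]) (q (+ 6)) k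
     *f q (+ (2 ℕ.* k)))
  ÷f (poch (q (+ 2)) (q (+ 2)) (2 ℕ.* k)
     *f poch (q (+ 6)) (q (+ 6)) k
     *f poch (q -[1+ 2 ]) (q (+ 2)) k
     *f poch (q (+ 6)) (q (+ 2)) k))

{-# OPTIONS --safe #-}
module Submission where

open import Algebra.Bundles using (CommutativeRing)
import Algebra.Properties.Ring as RingProps
import Algebra.Properties.Semiring.Mult.TCOptimised as Mult
import Algebra.Solver.Ring
open import Algebra.Solver.Ring.AlmostCommutativeRing using (fromCommutativeRing; _-Raw-AlmostCommutative⟶_)
open import Data.Empty using (⊥; ⊥-elim)
open import Data.Integer as ℤ using (ℤ; +_; -[1+_])
import Data.Integer.DivMod as ℤ÷
open import Data.Integer.Divisibility.Signed as ℤ∣ using (divides) renaming (_∣_ to _∣ℤ_; _∣?_ to _∣ℤ?_)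
import Data.Integer.Properties as ℤₚ
open import Data.Integer.Tactic.RingSolver using () renaming (solve-∀ to ℤ-solve)
open import Data.List using (List; []; _∷_; map; foldr; applyUpTo)
open import Data.Maybe using (Maybe; just; nothing)
open import Data.Nat as ℕ using (ℕ; zero; suc; _≤_; _<_; _∸_; z≤n; s≤s; NonZero)
open import Data.Nat.Coprimality using (Coprime; coprime-Bézout)
open import Data.Nat.Divisibility as ℕ∣ using (_∣_; _∣?_)
open import Data.Nat.GCD using (gcd; gcd[m,n]∣m; gcd[m,n]∣n; gcd-greatest; gcd-GCD; module Bézout)
import Data.Nat.Properties as ℕₚ
open import Data.Nat.Tactic.RingSolver using () renaming (solve-∀ to ℕ-solve)
open import Data.Product using (∃; _×_; _,_; proj₁; proj₂)
open import Data.Sum using (_⊎_; inj₁; inj₂; [_,_]′)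
open import Level using (0ℓ)
open import Relation.Binary using (IsEquivalence; Setoid)
open import Relation.Binary.Definitions using (tri<; tri≈; tri>)
open import Relation.Binary.PropositionalEquality as ≡ using (_≡_; _≢_; cong; cong₂)
open import Relation.Nullary using (¬_; yes; no; Dec)
open import Defs hiding (poch; num; den; q)

-- Put x = q^N for N = 6m + 1, m ∈ ℤ.  Deforming (q;q²)_k² / (q⁶;q⁶)_k² to
-- (aq, q/a;q²)_k / (aq⁶, q⁶/a;q⁶)_k makes the series terminate at a = q^N, where it is
-- summable in closed form; inverting this triangular family of evaluations expresses the
-- truncated sum itself as a finite sum ∑_m E_M(m) of products of factors (1 - q^j)^{±1}.
-- The expansion is verified by induction on M: E_k - E_{k-1} is again a single product, and
-- its sum over m satisfies a first-order recurrence in k by a WZ certificate.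
--
-- For a divisor d > 1 of n every E_M(m) vanishes to order at least 2 at the d-th cyclotomic
-- polynomial Φ_d: one counts the multiples of d among the exponents j, using that M is
-- congruent to -1 or (d - 1)/2 modulo d, and treating d ∣ N and d ∤ N separately.
-- Distinct cyclotomic polynomials are coprime over ℚ and monic, so the square of
-- [n] = ∏_{d ∣ n, d > 1} Φ_d divides the reduced numerator.

-- The summand at k = 0 equals 1, so divisibility cannot be read off term by term in k. In the
-- expansion it can: every `E M m` has order two by itself, and nothing has to cancel between
-- different m. The passage is an interchange of sums. Each summand is `δ k` times a sum over m of
-- `D̂ k m`, and for fixed m the sum over k of `δ k * D̂ k m` telescopes to `E M m`. Three
-- bookkeeping devices recur. Sums over m run over |m| ≤ k + j with a free slack j, so that k and k
-- + 1 can share one range. The reciprocal of (q²;q²)_z is taken to be 0 for negative z, which cuts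
-- off all sums without side conditions. Orders at Φ_d are pairs of natural numbers, one for zeros
-- and one for poles. Coprimality of cyclotomic polynomials holds over ℚ only: the Bézout constants
-- are integers such as a / gcd(a, i). Division by a monic polynomial does not leave ℤ[q], and this
-- is what removes these constants and brings divisibility back to ℤ[q].

module IntSolver {c ℓ} (R : CommutativeRing c ℓ) where
  open CommutativeRing R
  open Mult semiring renaming (_×_ to _•_)
  open RingProps ring
  open import Relation.Binary.Reasoning.Setoid setoid

  -- The canonical map from ℤ. Solver coefficients live in ℤ, where equality is decidable, so
  -- identities with integer constants can be normalised in any commutative ring.
  ι : ℤ → Carrier
  ι (+ n)    = n • 1#
  ι -[1+ n ] = - (suc n • 1#)

  ι-neg : ∀ a → ι (ℤ.- a) ≈ - ι a
  ι-neg (+ zero)  = sym -0#≈0#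
  ι-neg (+ suc n) = refl
  ι-neg -[1+ n ]  = sym (-‿involutive _)

  private
    suc-× : ∀ n → suc n • 1# ≈ 1# + n • 1#
    suc-× n = ×-homo-+ 1# 1 n

    cancel : ∀ a b c → (a + b) + - (a + c) ≈ b + - c
    cancel a b c = begin
      (a + b) + - (a + c)      ≈⟨ +-cong (+-comm a b) (sym (-‿+-comm a c)) ⟩
      (b + a) + (- a + - c)    ≈⟨ +-assoc b a _ ⟩
      b + (a + (- a + - c))    ≈⟨ +-congˡ (sym (+-assoc a (- a) (- c))) ⟩
      b + ((a + - a) + - c)    ≈⟨ +-congˡ (+-congʳ (-‿inverseʳ a)) ⟩
      b + (0# + - c)           ≈⟨ +-congˡ (+-identityˡ _) ⟩
      b + - c                  ∎

  ι-⊖ : ∀ m n → ι (m ℤ.⊖ n) ≈ m • 1# + - (n • 1#)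
  ι-⊖ m zero = trans (sym (+-identityʳ _)) (+-congˡ (sym -0#≈0#))
  ι-⊖ zero (suc n) = sym (+-identityˡ _)
  ι-⊖ (suc m) (suc n) = begin
    ι (suc m ℤ.⊖ suc n)                        ≡⟨ ≡.cong ι (ℤₚ.[1+m]⊖[1+n]≡m⊖n m n) ⟩
    ι (m ℤ.⊖ n)                                ≈⟨ ι-⊖ m n ⟩
    m • 1# + - (n • 1#)                        ≈⟨ cancel 1# _ _ ⟨
    (1# + m • 1#) + - (1# + n • 1#)            ≈⟨ +-cong (sym (suc-× m)) (-‿cong (sym (suc-× n))) ⟩
    suc m • 1# + - (suc n • 1#)                ∎

  ι-+ : ∀ a b → ι (a ℤ.+ b) ≈ ι a + ι b
  ι-+ (+ m)    (+ n)    = ×-homo-+ 1# m n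
  ι-+ (+ m)    -[1+ n ] = ι-⊖ m (suc n)
  ι-+ -[1+ m ] (+ n)    = trans (ι-⊖ n (suc m)) (+-comm _ _)
  ι-+ -[1+ m ] -[1+ n ] = begin
    - (suc (suc (m ℕ.+ n)) • 1#)       ≡⟨ ≡.cong (λ k → - (suc k • 1#)) (≡.sym (ℕ-suc m n)) ⟩
    - ((suc m ℕ.+ suc n) • 1#)         ≈⟨ -‿cong (×-homo-+ 1# (suc m) (suc n)) ⟩
    - (suc m • 1# + suc n • 1#)        ≈⟨ sym (-‿+-comm _ _) ⟩
    - (suc m • 1#) + - (suc n • 1#)    ∎
    where
    open import Data.Nat.Properties using () renaming (+-suc to ℕ-suc)

  ι-* : ∀ a b → ι (a ℤ.* b) ≈ ι a * ι b
  ι-* (+ m) (+ n) = trans (reflexive (≡.cong ι (≡.sym (ℤₚ.pos-* m n)))) (×1-homo-* m n)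
  ι-* (+ m) -[1+ n ] = begin
    ι (+ m ℤ.* -[1+ n ])                ≡⟨ ≡.cong ι (≡.sym (ℤₚ.neg-distribʳ-* (+ m) (+ suc n))) ⟩
    ι (ℤ.- (+ m ℤ.* + suc n))           ≈⟨ ι-neg (+ m ℤ.* + suc n) ⟩
    - ι (+ m ℤ.* + suc n)               ≈⟨ -‿cong (ι-* (+ m) (+ suc n)) ⟩
    - (ι (+ m) * ι (+ suc n))           ≈⟨ -‿distribʳ-* _ _ ⟩
    ι (+ m) * - ι (+ suc n)             ∎
  ι-* -[1+ m ] b = begin
    ι (-[1+ m ] ℤ.* b)                  ≡⟨ ≡.cong ι (≡.sym (ℤₚ.neg-distribˡ-* (+ suc m) b)) ⟩
    ι (ℤ.- (+ suc m ℤ.* b))             ≈⟨ ι-neg (+ suc m ℤ.* b) ⟩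
    - ι (+ suc m ℤ.* b)                 ≈⟨ -‿cong (lemma m b) ⟩
    - (ι (+ suc m) * ι b)               ≈⟨ -‿distribˡ-* _ _ ⟩
    - ι (+ suc m) * ι b                 ∎
    where
    lemma : ∀ m b → ι (+ suc m ℤ.* b) ≈ ι (+ suc m) * ι b
    lemma m (+ n) = trans (reflexive (≡.cong ι (≡.sym (ℤₚ.pos-* (suc m) n)))) (×1-homo-* (suc m) n)
    lemma m -[1+ n ] = begin
      ι (+ suc m ℤ.* -[1+ n ])           ≡⟨ ≡.cong ι (≡.sym (ℤₚ.neg-distribʳ-* (+ suc m) (+ suc n))) ⟩
      ι (ℤ.- (+ suc m ℤ.* + suc n))      ≈⟨ ι-neg (+ suc m ℤ.* + suc n) ⟩
      - ι (+ suc m ℤ.* + suc n)          ≈⟨ -‿cong (lemma m (+ suc n)) ⟩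
      - (ι (+ suc m) * ι (+ suc n))      ≈⟨ -‿distribʳ-* _ _ ⟩
      ι (+ suc m) * - ι (+ suc n)        ∎

  morphism : CommutativeRing.rawRing ℤₚ.+-*-commutativeRing -Raw-AlmostCommutative⟶ fromCommutativeRing R
  morphism = record
    { ⟦_⟧    = ι
    ; +-homo = ι-+
    ; *-homo = ι-*
    ; -‿homo = ι-neg
    ; 0-homo = refl
    ; 1-homo = refl
    }

  ι-≟ : ∀ a b → Maybe (ι a ≈ ι b)
  ι-≟ a b with a ℤₚ.≟ b
  ... | yes a≡b = just (reflexive (≡.cong ι a≡b))
  ... | no _    = nothing

  open Algebra.Solver.Ring _ (fromCommutativeRing R) morphism ι-≟ public
    using (solve; con; var; _:+_; _:*_; _:-_; :-_; _:^_; _:=_)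

-- Polynomials over ℤ

infix 4 _≋_

-- A record, so that the two polynomials can be inferred from a proof.
record _≋_ (p r : Poly) : Set where
  constructor mk
  field at : p ≈ₚ r
open _≋_ public

≋-isEquivalence : IsEquivalence _≋_
≋-isEquivalence = record
  { refl  = mk λ _ → ≡.refl
  ; sym   = λ e → mk λ i → ≡.sym (at e i)
  ; trans = λ e f → mk λ i → ≡.trans (at e i) (at f i)
  }

open IsEquivalence ≋-isEquivalence public
  using () renaming (refl to ≋-refl; sym to ≋-sym; trans to ≋-trans)

≋-setoid : Setoid 0ℓ 0ℓ
≋-setoid = record { isEquivalence = ≋-isEquivalence }

infixr 8 _·_
_·_ : ℤ → Poly → Poly
a · p = map (a ℤ.*_) p

coeff-+ : ∀ p r i → coeff (p +ₚ r) i ≡ coeff p i ℤ.+ coeff r i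
coeff-+ []      r       i       = ≡.sym (ℤₚ.+-identityˡ _)
coeff-+ (a ∷ p) []      i       = ≡.sym (ℤₚ.+-identityʳ _)
coeff-+ (a ∷ p) (b ∷ r) zero    = ≡.refl
coeff-+ (a ∷ p) (b ∷ r) (suc i) = coeff-+ p r i

coeff-· : ∀ a p i → coeff (a · p) i ≡ a ℤ.* coeff p i
coeff-· a []      i       = ≡.sym (ℤₚ.*-zeroʳ a)
coeff-· a (b ∷ p) zero    = ≡.refl
coeff-· a (b ∷ p) (suc i) = coeff-· a p i

coeff-neg : ∀ p i → coeff (negₚ p) i ≡ ℤ.- coeff p i
coeff-neg []      i       = ≡.refl
coeff-neg (b ∷ p) zero    = ≡.refl
coeff-neg (b ∷ p) (suc i) = coeff-neg p i

module PolyLaws where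
  open import Relation.Binary.Reasoning.Setoid ≋-setoid

  ∷-cong : ∀ {a b p r} → a ≡ b → p ≋ r → a ∷ p ≋ b ∷ r
  ∷-cong a≡b p≋r = mk λ { zero → a≡b ; (suc i) → at p≋r i }

  tail-≋ : ∀ {a b p r} → a ∷ p ≋ b ∷ r → p ≋ r
  tail-≋ e = mk λ i → at e (suc i)

  tail-≋0 : ∀ {a p} → a ∷ p ≋ [] → p ≋ []
  tail-≋0 e = mk λ i → at e (suc i)

  shift-0 : + 0 ∷ [] ≋ []
  shift-0 = mk λ { zero → ≡.refl ; (suc i) → ≡.refl }

  +-cong : ∀ {p p′ r r′} → p ≋ p′ → r ≋ r′ → p +ₚ r ≋ p′ +ₚ r′
  +-cong {p} {p′} {r} {r′} e f = mk λ i → ≡.trans (coeff-+ p r i)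
    (≡.trans (cong₂ ℤ._+_ (at e i) (at f i)) (≡.sym (coeff-+ p′ r′ i)))

  ·-cong : ∀ {a b p r} → a ≡ b → p ≋ r → a · p ≋ b · r
  ·-cong {a} {b} {p} {r} e f = mk λ i → ≡.trans (coeff-· a p i)
    (≡.trans (cong₂ ℤ._*_ e (at f i)) (≡.sym (coeff-· b r i)))

  neg-cong : ∀ {p r} → p ≋ r → negₚ p ≋ negₚ r
  neg-cong {p} {r} e = mk λ i → ≡.trans (coeff-neg p i)
    (≡.trans (cong ℤ.-_ (at e i)) (≡.sym (coeff-neg r i)))

  +-assoc : ∀ p r s → (p +ₚ r) +ₚ s ≋ p +ₚ (r +ₚ s)
  +-assoc p r s = mk λ i → ≡.trans (coeff-+ (p +ₚ r) s i)
    (≡.trans (cong (ℤ._+ coeff s i) (coeff-+ p r i))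
    (≡.trans (ℤₚ.+-assoc (coeff p i) _ _)
    (≡.trans (cong (ℤ._+_ (coeff p i)) (≡.sym (coeff-+ r s i))) (≡.sym (coeff-+ p (r +ₚ s) i)))))

  +-comm : ∀ p r → p +ₚ r ≋ r +ₚ p
  +-comm p r = mk λ i → ≡.trans (coeff-+ p r i)
    (≡.trans (ℤₚ.+-comm (coeff p i) _) (≡.sym (coeff-+ r p i)))

  +-identityʳ : ∀ p → p +ₚ [] ≋ p
  +-identityʳ []      = ≋-refl
  +-identityʳ (a ∷ p) = ≋-refl

  +-inverseʳ : ∀ p → p +ₚ negₚ p ≋ []
  +-inverseʳ p = mk λ i → ≡.trans (coeff-+ p (negₚ p) i)
    (≡.trans (cong (ℤ._+_ (coeff p i)) (coeff-neg p i)) (ℤₚ.+-inverseʳ (coeff p i)))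

  private
    interchange : ∀ a b c d → (a +ₚ b) +ₚ (c +ₚ d) ≋ (a +ₚ c) +ₚ (b +ₚ d)
    interchange a b c d = begin
      (a +ₚ b) +ₚ (c +ₚ d)    ≈⟨ +-assoc a b _ ⟩
      a +ₚ (b +ₚ (c +ₚ d))    ≈⟨ +-cong (≋-refl {a}) (+-assoc b c d) ⟨
      a +ₚ ((b +ₚ c) +ₚ d)    ≈⟨ +-cong (≋-refl {a}) (+-cong (+-comm b c) (≋-refl {d})) ⟩
      a +ₚ ((c +ₚ b) +ₚ d)    ≈⟨ +-cong (≋-refl {a}) (+-assoc c b d) ⟩
      a +ₚ (c +ₚ (b +ₚ d))    ≈⟨ +-assoc a c _ ⟨
      (a +ₚ c) +ₚ (b +ₚ d)    ∎

  ·-distribˡ : ∀ a p r → a · (p +ₚ r) ≋ a · p +ₚ a · r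
  ·-distribˡ a p r = mk λ i → ≡.trans (coeff-· a (p +ₚ r) i)
    (≡.trans (cong (a ℤ.*_) (coeff-+ p r i))
    (≡.trans (ℤₚ.*-distribˡ-+ a (coeff p i) _)
    (≡.trans (cong₂ ℤ._+_ (≡.sym (coeff-· a p i)) (≡.sym (coeff-· a r i)))
             (≡.sym (coeff-+ (a · p) (a · r) i)))))

  ·-distribʳ : ∀ a b p → (a ℤ.+ b) · p ≋ a · p +ₚ b · p
  ·-distribʳ a b p = mk λ i → ≡.trans (coeff-· (a ℤ.+ b) p i)
    (≡.trans (ℤₚ.*-distribʳ-+ (coeff p i) a b)
    (≡.trans (cong₂ ℤ._+_ (≡.sym (coeff-· a p i)) (≡.sym (coeff-· b p i)))
             (≡.sym (coeff-+ (a · p) (b · p) i))))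

  ·-assoc : ∀ a b p → (a ℤ.* b) · p ≋ a · (b · p)
  ·-assoc a b p = mk λ i → ≡.trans (coeff-· (a ℤ.* b) p i)
    (≡.trans (ℤₚ.*-assoc a b _)
    (≡.trans (cong (a ℤ.*_) (≡.sym (coeff-· b p i))) (≡.sym (coeff-· a (b · p) i))))

  0·-zero : ∀ p → (+ 0) · p ≋ []
  0·-zero p = mk λ i → ≡.trans (coeff-· (+ 0) p i) (ℤₚ.*-zeroˡ (coeff p i))

  1·-identity : ∀ p → (+ 1) · p ≋ p
  1·-identity p = mk λ i → ≡.trans (coeff-· (+ 1) p i) (ℤₚ.*-identityˡ _)

  shift-*ₚ : ∀ p r → (+ 0 ∷ p) *ₚ r ≋ + 0 ∷ (p *ₚ r)
  shift-*ₚ p r = +-cong (0·-zero r) ≋-refl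

  *ₚ-zeroˡ : ∀ {p} r → p ≋ [] → p *ₚ r ≋ []
  *ₚ-zeroˡ {[]}    r e = ≋-refl
  *ₚ-zeroˡ {a ∷ p} r e = begin
    a · r +ₚ (+ 0 ∷ p *ₚ r)    ≈⟨ +-cong (·-cong (at e 0) ≋-refl) (∷-cong ≡.refl (*ₚ-zeroˡ r (tail-≋0 e))) ⟩
    (+ 0) · r +ₚ (+ 0 ∷ [])      ≈⟨ +-cong (0·-zero r) shift-0 ⟩
    []                         ∎

  *ₚ-congʳ : ∀ {p p′} r → p ≋ p′ → p *ₚ r ≋ p′ *ₚ r
  *ₚ-congʳ {[]}    {p′}     r e = ≋-sym (*ₚ-zeroˡ r (≋-sym e))
  *ₚ-congʳ {a ∷ p} {[]}     r e = *ₚ-zeroˡ r e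
  *ₚ-congʳ {a ∷ p} {b ∷ p′} r e =
    +-cong (·-cong (at e 0) ≋-refl) (∷-cong ≡.refl (*ₚ-congʳ r (tail-≋ e)))

  *ₚ-congˡ : ∀ p {r r′} → r ≋ r′ → p *ₚ r ≋ p *ₚ r′
  *ₚ-congˡ []      e = ≋-refl
  *ₚ-congˡ (a ∷ p) e = +-cong (·-cong (≡.refl {x = a}) e) (∷-cong ≡.refl (*ₚ-congˡ p e))

  *ₚ-zeroʳ : ∀ p → p *ₚ [] ≋ []
  *ₚ-zeroʳ []      = ≋-refl
  *ₚ-zeroʳ (a ∷ p) = ≋-trans (∷-cong ≡.refl (*ₚ-zeroʳ p)) shift-0

  *ₚ-∷ : ∀ p b r → p *ₚ (b ∷ r) ≋ b · p +ₚ (+ 0 ∷ p *ₚ r)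
  *ₚ-∷ []      b r = ≋-sym shift-0
  *ₚ-∷ (a ∷ p) b r = ∷-cong (cong (ℤ._+ + 0) (ℤₚ.*-comm a b)) (begin
    a · r +ₚ p *ₚ (b ∷ r)                ≈⟨ +-cong ≋-refl (*ₚ-∷ p b r) ⟩
    a · r +ₚ (b · p +ₚ (+ 0 ∷ p *ₚ r))   ≈⟨ +-assoc (a · r) _ _ ⟨
    (a · r +ₚ b · p) +ₚ (+ 0 ∷ p *ₚ r)   ≈⟨ +-cong (+-comm (a · r) _) ≋-refl ⟩
    (b · p +ₚ a · r) +ₚ (+ 0 ∷ p *ₚ r)   ≈⟨ +-assoc (b · p) _ _ ⟩
    b · p +ₚ (a · r +ₚ (+ 0 ∷ p *ₚ r))   ∎)

  *ₚ-comm : ∀ p r → p *ₚ r ≋ r *ₚ p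
  *ₚ-comm []      r = ≋-sym (*ₚ-zeroʳ r)
  *ₚ-comm (a ∷ p) r = ≋-trans (+-cong ≋-refl (∷-cong ≡.refl (*ₚ-comm p r))) (≋-sym (*ₚ-∷ r a p))

  *ₚ-distribʳ : ∀ r p s → (p +ₚ s) *ₚ r ≋ p *ₚ r +ₚ s *ₚ r
  *ₚ-distribʳ r []      s       = ≋-refl
  *ₚ-distribʳ r (a ∷ p) []      = ≋-sym (+-identityʳ _)
  *ₚ-distribʳ r (a ∷ p) (b ∷ s) = begin
    (a ℤ.+ b) · r +ₚ (+ 0 ∷ (p +ₚ s) *ₚ r)
      ≈⟨ +-cong (·-distribʳ a b r) (∷-cong ≡.refl (*ₚ-distribʳ r p s)) ⟩
    (a · r +ₚ b · r) +ₚ ((+ 0 ∷ p *ₚ r) +ₚ (+ 0 ∷ s *ₚ r))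
      ≈⟨ interchange (a · r) _ _ _ ⟩
    (a · r +ₚ (+ 0 ∷ p *ₚ r)) +ₚ (b · r +ₚ (+ 0 ∷ s *ₚ r)) ∎

  ·-*ₚ : ∀ a p r → (a · p) *ₚ r ≋ a · (p *ₚ r)
  ·-*ₚ a []      r = ≋-refl
  ·-*ₚ a (b ∷ p) r = begin
    (a ℤ.* b) · r +ₚ (+ 0 ∷ (a · p) *ₚ r)
      ≈⟨ +-cong (·-assoc a b r) (∷-cong (≡.sym (ℤₚ.*-zeroʳ a)) (·-*ₚ a p r)) ⟩
    a · (b · r) +ₚ a · (+ 0 ∷ p *ₚ r)
      ≈⟨ ·-distribˡ a (b · r) _ ⟨
    a · (b · r +ₚ (+ 0 ∷ p *ₚ r)) ∎

  *ₚ-assoc : ∀ p r s → (p *ₚ r) *ₚ s ≋ p *ₚ (r *ₚ s)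
  *ₚ-assoc []      r s = ≋-refl
  *ₚ-assoc (a ∷ p) r s = begin
    (a · r +ₚ (+ 0 ∷ p *ₚ r)) *ₚ s          ≈⟨ *ₚ-distribʳ s (a · r) _ ⟩
    (a · r) *ₚ s +ₚ (+ 0 ∷ p *ₚ r) *ₚ s     ≈⟨ +-cong (·-*ₚ a r s) (shift-*ₚ (p *ₚ r) s) ⟩
    a · (r *ₚ s) +ₚ (+ 0 ∷ (p *ₚ r) *ₚ s)   ≈⟨ +-cong ≋-refl (∷-cong ≡.refl (*ₚ-assoc p r s)) ⟩
    a · (r *ₚ s) +ₚ (+ 0 ∷ p *ₚ (r *ₚ s))   ∎

  *ₚ-identityˡ : ∀ p → 1ₚ *ₚ p ≋ p
  *ₚ-identityˡ p = ≋-trans (+-cong (1·-identity p) shift-0) (+-identityʳ p)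

  open import Algebra.Consequences.Setoid ≋-setoid

  commutativeRing : CommutativeRing 0ℓ 0ℓ
  commutativeRing = record
    { Carrier = Poly ; _≈_ = _≋_ ; _+_ = _+ₚ_ ; _*_ = _*ₚ_ ; -_ = negₚ ; 0# = 0ₚ ; 1# = 1ₚ
    ; isCommutativeRing = record
      { isRing = record
        { +-isAbelianGroup = record
          { isGroup = record
            { isMonoid = record
              { isSemigroup = record
                { isMagma = record { isEquivalence = ≋-isEquivalence ; ∙-cong = +-cong }
                ; assoc = +-assoc }
              ; identity = (λ p → ≋-refl) , +-identityʳ }
            ; inverse = (λ p → ≋-trans (+-comm (negₚ p) p) (+-inverseʳ p)) , +-inverseʳ
            ; ⁻¹-cong = neg-cong }
          ; comm = +-comm }
        ; *-cong = λ {p} {p′} {r} {r′} e f → ≋-trans (*ₚ-congʳ r e) (*ₚ-congˡ p′ f)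
        ; *-assoc = *ₚ-assoc
        ; *-identity = *ₚ-identityˡ , λ p → ≋-trans (*ₚ-comm p 1ₚ) (*ₚ-identityˡ p)
        ; distrib = comm∧distrʳ⇒distr +-cong *ₚ-comm *ₚ-distribʳ
        }
      ; *-comm = *ₚ-comm
      }
    }

module PolynomialArithmetic where
  open PolyLaws using (commutativeRing; ∷-cong; shift-0; *ₚ-zeroˡ; +-identityʳ)
  open CommutativeRing commutativeRing using () renaming
    ( +-cong to +ₚ-cong; *-cong to *ₚ-cong; -‿cong to negₚ-cong; *-comm to *ₚ-comm; *-assoc to *ₚ-assoc
    ; +-congˡ to +ₚ-congˡ; +-congʳ to +ₚ-congʳ; *-congˡ to *ₚ-congˡ; *-congʳ to *ₚ-congʳ; zeroʳ to *ₚ-zeroʳ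
    ; *-identityˡ to *ₚ-identityˡ; *-identityʳ to *ₚ-identityʳ; +-comm to +ₚ-comm; reflexive to ≋-reflexive)
  module PS = IntSolver commutativeRing
  open PS using (solve; con; _:+_; _:*_; _:-_; :-_; _:=_)
  open import Relation.Binary.Reasoning.Setoid ≋-setoid

  -- Constants, degrees and integrality of ℤ[q]

  C : ℤ → Poly
  C a = a ∷ []

  C-* : ∀ a p → C a *ₚ p ≋ a · p
  C-* a p = ≋-trans (+ₚ-congˡ {a · p} shift-0) (+-identityʳ _)

  C-cong : ∀ {a b} → a ≡ b → C a ≋ C b
  C-cong ≡.refl = ≋-refl

  C-homo-* : ∀ a b → C (a ℤ.* b) ≋ C a *ₚ C b
  C-homo-* a b = ≋-sym (C-* a (C b))

  C-0 : C (+ 0) ≋ []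
  C-0 = shift-0

  -- Coefficient lists may end in zeros, so degrees are handled through vanishing coefficients and
  -- not through lengths.
  Below : ℕ → Poly → Set
  Below n p = ∀ i → n ≤ i → coeff p i ≡ + 0

  Below-resp : ∀ {n p r} → p ≋ r → Below n p → Below n r
  Below-resp e b i n≤i = ≡.trans (≡.sym (at e i)) (b i n≤i)

  Below-mono : ∀ {m n p} → m ≤ n → Below m p → Below n p
  Below-mono m≤n b i n≤i = b i (ℕₚ.≤-trans m≤n n≤i)

  Below-0 : ∀ {p} → Below 0 p → p ≋ []
  Below-0 b = mk λ i → b i z≤n

  Below-tail : ∀ {n a p} → Below (suc n) (a ∷ p) → Below n p
  Below-tail b i n≤i = b (suc i) (s≤s n≤i)

  HasDegree : Poly → ℕ → Set
  HasDegree p d = coeff p d ≢ + 0 × Below (suc d) p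

  degree? : ∀ p → p ≋ [] ⊎ ∃ (HasDegree p)
  degree? [] = inj₁ ≋-refl
  degree? (a ∷ p) with degree? p
  ... | inj₂ (d , l , b) = inj₂ (suc d , l , λ { (suc i) (s≤s d<i) → b i d<i })
  ... | inj₁ p≋0 with a ℤₚ.≟ + 0
  ...   | yes a≡0 = inj₁ (≋-trans (∷-cong a≡0 p≋0) shift-0)
  ...   | no  a≢0 = inj₂ (0 , a≢0 , λ { (suc i) _ → at p≋0 i })

  -- Here `d` and `e` are mere bounds and either top coefficient may vanish. This generality is used
  -- in `pseudo-divide`, where the coefficient to be cancelled may already be zero.
  coeff-*-top : ∀ d e p r → Below (suc d) p → Below (suc e) r →
    coeff (p *ₚ r) (d ℕ.+ e) ≡ coeff p d ℤ.* coeff r e × Below (suc (d ℕ.+ e)) (p *ₚ r)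
  coeff-*-top d e [] r bp br = ≡.refl , λ _ _ → ≡.refl
  coeff-*-top zero e (a ∷ p) r bp br = top e , λ i e<i → ≡.trans (top i) (≡.trans (cong (a ℤ.*_) (br i e<i)) (ℤₚ.*-zeroʳ a))
    where
    pr≋0 : + 0 ∷ p *ₚ r ≋ []
    pr≋0 = ≋-trans (∷-cong ≡.refl (*ₚ-zeroˡ r (Below-0 {p} (Below-tail {a = a} {p = p} bp)))) shift-0
    top : ∀ i → coeff ((a ∷ p) *ₚ r) i ≡ a ℤ.* coeff r i
    top i = ≡.trans (coeff-+ (a · r) _ i) (≡.trans (cong₂ ℤ._+_ (coeff-· a r i) (at pr≋0 i)) (ℤₚ.+-identityʳ _))
  coeff-*-top (suc d) e (a ∷ p) r bp br with coeff-*-top d e p r (Below-tail {a = a} {p = p} bp) br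
  ... | t , b = ≡.trans (high (d ℕ.+ e) (s≤s (ℕₚ.m≤n+m e d))) t
              , λ { (suc i) (s≤s h) → ≡.trans (high i (s≤s (ℕₚ.≤-trans (ℕₚ.m≤n+m e (suc d)) h))) (b i h) }
    where
    high : ∀ i → suc e ≤ suc i → coeff ((a ∷ p) *ₚ r) (suc i) ≡ coeff (p *ₚ r) i
    high i e<i = ≡.trans (coeff-+ (a · r) _ (suc i)) (≡.trans (cong (ℤ._+ coeff (p *ₚ r) i)
      (≡.trans (coeff-· a r (suc i)) (≡.trans (cong (a ℤ.*_) (br (suc i) e<i)) (ℤₚ.*-zeroʳ a)))) (ℤₚ.+-identityˡ _))

  ℤ-*-nonzero : ∀ {a b} → a ≢ + 0 → b ≢ + 0 → a ℤ.* b ≢ + 0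
  ℤ-*-nonzero {a} a≢0 b≢0 ab≡0 with ℤₚ.i*j≡0⇒i≡0∨j≡0 a ab≡0
  ... | inj₁ e = a≢0 e
  ... | inj₂ e = b≢0 e

  *-degree : ∀ {p r d e} → HasDegree p d → HasDegree r e → HasDegree (p *ₚ r) (d ℕ.+ e)
  *-degree {p} {r} {d} {e} (lp , bp) (lr , br) with coeff-*-top d e p r bp br
  ... | t , b = (λ z → ℤ-*-nonzero lp lr (≡.trans (≡.sym t) z)) , b

  degree-nonzero : ∀ {p d} → HasDegree p d → ¬ p ≋ []
  degree-nonzero {p} {d} (l , _) e = l (at e d)

  *ₚ-nonzero : ∀ {p r} → ¬ p ≋ [] → ¬ r ≋ [] → ¬ p *ₚ r ≋ []
  *ₚ-nonzero {p} {r} p≢0 r≢0 with degree? p | degree? r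
  ... | inj₁ e       | _            = ⊥-elim (p≢0 e)
  ... | inj₂ _       | inj₁ e       = ⊥-elim (r≢0 e)
  ... | inj₂ (d , h) | inj₂ (e , k) = degree-nonzero (*-degree {p} {r} h k)

  *ₚ-integral : ∀ {p r} → ¬ p ≋ [] → p *ₚ r ≋ [] → r ≋ []
  *ₚ-integral {p} {r} p≢0 e with degree? r
  ... | inj₁ z       = z
  ... | inj₂ (_ , h) = ⊥-elim (*ₚ-nonzero p≢0 (degree-nonzero {r} h) e)

  difference-zero : ∀ {p r} → p ≋ r → p -ₚ r ≋ []
  difference-zero {p} {r} e = ≋-trans (+ₚ-congʳ {negₚ r} e) (CommutativeRing.-‿inverseʳ commutativeRing r)

  difference-zero⁻¹ : ∀ {p r} → p -ₚ r ≋ [] → p ≋ r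
  difference-zero⁻¹ {p} {r} e = begin
    p               ≈⟨ solve 2 (λ a b → a := (a :- b) :+ b) ≋-refl p r ⟩
    p -ₚ r +ₚ r     ≈⟨ +ₚ-congʳ {r} e ⟩
    r               ∎

  *ₚ-cancelˡ : ∀ {p a b} → ¬ p ≋ [] → p *ₚ a ≋ p *ₚ b → a ≋ b
  *ₚ-cancelˡ {p} {a} {b} p≢0 e = difference-zero⁻¹ (*ₚ-integral p≢0 (≋-trans
    (solve 3 (λ p a b → p :* (a :- b) := p :* a :- p :* b) ≋-refl p a b)
    (difference-zero e)))

  -- Pseudo-division and Bézout relations

  mono : ℕ → ℤ → Poly
  mono zero    a = a ∷ []
  mono (suc j) a = + 0 ∷ mono j a

  coeff-mono : ∀ j a → coeff (mono j a) j ≡ a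
  coeff-mono zero    a = ≡.refl
  coeff-mono (suc j) a = coeff-mono j a

  Below-mono-poly : ∀ j a → Below (suc j) (mono j a)
  Below-mono-poly zero    a (suc i) h       = ≡.refl
  Below-mono-poly (suc j) a (suc i) (s≤s h) = Below-mono-poly j a i h

  Below-+ : ∀ {n} p r → Below n p → Below n r → Below n (p +ₚ r)
  Below-+ p r bp br i h = ≡.trans (coeff-+ p r i) (cong₂ ℤ._+_ (bp i h) (br i h))

  Below-C* : ∀ {n} a p → Below n p → Below n (C a *ₚ p)
  Below-C* a p b i h = ≡.trans (at (C-* a p) i) (≡.trans (coeff-· a p i) (≡.trans (cong (a ℤ.*_) (b i h)) (ℤₚ.*-zeroʳ a)))

  -- The leading coefficient of P need not be invertible in ℤ; each cancellation of a top term of A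
  -- costs one factor of it, whence the power on the left.
  pseudo-divide : ∀ P e → Below (suc e) P → ∀ n A → Below n A →
    ∃ λ k → ∃ λ Q → ∃ λ R → C (coeff P e ℤ.^ k) *ₚ A ≋ Q *ₚ P +ₚ R × Below e R
  pseudo-divide P e bP zero A bA = 0 , [] , A , *ₚ-identityˡ A , Below-mono {p = A} z≤n bA
  pseudo-divide P e bP (suc n) A bA with suc n ℕₚ.≤? e
  ... | yes n<e = 0 , [] , A , *ₚ-identityˡ A , Below-mono {p = A} n<e bA
  ... | no  n≮e = suc k , Q +ₚ C (b ℤ.^ k) *ₚ M , R , eq , proj₂ (proj₂ (proj₂ (proj₂ rec)))
    where
    b = coeff P e
    j = n ℕ.∸ e
    j+e≡n : j ℕ.+ e ≡ n
    j+e≡n = ℕₚ.m∸n+n≡m (ℕₚ.≤-pred (ℕₚ.≰⇒> n≮e))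
    M = mono j (coeff A n)
    A′ = C b *ₚ A -ₚ M *ₚ P
    MP-top = coeff-*-top j e M P (Below-mono-poly j _) bP
    bA′ : Below n A′
    bA′ i n≤i with ℕₚ.m≤n⇒m<n∨m≡n n≤i
    ... | inj₁ n<i = Below-+ (C b *ₚ A) (negₚ (M *ₚ P)) (Below-C* b A bA)
                       (λ i h → ≡.trans (coeff-neg (M *ₚ P) i) (cong ℤ.-_ (proj₂ MP-top i (≡.subst (λ z → suc z ≤ i) (≡.sym j+e≡n) h)))) i n<i
    ... | inj₂ ≡.refl = ≡.trans (coeff-+ (C b *ₚ A) _ n) (≡.trans (cong₂ ℤ._+_
            (≡.trans (at (C-* b A) n) (coeff-· b A n))
            (≡.trans (coeff-neg (M *ₚ P) n) (cong ℤ.-_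
              (≡.trans (cong (coeff (M *ₚ P)) (≡.sym j+e≡n)) (≡.trans (proj₁ MP-top) (≡.trans (cong (ℤ._* b) (coeff-mono j _)) (ℤₚ.*-comm _ b)))))))
            (ℤₚ.+-inverseʳ (b ℤ.* coeff A n)))
    rec = pseudo-divide P e bP n A′ bA′
    k = proj₁ rec
    Q = proj₁ (proj₂ rec)
    R = proj₁ (proj₂ (proj₂ rec))
    eq : C (b ℤ.^ suc k) *ₚ A ≋ (Q +ₚ C (b ℤ.^ k) *ₚ M) *ₚ P +ₚ R
    eq = begin
      C (b ℤ.* b ℤ.^ k) *ₚ A          ≈⟨ *ₚ-congʳ {A} (C-homo-* b _) ⟩
      (C b *ₚ C (b ℤ.^ k)) *ₚ A
        ≈⟨ solve 5 (λ B K A M P → (B :* K) :* A := K :* (B :* A :- M :* P) :+ K :* M :* P) ≋-refl (C b) (C (b ℤ.^ k)) A M P ⟩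
      C (b ℤ.^ k) *ₚ A′ +ₚ C (b ℤ.^ k) *ₚ M *ₚ P
        ≈⟨ +ₚ-congʳ {C (b ℤ.^ k) *ₚ M *ₚ P} (proj₁ (proj₂ (proj₂ (proj₂ rec)))) ⟩
      Q *ₚ P +ₚ R +ₚ C (b ℤ.^ k) *ₚ M *ₚ P
        ≈⟨ solve 4 (λ Q P R S → Q :* P :+ R :+ S :* P := (Q :+ S) :* P :+ R) ≋-refl Q P R (C (b ℤ.^ k) *ₚ M) ⟩
      (Q +ₚ C (b ℤ.^ k) *ₚ M) *ₚ P +ₚ R ∎

  ^-nonzero : ∀ {b} k → b ≢ + 0 → b ℤ.^ k ≢ + 0
  ^-nonzero zero    b≢0 ()
  ^-nonzero (suc k) b≢0 = ℤ-*-nonzero b≢0 (^-nonzero k b≢0)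

  some-bound : ∀ p → ∃ λ n → Below n p
  some-bound []      = 0 , λ _ _ → ≡.refl
  some-bound (a ∷ p) with some-bound p
  ... | n , b = suc n , λ { (suc i) (s≤s h) → b i h }

  -- A representative of A / B in lowest terms over ℚ: the relation `bezout` leaves only integer
  -- constants as common factors of `N` and `D`.
  record Bezout (A B : Poly) : Set where
    field
      N D α β  : Poly
      m        : ℤ
      m≢0      : m ≢ + 0
      fraction : N *ₚ B ≋ A *ₚ D
      bezout   : α *ₚ N +ₚ β *ₚ D ≋ C m

  -- Euclid's algorithm read as a continued fraction: if K A = Q B + R and B / R = N / D, then A / B
  -- = (Q N + D) / (K N). The degree bound of the divisor decreases.
  bezout-below : ∀ n A B → Below n B → Bezout A B
  bezout-below n A B bB with degree? B
  -- The algorithm stops at a zero divisor, with the formal quotient 1 / 0.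
  ... | inj₁ B≋0 = record
    { N = 1ₚ ; D = [] ; α = 1ₚ ; β = [] ; m = + 1 ; m≢0 = λ ()
    ; fraction = ≋-trans (*ₚ-identityˡ B) (≋-trans B≋0 (≋-sym (*ₚ-zeroʳ A)))
    ; bezout = ≋-refl }
  bezout-below zero A B bB | inj₂ (e , l , _) = ⊥-elim (l (bB e z≤n))
  bezout-below (suc n) A B bB | inj₂ (e , l , bP) = go (pseudo-divide B e bP _ A (proj₂ (some-bound A)))
    where
    e≤n : e ≤ n
    e≤n with e ℕₚ.≤? n
    ... | yes h = h
    ... | no  h = ⊥-elim (l (bB e (ℕₚ.≰⇒> h)))
    go : (∃ λ k → ∃ λ Q → ∃ λ R → C (coeff B e ℤ.^ k) *ₚ A ≋ Q *ₚ B +ₚ R × Below e R) → Bezout A B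
    go (k , Q , R , eq , bR) = record
      { N = Q *ₚ I.N +ₚ I.D ; D = K *ₚ I.N ; α = K *ₚ I.β ; β = I.α -ₚ I.β *ₚ Q
      ; m = coeff B e ℤ.^ k ℤ.* I.m ; m≢0 = ℤ-*-nonzero (^-nonzero k l) I.m≢0
      ; fraction = begin
          (Q *ₚ I.N +ₚ I.D) *ₚ B
            ≈⟨ solve 4 (λ Q N D B → (Q :* N :+ D) :* B := Q :* B :* N :+ B :* D) ≋-refl Q I.N I.D B ⟩
          Q *ₚ B *ₚ I.N +ₚ B *ₚ I.D
            ≈⟨ +ₚ-congˡ {Q *ₚ B *ₚ I.N} (≋-sym I.fraction) ⟩
          Q *ₚ B *ₚ I.N +ₚ I.N *ₚ R
            ≈⟨ solve 4 (λ Q B N R → Q :* B :* N :+ N :* R := (Q :* B :+ R) :* N) ≋-refl Q B I.N R ⟩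
          (Q *ₚ B +ₚ R) *ₚ I.N
            ≈⟨ *ₚ-congʳ {I.N} eq ⟨
          K *ₚ A *ₚ I.N
            ≈⟨ solve 3 (λ K A N → K :* A :* N := A :* (K :* N)) ≋-refl K A I.N ⟩
          A *ₚ (K *ₚ I.N) ∎
      ; bezout = begin
          K *ₚ I.β *ₚ (Q *ₚ I.N +ₚ I.D) +ₚ (I.α -ₚ I.β *ₚ Q) *ₚ (K *ₚ I.N)
            ≈⟨ solve 6 (λ K b Q N D a → K :* b :* (Q :* N :+ D) :+ (a :- b :* Q) :* (K :* N)
                 := K :* (a :* N :+ b :* D)) ≋-refl K I.β Q I.N I.D I.α ⟩
          K *ₚ (I.α *ₚ I.N +ₚ I.β *ₚ I.D)
            ≈⟨ *ₚ-congˡ {K} I.bezout ⟩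
          K *ₚ C I.m
            ≈⟨ C-homo-* (coeff B e ℤ.^ k) I.m ⟨
          C (coeff B e ℤ.^ k ℤ.* I.m) ∎
      }
      where
      K = C (coeff B e ℤ.^ k)
      module I = Bezout (bezout-below n B R (Below-mono {p = R} e≤n bR))

  -- Contents and reduced fractions

  content : Poly → ℕ
  content []      = 0
  content (a ∷ p) = gcd ℤ.∣ a ∣ (content p)

  content-∣ : ∀ p i → content p ∣ ℤ.∣ coeff p i ∣
  content-∣ []      i       = ℕ∣.∣-refl
  content-∣ (a ∷ p) zero    = gcd[m,n]∣m ℤ.∣ a ∣ (content p)
  content-∣ (a ∷ p) (suc i) = ℕ∣.∣-trans (gcd[m,n]∣n ℤ.∣ a ∣ (content p)) (content-∣ p i)

  content-greatest : ∀ p {k} → (∀ i → k ∣ ℤ.∣ coeff p i ∣) → k ∣ content p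
  content-greatest []      h = _ ℕ∣.∣0
  content-greatest (a ∷ p) h = gcd-greatest (h 0) (content-greatest p (λ i → h (suc i)))

  divide-by : ∀ g p → (∀ i → g ∣ ℤ.∣ coeff p i ∣) → ∃ λ r → (+ g) · r ≋ p
  divide-by g []      h = [] , ≋-refl
  divide-by g (a ∷ p) h with divide-by g p (λ i → h (suc i)) | ℤ∣.∣ᵤ⇒∣ {+ g} {a} (h 0)
  ... | r , e | ℤ∣.divides b a≡ = b ∷ r , ∷-cong (≡.trans (ℤₚ.*-comm (+ g) b) (≡.sym a≡)) e

  constant-divisor : ∀ c x m → m ≢ + 0 → c *ₚ x ≋ C m → ∃ λ k → c ≋ C k
  constant-divisor c x m m≢0 e with degree? c | degree? x
  ... | inj₁ z | _ = ⊥-elim (m≢0 (≡.trans (≡.sym (at e 0)) (at (*ₚ-zeroˡ x z) 0)))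
  ... | inj₂ _ | inj₁ z = ⊥-elim (m≢0 (≡.trans (≡.sym (at e 0)) (at (≋-trans (*ₚ-congˡ {c} z) (*ₚ-zeroʳ c)) 0)))
  ... | inj₂ (suc d , h) | inj₂ (f , k) = ⊥-elim (proj₁ (*-degree {c} {x} h k) (at e (suc (d ℕ.+ f))))
  ... | inj₂ (zero , _ , b) | inj₂ _ = coeff c 0 , mk λ { zero → ≡.refl ; (suc i) → b (suc i) (s≤s z≤n) }

  unit-square : ∀ k → ℤ.∣ k ∣ ≡ 1 → k ℤ.* k ≡ + 1
  unit-square (+ _)      ≡.refl = ≡.refl
  unit-square (-[1+ _ ]) ≡.refl = ≡.refl

  record Reduced (A B : Poly) : Set where
    field
      N D      : Poly
      D≢0      : ¬ D ≋ []
      fraction : N *ₚ B ≋ A *ₚ D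
      coprime  : CoprimeₚP N D

  -- The Bézout relation has disposed of all non-constant common factors; dividing by the gcd `g` of
  -- the two contents disposes of the constant ones.
  reduce-bezout : ∀ {A B} → ¬ B ≋ [] → Bezout A B → Reduced A B
  reduce-bezout {A} {B} B≢0 Z = record { N = N ; D = D ; D≢0 = D≢0 ; fraction = frac ; coprime = cop }
    where
    module Z = Bezout Z
    g = gcd (content Z.N) (content Z.D)
    divN = divide-by g Z.N (λ i → ℕ∣.∣-trans (gcd[m,n]∣m _ (content Z.D)) (content-∣ Z.N i))
    divD = divide-by g Z.D (λ i → ℕ∣.∣-trans (gcd[m,n]∣n (content Z.N) _) (content-∣ Z.D i))
    N = proj₁ divN
    D = proj₁ divD
    gN : C (+ g) *ₚ N ≋ Z.N
    gN = ≋-trans (C-* (+ g) N) (proj₂ divN)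
    gD : C (+ g) *ₚ D ≋ Z.D
    gD = ≋-trans (C-* (+ g) D) (proj₂ divD)
    u = Z.α *ₚ N +ₚ Z.β *ₚ D
    gu : C (+ g) *ₚ u ≋ C Z.m
    gu = begin
      C (+ g) *ₚ u
        ≈⟨ solve 5 (λ g a n b d → g :* (a :* n :+ b :* d) := a :* (g :* n) :+ b :* (g :* d)) ≋-refl (C (+ g)) Z.α N Z.β D ⟩
      Z.α *ₚ (C (+ g) *ₚ N) +ₚ Z.β *ₚ (C (+ g) *ₚ D)
        ≈⟨ +ₚ-cong (*ₚ-congˡ {Z.α} gN) (*ₚ-congˡ {Z.β} gD) ⟩
      Z.α *ₚ Z.N +ₚ Z.β *ₚ Z.D
        ≈⟨ Z.bezout ⟩
      C Z.m ∎
    Cm≢0 : ¬ C Z.m ≋ []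
    Cm≢0 e = Z.m≢0 (at e 0)
    Cg≢0 : ¬ C (+ g) ≋ []
    Cg≢0 e = Cm≢0 (≋-trans (≋-sym gu) (*ₚ-zeroˡ u e))
    frac : N *ₚ B ≋ A *ₚ D
    frac = *ₚ-cancelˡ Cg≢0 (begin
      C (+ g) *ₚ (N *ₚ B)   ≈⟨ *ₚ-assoc (C (+ g)) N B ⟨
      C (+ g) *ₚ N *ₚ B     ≈⟨ *ₚ-congʳ {B} gN ⟩
      Z.N *ₚ B              ≈⟨ Z.fraction ⟩
      A *ₚ Z.D              ≈⟨ *ₚ-congˡ {A} gD ⟨
      A *ₚ (C (+ g) *ₚ D)   ≈⟨ solve 3 (λ a g d → a :* (g :* d) := g :* (a :* d)) ≋-refl A (C (+ g)) D ⟩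
      C (+ g) *ₚ (A *ₚ D)   ∎)
    D≢0 : ¬ D ≋ []
    D≢0 D≋0 = Cm≢0 (≋-trans (≋-sym gu) (≋-trans (*ₚ-congˡ {C (+ g)} u≋0) (*ₚ-zeroʳ (C (+ g)))))
      where
      N≋0 : N ≋ []
      N≋0 = *ₚ-integral B≢0 (≋-trans (*ₚ-comm B N) (≋-trans frac (≋-trans (*ₚ-congˡ {A} D≋0) (*ₚ-zeroʳ A))))
      u≋0 : u ≋ []
      u≋0 = +ₚ-cong (≋-trans (*ₚ-congˡ {Z.α} N≋0) (*ₚ-zeroʳ Z.α)) (≋-trans (*ₚ-congˡ {Z.β} D≋0) (*ₚ-zeroʳ Z.β))
    -- A common divisor c divides the constant `Z.m`, so it is a constant k. Then g k divides every
    -- coefficient of `Z.N` and `Z.D`, hence g itself, and k = ±1.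
    cop : CoprimeₚP N D
    cop c (x , cx) (y , cy) = C k , at (≋-trans (*ₚ-congʳ {C k} c≋k) (≋-trans (≋-sym (C-homo-* k k)) (C-cong (unit-square k k-unit))))
      where
      cw : c *ₚ (C (+ g) *ₚ (Z.α *ₚ x +ₚ Z.β *ₚ y)) ≋ C Z.m
      cw = begin
        c *ₚ (C (+ g) *ₚ (Z.α *ₚ x +ₚ Z.β *ₚ y))
          ≈⟨ solve 6 (λ c g a x b y → c :* (g :* (a :* x :+ b :* y)) := g :* (a :* (c :* x) :+ b :* (c :* y))) ≋-refl c (C (+ g)) Z.α x Z.β y ⟩
        C (+ g) *ₚ (Z.α *ₚ (c *ₚ x) +ₚ Z.β *ₚ (c *ₚ y))
          ≈⟨ *ₚ-congˡ {C (+ g)} (+ₚ-cong (*ₚ-congˡ {Z.α} (mk cx)) (*ₚ-congˡ {Z.β} (mk cy))) ⟩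
        C (+ g) *ₚ u ≈⟨ gu ⟩
        C Z.m ∎
      const = constant-divisor c (C (+ g) *ₚ (Z.α *ₚ x +ₚ Z.β *ₚ y)) Z.m Z.m≢0 cw
      k = proj₁ const
      c≋k = proj₂ const
      divides-coeff : ∀ p s t → C (+ g) *ₚ p ≋ s → c *ₚ t ≋ p → ∀ i → g ℕ.* ℤ.∣ k ∣ ∣ ℤ.∣ coeff s i ∣
      divides-coeff p s t gp ct i = ℕ∣.divides ℤ.∣ coeff t i ∣ (≡.trans (cong ℤ.∣_∣ (≡.trans (≡.sym (at gp i)) (≡.trans (at (C-* (+ g) p) i) (≡.trans (coeff-· (+ g) p i)
        (cong ((+ g) ℤ.*_) (≡.trans (≡.sym (at ct i)) (≡.trans (at (*ₚ-congʳ {t} c≋k) i) (≡.trans (at (C-* k t) i) (coeff-· k t i)))))))))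
        (≡.trans (ℤₚ.abs-* (+ g) _) (≡.trans (cong (g ℕ.*_) (ℤₚ.abs-* k _)) (≡.trans (≡.sym (ℕₚ.*-assoc g _ _)) (ℕₚ.*-comm _ ℤ.∣ coeff t i ∣)))))
      gk∣g : g ℕ.* ℤ.∣ k ∣ ∣ g
      gk∣g = gcd-greatest (content-greatest Z.N (divides-coeff N Z.N x gN (mk cx))) (content-greatest Z.D (divides-coeff D Z.D y gD (mk cy)))
      ∣k∣≡1 : ∀ g → C (+ g) ≋ [] ⊎ (g ℕ.* ℤ.∣ k ∣ ∣ g → ℤ.∣ k ∣ ≡ 1)
      ∣k∣≡1 zero    = inj₁ C-0
      ∣k∣≡1 (suc g) = inj₂ λ h → ℕ∣.∣1⇒≡1 (ℕ∣.*-cancelˡ-∣ (suc g) (≡.subst (suc g ℕ.* ℤ.∣ k ∣ ∣_) (≡.sym (ℕₚ.*-identityʳ (suc g))) h))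
      k-unit : ℤ.∣ k ∣ ≡ 1
      k-unit = [ (λ z → ⊥-elim (Cg≢0 z)) , (λ f → f gk∣g) ]′ (∣k∣≡1 g)

  reduced : ∀ A B → ¬ B ≋ [] → Reduced A B
  reduced A B B≢0 = reduce-bezout B≢0 (bezout-below _ A B (proj₂ (some-bound B)))

  -- Divisibility by monic polynomials

  infix 4 _∣′_
  record _∣′_ (d a : Poly) : Set where
    constructor _,_
    field
      quotient : Poly
      equality : d *ₚ quotient ≋ a
  open _∣′_

  ∣′-trans : ∀ {a b c} → a ∣′ b → b ∣′ c → a ∣′ c
  ∣′-trans {a} (x , e) (y , f) = x *ₚ y , ≋-trans (≋-sym (*ₚ-assoc a x y)) (≋-trans (*ₚ-congʳ {y} e) f)

  ∣′-resp : ∀ {a b c} → b ≋ c → a ∣′ b → a ∣′ c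
  ∣′-resp e (x , f) = x , ≋-trans f e

  ∣′-*ʳ : ∀ {a b} c → a ∣′ b → a ∣′ b *ₚ c
  ∣′-*ʳ {a} c (x , e) = x *ₚ c , ≋-trans (≋-sym (*ₚ-assoc a x c)) (*ₚ-congʳ {c} e)

  ∣′-*ˡ : ∀ {a b} c → a ∣′ b → a ∣′ c *ₚ b
  ∣′-*ˡ {a} {b} c (x , e) = c *ₚ x , ≋-trans (solve 3 (λ a c x → a :* (c :* x) := c :* (a :* x)) ≋-refl a c x) (*ₚ-congˡ {c} e)

  ∣′-+ : ∀ {a b c} → a ∣′ b → a ∣′ c → a ∣′ b +ₚ c
  ∣′-+ {a} (x , e) (y , f) = x +ₚ y , ≋-trans (solve 3 (λ a x y → a :* (x :+ y) := a :* x :+ a :* y) ≋-refl a x y) (+ₚ-cong e f)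

  Monic : Poly → Set
  Monic p = ∃ λ e → coeff p e ≡ + 1 × Below (suc e) p

  monic-degree : ∀ {p} (m : Monic p) → HasDegree p (proj₁ m)
  monic-degree (e , l , b) = (λ z → case (≡.trans (≡.sym l) z)) , b
    where
    case : + 1 ≡ + 0 → ⊥
    case ()

  monic-nonzero : ∀ {p} → Monic p → ¬ p ≋ []
  monic-nonzero {p} m = degree-nonzero {p} (monic-degree {p} m)

  monic-1 : Monic 1ₚ
  monic-1 = 0 , ≡.refl , λ { (suc i) _ → ≡.refl }

  monic-* : ∀ {p r} → Monic p → Monic r → Monic (p *ₚ r)
  monic-* {p} {r} (d , lp , bp) (e , lr , br) with coeff-*-top d e p r bp br
  ... | t , b = d ℕ.+ e , ≡.trans t (cong₂ ℤ._*_ lp lr) , b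

  degree-unique : ∀ {p d e} → HasDegree p d → HasDegree p e → d ≡ e
  degree-unique {p} {d} {e} (l , b) (l′ , b′) with ℕₚ.<-cmp d e
  ... | tri< d<e _ _ = ⊥-elim (l′ (b e d<e))
  ... | tri≈ _ d≡e _ = d≡e
  ... | tri> _ _ e<d = ⊥-elim (l (b′ d e<d))

  monic-cofactor : ∀ {p r s} → Monic p → p *ₚ r ≋ s → Monic s → Monic r
  monic-cofactor {p} {r} {s} mp@(d , lp , bp) e ms with degree? r
  ... | inj₁ z = ⊥-elim (monic-nonzero {s} ms (≋-trans (≋-sym e) (≋-trans (*ₚ-congˡ {p} z) (*ₚ-zeroʳ p))))
  ... | inj₂ (f , lr , br) = f , lead , br
    where
    pr = *-degree {p} {r} (monic-degree {p} mp) (lr , br)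
    deg : d ℕ.+ f ≡ proj₁ ms
    deg = degree-unique {p *ₚ r} pr ((λ z → proj₁ (monic-degree {s} ms) (≡.trans (≡.sym (at e _)) z)) , Below-resp {p = s} {p *ₚ r} (≋-sym e) (proj₂ (proj₂ ms)))
    lead : coeff r f ≡ + 1
    lead = ≡.trans (≡.sym (ℤₚ.*-identityˡ _)) (≡.trans (cong (ℤ._* coeff r f) (≡.sym lp)) (≡.trans (≡.sym (proj₁ (coeff-*-top d f p r bp br)))
      (≡.trans (at e _) (≡.trans (cong (coeff s) deg) (proj₁ (proj₂ ms))))))

  -- Let R be the remainder of A modulo P. Then m R is a multiple of P of degree below that of P, so
  -- R = 0.
  monic-∣-constant* : ∀ {P A m} → Monic P → m ≢ + 0 → P ∣′ C m *ₚ A → P ∣′ A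
  monic-∣-constant* {P} {A} {m} (e , l , bP) m≢0 (Z , PZ≋) = go (pseudo-divide P e bP _ A (proj₂ (some-bound A)))
    where
    go : (∃ λ k → ∃ λ Q → ∃ λ R → C (coeff P e ℤ.^ k) *ₚ A ≋ Q *ₚ P +ₚ R × Below e R) → P ∣′ A
    go (k , Q , R , eq , bR) = Q , (begin
      P *ₚ Q           ≈⟨ *ₚ-comm P Q ⟩
      Q *ₚ P           ≈⟨ +-identityʳ _ ⟨
      Q *ₚ P +ₚ []     ≈⟨ +ₚ-congˡ {Q *ₚ P} (≋-sym R≋0) ⟩
      Q *ₚ P +ₚ R      ≈⟨ A≋ ⟨
      A                ∎)
      where
      A≋ : A ≋ Q *ₚ P +ₚ R
      A≋ = ≋-trans (≋-sym (*ₚ-identityˡ A)) (≋-trans (*ₚ-congʳ {A} (C-cong (≡.sym (≡.trans (cong (ℤ._^ k) l) (ℤₚ.^-zeroˡ k))))) eq)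
      mR : C m *ₚ R ≋ P *ₚ (Z -ₚ C m *ₚ Q)
      mR = begin
        C m *ₚ R                               ≈⟨ solve 4 (λ m r q p → m :* r := m :* (q :* p :+ r) :- p :* (m :* q)) ≋-refl (C m) R Q P ⟩
        C m *ₚ (Q *ₚ P +ₚ R) -ₚ P *ₚ (C m *ₚ Q) ≈⟨ +ₚ-congʳ {negₚ (P *ₚ (C m *ₚ Q))} (≋-trans (*ₚ-congˡ {C m} (≋-sym A≋)) (≋-sym PZ≋)) ⟩
        P *ₚ Z -ₚ P *ₚ (C m *ₚ Q)              ≈⟨ solve 3 (λ p z q → p :* z :- p :* q := p :* (z :- q)) ≋-refl P Z (C m *ₚ Q) ⟩
        P *ₚ (Z -ₚ C m *ₚ Q)                   ∎
      R≋0 : R ≋ []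
      R≋0 with degree? (Z -ₚ C m *ₚ Q)
      ... | inj₁ z = *ₚ-integral {C m} (λ z′ → m≢0 (at z′ 0)) (≋-trans mR (≋-trans (*ₚ-congˡ {P} z) (*ₚ-zeroʳ P)))
      ... | inj₂ (f , h) = ⊥-elim (proj₁ (*-degree {P} {Z -ₚ C m *ₚ Q} (monic-degree {P} (e , l , bP)) h)
              (≡.trans (≡.sym (at mR (e ℕ.+ f))) (Below-C* m R bR (e ℕ.+ f) (ℕₚ.m≤m+n e f))))

  -- Y becomes invertible in ℚ[q]/(P).
  record UnitMod (P Y : Poly) : Set where
    field
      v w : Poly
      m   : ℤ
      m≢0 : m ≢ + 0
      inv : v *ₚ Y +ₚ w *ₚ P ≋ C m

  unit-1 : ∀ {P} → UnitMod P 1ₚ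
  unit-1 = record { v = 1ₚ ; w = [] ; m = + 1 ; m≢0 = λ () ; inv = ≋-refl }

  unit-* : ∀ {P Y Z} → UnitMod P Y → UnitMod P Z → UnitMod P (Y *ₚ Z)
  unit-* {P} {Y} {Z} U V = record
    { v = U.v *ₚ V.v ; w = U.w *ₚ (V.v *ₚ Z +ₚ V.w *ₚ P) +ₚ U.v *ₚ Y *ₚ V.w ; m = U.m ℤ.* V.m
    ; m≢0 = ℤ-*-nonzero U.m≢0 V.m≢0
    ; inv = begin
        U.v *ₚ V.v *ₚ (Y *ₚ Z) +ₚ (U.w *ₚ (V.v *ₚ Z +ₚ V.w *ₚ P) +ₚ U.v *ₚ Y *ₚ V.w) *ₚ P
          ≈⟨ solve 7 (λ a b y z c d p → a :* b :* (y :* z) :+ (c :* (b :* z :+ d :* p) :+ a :* y :* d) :* p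
               := (a :* y :+ c :* p) :* (b :* z :+ d :* p)) ≋-refl U.v V.v Y Z U.w V.w P ⟩
        (U.v *ₚ Y +ₚ U.w *ₚ P) *ₚ (V.v *ₚ Z +ₚ V.w *ₚ P)
          ≈⟨ *ₚ-cong U.inv V.inv ⟩
        C U.m *ₚ C V.m ≈⟨ C-homo-* U.m V.m ⟨
        C (U.m ℤ.* V.m) ∎ }
    where
    module U = UnitMod U
    module V = UnitMod V

  unit-factor : ∀ {P Y Z} → Y ∣′ Z → UnitMod P Z → UnitMod P Y
  unit-factor {P} {Y} {Z} (c , e) U = record
    { v = U.v *ₚ c ; w = U.w ; m = U.m ; m≢0 = U.m≢0
    ; inv = ≋-trans (+ₚ-congʳ {U.w *ₚ P} (≋-trans (solve 3 (λ v c y → v :* c :* y := v :* (y :* c)) ≋-refl U.v c Y) (*ₚ-congˡ {U.v} e))) U.inv }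
    where module U = UnitMod U

  unit-sym : ∀ {P Y} → UnitMod P Y → UnitMod Y P
  unit-sym {P} {Y} U = record { v = U.w ; w = U.v ; m = U.m ; m≢0 = U.m≢0 ; inv = ≋-trans (+ₚ-comm (U.w *ₚ P) _) U.inv }
    where module U = UnitMod U

  -- Multiplying v Y + w P = m by A shows that P divides m A, and monicity removes m.
  unit-cancel : ∀ {P Y A} → Monic P → UnitMod P Y → P ∣′ Y *ₚ A → P ∣′ A
  unit-cancel {P} {Y} {A} mP U d = monic-∣-constant* {P} mP U.m≢0 (∣′-resp eq
    (∣′-+ (∣′-*ˡ U.v d) (∣′-*ʳ (U.w *ₚ A) (1ₚ , *ₚ-identityʳ P))))
    where
    module U = UnitMod U
    eq : U.v *ₚ (Y *ₚ A) +ₚ P *ₚ (U.w *ₚ A) ≋ C U.m *ₚ A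
    eq = ≋-trans (solve 5 (λ v y a p w → v :* (y :* a) :+ p :* (w :* a) := (v :* y :+ w :* p) :* a) ≋-refl U.v Y A P U.w)
           (*ₚ-congʳ {A} U.inv)

  -- Invertibility modulo P is enough: cancel Y once, divide everything by P, and cancel Y again
  -- from the quotient.
  unit-cancel² : ∀ {P Y A} → Monic P → UnitMod P Y → P *ₚ P ∣′ Y *ₚ A → P *ₚ P ∣′ A
  unit-cancel² {P} {Y} {A} mP U d@(z , ez) = go (unit-cancel {P} {Y} mP U (∣′-trans {P} (P , ≋-refl) d))
    where
    go : P ∣′ A → P *ₚ P ∣′ A
    go (B , PB≋A) = go′ (unit-cancel {P} {Y} mP U (z , *ₚ-cancelˡ (monic-nonzero {P} mP) (begin
        P *ₚ (P *ₚ z)   ≈⟨ *ₚ-assoc P P z ⟨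
        P *ₚ P *ₚ z     ≈⟨ ez ⟩
        Y *ₚ A          ≈⟨ *ₚ-congˡ {Y} PB≋A ⟨
        Y *ₚ (P *ₚ B)   ≈⟨ solve 3 (λ y p b → y :* (p :* b) := p :* (y :* b)) ≋-refl Y P B ⟩
        P *ₚ (Y *ₚ B)   ∎)))
      where
      go′ : P ∣′ B → P *ₚ P ∣′ A
      go′ (c , e) = c , ≋-trans (*ₚ-assoc P P c) (≋-trans (*ₚ-congˡ {P} e) PB≋A)

  -- The polynomials q^n - 1

  X^-+ : ∀ m n → X^ (m ℕ.+ n) ≋ X^ m *ₚ X^ n
  X^-+ zero    n = ≋-sym (*ₚ-identityˡ (X^ n))
  X^-+ (suc m) n = ≋-trans (∷-cong ≡.refl (X^-+ m n)) (≋-sym (PolyLaws.shift-*ₚ (X^ m) (X^ n)))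

  X^-1 : ℕ → Poly
  X^-1 n = X^ n -ₚ 1ₚ

  X^-1-+ : ∀ m n → X^-1 (m ℕ.+ n) ≋ X^ m *ₚ X^-1 n +ₚ X^-1 m
  X^-1-+ m n = ≋-trans (+ₚ-congʳ {negₚ 1ₚ} (X^-+ m n))
    (solve 2 (λ a b → a :* b :- con (+ 1) := a :* (b :- con (+ 1)) :+ (a :- con (+ 1))) ≋-refl (X^ m) (X^ n))

  geometric : ℕ → ℕ → Poly
  geometric g zero    = []
  geometric g (suc k) = 1ₚ +ₚ X^ g *ₚ geometric g k

  geometric-* : ∀ g k → X^-1 g *ₚ geometric g k ≋ X^-1 (k ℕ.* g)
  geometric-* g zero = ≋-trans (*ₚ-zeroʳ (X^-1 g)) (mk λ { zero → ≡.refl ; (suc i) → ≡.refl })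
  geometric-* g (suc k) = begin
    X^-1 g *ₚ (1ₚ +ₚ X^ g *ₚ geometric g k)
      ≈⟨ solve 3 (λ a x s → a :* (con (+ 1) :+ x :* s) := x :* (a :* s) :+ a) ≋-refl (X^-1 g) (X^ g) (geometric g k) ⟩
    X^ g *ₚ (X^-1 g *ₚ geometric g k) +ₚ X^-1 g
      ≈⟨ +ₚ-congʳ {X^-1 g} (*ₚ-congˡ {X^ g} (geometric-* g k)) ⟩
    X^ g *ₚ X^-1 (k ℕ.* g) +ₚ X^-1 g
      ≈⟨ X^-1-+ g (k ℕ.* g) ⟨
    X^-1 (suc k ℕ.* g) ∎

  -- Modulo q^g - 1 every power of q^g is 1.
  geometric-mod : ∀ g k → ∃ λ w → geometric g k ≋ C (+ k) +ₚ w *ₚ X^-1 g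
  geometric-mod g zero = [] , mk λ { zero → ≡.refl ; (suc i) → ≡.refl }
  geometric-mod g (suc k) with geometric-mod g k
  ... | w , e = geometric g k +ₚ w , (begin
    1ₚ +ₚ X^ g *ₚ geometric g k
      ≈⟨ solve 2 (λ x s → con (+ 1) :+ x :* s := con (+ 1) :+ s :+ s :* (x :- con (+ 1))) ≋-refl (X^ g) (geometric g k) ⟩
    1ₚ +ₚ geometric g k +ₚ geometric g k *ₚ X^-1 g
      ≈⟨ +ₚ-congʳ {geometric g k *ₚ X^-1 g} (+ₚ-congˡ {1ₚ} e) ⟩
    1ₚ +ₚ (C (+ k) +ₚ w *ₚ X^-1 g) +ₚ geometric g k *ₚ X^-1 g
      ≈⟨ solve 4 (λ c w x s → con (+ 1) :+ (c :+ w :* x) :+ s :* x := (con (+ 1) :+ c) :+ (s :+ w) :* x) ≋-refl (C (+ k)) w (X^-1 g) (geometric g k) ⟩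
    C (+ suc k) +ₚ (geometric g k +ₚ w) *ₚ X^-1 g ∎)

  X^-1-∣ : ∀ {d n} → d ∣ n → X^-1 d ∣′ X^-1 n
  X^-1-∣ {d} (ℕ∣.divides k ≡.refl) = geometric d k , geometric-* d k

  X^-1-difference : ∀ d m n → d ℕ.+ n ≡ m → X^-1 d ≋ X^-1 m +ₚ negₚ (X^ d) *ₚ X^-1 n
  X^-1-difference d m n ≡.refl = ≋-trans
    (solve 3 (λ a x b → a := (x :* b :+ a) :+ (:- x) :* b) ≋-refl (X^-1 d) (X^ d) (X^-1 n))
    (+ₚ-congʳ {negₚ (X^ d) *ₚ X^-1 n} (≋-sym (X^-1-+ d n)))

  -- A Bézout identity g + y b = x a between the exponents gives q^g - 1 = (q^(xa) - 1) - q^g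
  -- (q^(yb) - 1), and the two terms are multiples of q^a - 1 and q^b - 1.
  X^-1-gcd : ∀ a b → ∃ λ u → ∃ λ v → u *ₚ X^-1 a +ₚ v *ₚ X^-1 b ≋ X^-1 (gcd a b)
  X^-1-gcd a b with Bézout.identity (gcd-GCD a b)
  ... | Bézout.+- x y e = geometric a x , negₚ (X^ (gcd a b)) *ₚ geometric b y , ≋-trans
          (solve 5 (λ s a n b t → s :* a :+ n :* t :* b := a :* s :+ n :* (b :* t)) ≋-refl (geometric a x) (X^-1 a) (negₚ (X^ (gcd a b))) (X^-1 b) (geometric b y))
          (≋-trans (+ₚ-cong (geometric-* a x) (*ₚ-congˡ {negₚ (X^ (gcd a b))} (geometric-* b y))) (≋-sym (X^-1-difference (gcd a b) _ _ e)))
  ... | Bézout.-+ x y e = negₚ (X^ (gcd a b)) *ₚ geometric a x , geometric b y , ≋-trans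
          (solve 5 (λ s a n b t → n :* s :* a :+ t :* b := b :* t :+ n :* (a :* s)) ≋-refl (geometric a x) (X^-1 a) (negₚ (X^ (gcd a b))) (X^-1 b) (geometric b y))
          (≋-trans (+ₚ-cong (geometric-* b y) (*ₚ-congˡ {negₚ (X^ (gcd a b))} (geometric-* a x))) (≋-sym (X^-1-difference (gcd a b) _ _ e)))

  X^-monic : ∀ n → coeff (X^ n) n ≡ + 1 × Below (suc n) (X^ n)
  X^-monic zero    = ≡.refl , λ { (suc i) _ → ≡.refl }
  X^-monic (suc n) with X^-monic n
  ... | l , b = l , λ { (suc i) (s≤s h) → b i h }

  X^-1-monic : ∀ n → Monic (X^-1 (suc n))
  X^-1-monic n with X^-monic n
  ... | l , b = suc n , ≡.trans (coeff-+ (X^ n) [] n) (cong (ℤ._+ + 0) l)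
              , λ { (suc i) (s≤s h) → ≡.trans (coeff-+ (X^ n) [] i) (cong (ℤ._+ + 0) (b i h)) }

  -- Finite products of polynomials

  productTo : (ℕ → Poly) → ℕ → Poly
  productTo h zero    = 1ₚ
  productTo h (suc k) = productTo h k *ₚ h (suc k)

  productTo-cong : ∀ {h h′} k → (∀ d → d ≤ k → h d ≋ h′ d) → productTo h k ≋ productTo h′ k
  productTo-cong zero    e = ≋-refl
  productTo-cong (suc k) e = *ₚ-cong (productTo-cong k (λ d d≤k → e d (ℕₚ.m≤n⇒m≤1+n d≤k))) (e (suc k) ℕₚ.≤-refl)

  productTo-∣ : ∀ {h h′} k → (∀ d → d ≤ k → h d ∣′ h′ d) → productTo h k ∣′ productTo h′ k
  productTo-∣ zero    e = 1ₚ , ≋-refl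
  productTo-∣ {h} {h′} (suc k) e with productTo-∣ {h} {h′} k (λ d d≤k → e d (ℕₚ.m≤n⇒m≤1+n d≤k)) | e (suc k) ℕₚ.≤-refl
  ... | x , p | y , r = x *ₚ y , ≋-trans (solve 4 (λ a b x y → a :* b :* (x :* y) := (a :* x) :* (b :* y)) ≋-refl (productTo h k) (h (suc k)) x y) (*ₚ-cong p r)

  productTo-mono-∣ : ∀ h {j k} → j ≤ k → productTo h j ∣′ productTo h k
  productTo-mono-∣ h {zero}  {zero}  _ = 1ₚ , ≋-refl
  productTo-mono-∣ h {j} {suc k} j≤ with ℕₚ.m≤n⇒m<n∨m≡n j≤
  ... | inj₁ (s≤s j≤k) = ∣′-*ʳ (h (suc k)) (productTo-mono-∣ h j≤k)
  ... | inj₂ ≡.refl    = 1ₚ , *ₚ-identityʳ _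

  productTo-square : ∀ h k → productTo (λ d → h d *ₚ h d) k ≋ productTo h k *ₚ productTo h k
  productTo-square h zero    = ≋-refl
  productTo-square h (suc k) = ≋-trans (*ₚ-congʳ {h (suc k) *ₚ h (suc k)} (productTo-square h k))
    (solve 2 (λ a b → a :* a :* (b :* b) := a :* b :* (a :* b)) ≋-refl (productTo h k) (h (suc k)))

  productTo-monic : ∀ {h} k → (∀ d → d < k → Monic (h (suc d))) → Monic (productTo h k)
  productTo-monic zero m = monic-1
  productTo-monic {h} (suc k) m = monic-* {productTo h k} (productTo-monic k (λ d d<k → m d (ℕₚ.m≤n⇒m≤1+n d<k))) (m k ℕₚ.≤-refl)

  -- Pairwise coprimality enters as a cancellation rule, a form that also fits the squares and the
  -- trivial factors 1 occurring in `select`. A new factor is moved past the earlier ones until it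
  -- divides the last cofactor.
  productTo-∣-common : ∀ h k {N} → (∀ d → d < k → h (suc d) ∣′ N) →
    (∀ d e A → d < e → e < k → h (suc e) ∣′ h (suc d) *ₚ A → h (suc e) ∣′ A) → productTo h k ∣′ N
  productTo-∣-common h zero    {N} div cop = N , *ₚ-identityˡ N
  productTo-∣-common h (suc k) {N} div cop
    with productTo-∣-common h k (λ d d<k → div d (ℕₚ.m≤n⇒m≤1+n d<k)) (λ d e A d<e e<k → cop d e A d<e (ℕₚ.m≤n⇒m≤1+n e<k))
  ... | Z , e = quotient last , ≋-trans (*ₚ-assoc (productTo h k) _ _) (≋-trans (*ₚ-congˡ {productTo h k} (equality last)) e)
    where
    strip : ∀ j → j ≤ k → h (suc k) ∣′ productTo h j *ₚ Z → h (suc k) ∣′ Z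
    strip zero    _   d = ∣′-resp (*ₚ-identityˡ Z) d
    strip (suc j) j<k d = strip j (ℕₚ.<⇒≤ j<k) (cop j k _ j<k ℕₚ.≤-refl (∣′-resp
      (solve 3 (λ a b z → a :* b :* z := b :* (a :* z)) ≋-refl (productTo h j) (h (suc j)) Z) d))
    last : h (suc k) ∣′ Z
    last = strip k ℕₚ.≤-refl (∣′-resp (≋-sym e) (div k ℕₚ.≤-refl))

  -- Cyclotomic polynomials

  choose : ∀ {A : Set} → Dec A → Poly → Poly → Poly
  choose (yes _) p r = p
  choose (no  _) p r = r

  -- Non-divisors of m contribute 1, which turns products over the divisors of m into products over
  -- an interval.
  select : (ℕ → Poly) → ℕ → ℕ → Poly
  select f m d = choose (d ∣? m) (f d) 1ₚ

  select-yes : ∀ f {m d} → d ∣ m → select f m d ≡ f d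
  select-yes f {m} {d} d∣m with d ∣? m
  ... | yes _ = ≡.refl
  ... | no  h = ⊥-elim (h d∣m)

  1∣′ : ∀ A → 1ₚ ∣′ A
  1∣′ A = A , *ₚ-identityˡ A

  -- f d plays the role of the d-th cyclotomic polynomial for 1 ≤ d ≤ n.
  record Cyclotomic (n : ℕ) : Set where
    field
      f       : ℕ → Poly
      monic   : ∀ d → d < n → Monic (f (suc d))
      product : ∀ m → m < n → productTo (select f (suc m)) (suc m) ≋ X^-1 (suc m)

    split : ∀ m → m < n → f (suc m) *ₚ productTo (select f (suc m)) m ≋ X^-1 (suc m)
    split m m<n = ≋-trans (*ₚ-comm (f (suc m)) _) (≋-trans
      (*ₚ-congˡ {productTo (select f (suc m)) m} (≋-sym (≋-reflexive (select-yes f ℕ∣.∣-refl)))) (product m m<n))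

    f-∣ : ∀ m → m < n → f (suc m) ∣′ X^-1 (suc m)
    f-∣ m m<n = productTo (select f (suc m)) m , split m m<n

    -- For a proper divisor g of a, the product of the `f d` over d ∣ g is part of the product over
    -- the proper divisors of a. So q^g - 1 divides the cofactor of `f a` in q^a - 1, and `f a`
    -- survives in the quotient (q^a - 1) / (q^g - 1).
    f-∣-geometric : ∀ a → a < n → ∀ g k → suc g < suc a → k ℕ.* suc g ≡ suc a → f (suc a) ∣′ geometric (suc g) k
    f-∣-geometric a a<n g k (s≤s g<a) kg≡a = quotient lower , *ₚ-cancelˡ (monic-nonzero {X^-1 (suc g)} (X^-1-monic g)) (begin
      X^-1 (suc g) *ₚ (f (suc a) *ₚ quotient lower)
        ≈⟨ solve 3 (λ x f l → x :* (f :* l) := f :* (x :* l)) ≋-refl (X^-1 (suc g)) (f (suc a)) (quotient lower) ⟩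
      f (suc a) *ₚ (X^-1 (suc g) *ₚ quotient lower)
        ≈⟨ *ₚ-congˡ {f (suc a)} (equality lower) ⟩
      f (suc a) *ₚ productTo (select f (suc a)) a
        ≈⟨ split a a<n ⟩
      X^-1 (suc a)
        ≡⟨ cong X^-1 kg≡a ⟨
      X^-1 (k ℕ.* suc g)
        ≈⟨ geometric-* (suc g) k ⟨
      X^-1 (suc g) *ₚ geometric (suc g) k ∎)
      where
      sub : ∀ d → d ≤ suc g → select f (suc g) d ∣′ select f (suc a) d
      sub d _ with d ∣? suc g
      ... | no  _   = 1∣′ _
      ... | yes d∣g = 1ₚ , ≋-trans (*ₚ-identityʳ _) (≋-reflexive
                        (≡.sym (select-yes f (ℕ∣.∣-trans d∣g (ℕ∣.divides k (≡.sym kg≡a))))))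
      lower : X^-1 (suc g) ∣′ productTo (select f (suc a)) a
      lower = ∣′-trans {X^-1 (suc g)} {productTo (select f (suc a)) (suc g)}
        (let (c , e) = productTo-∣ {select f (suc g)} {select f (suc a)} (suc g) sub in c , ≋-trans (*ₚ-congʳ {c} (≋-sym (product g (ℕₚ.<-trans g<a a<n)))) e)
        (productTo-mono-∣ (select f (suc a)) g<a)

    -- With g the gcd of `suc a` and i, a proper divisor of `suc a`, and k = (suc a) / g: the
    -- cyclotomic factor divides `geometric g k`, which is k modulo q^g - 1, and q^g - 1 is a
    -- combination of q^(suc a) - 1 and q^i - 1. Hence k lies in the ideal generated by the
    -- cyclotomic factor and q^i - 1.
    unit : ∀ a → a < n → ∀ i → ¬ suc a ∣ i → UnitMod (f (suc a)) (X^-1 i)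
    unit a a<n i a∤i with gcd (suc a) i in g≡ | gcd[m,n]∣m (suc a) i | X^-1-gcd (suc a) i
    ... | zero  | ℕ∣.divides k k≡ | _ = ⊥-elim (ℕₚ.1+n≢0 (≡.trans k≡ (ℕₚ.*-zeroʳ k)))
    ... | suc g | g∣a@(ℕ∣.divides k k≡) | u , v , bez = record
      { v = negₚ (w *ₚ v) ; w = c -ₚ w *ₚ u *ₚ quotient (f-∣ a a<n) ; m = + k ; m≢0 = k≢0
      ; inv = begin
          negₚ (w *ₚ v) *ₚ X^-1 i +ₚ (c -ₚ w *ₚ u *ₚ quotient (f-∣ a a<n)) *ₚ f (suc a)
            ≈⟨ solve 7 (λ w v x c u p f → (:- (w :* v)) :* x :+ (c :- w :* u :* p) :* f
                 := f :* c :- w :* (u :* (f :* p) :+ v :* x)) ≋-refl w v (X^-1 i) c u (quotient (f-∣ a a<n)) (f (suc a)) ⟩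
          f (suc a) *ₚ c -ₚ w *ₚ (u *ₚ (f (suc a) *ₚ quotient (f-∣ a a<n)) +ₚ v *ₚ X^-1 i)
            ≈⟨ +ₚ-cong fc (negₚ-cong (*ₚ-congˡ {w} (≋-trans (+ₚ-congʳ {v *ₚ X^-1 i} (*ₚ-congˡ {u} (equality (f-∣ a a<n)))) bez))) ⟩
          C (+ k) +ₚ w *ₚ X^-1 (suc g) -ₚ w *ₚ X^-1 (suc g)
            ≈⟨ solve 2 (λ k y → k :+ y :- y := k) ≋-refl (C (+ k)) (w *ₚ X^-1 (suc g)) ⟩
          C (+ k) ∎ }
      where
      k≢0 : + k ≢ + 0
      k≢0 ≡.refl = ℕₚ.1+n≢0 k≡
      g<a : suc g < suc a
      g<a = ℕₚ.≤∧≢⇒< (ℕ∣.∣⇒≤ g∣a) (λ g≡a → a∤i (≡.subst (_∣ i) (≡.trans g≡ g≡a) (gcd[m,n]∣n (suc a) i)))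
      geo = f-∣-geometric a a<n g k g<a (≡.sym k≡)
      c = quotient geo
      w = proj₁ (geometric-mod (suc g) k)
      fc : f (suc a) *ₚ c ≋ C (+ k) +ₚ w *ₚ X^-1 (suc g)
      fc = ≋-trans (equality geo) (proj₂ (geometric-mod (suc g) k))

    pairwise : ∀ a b → a < n → b < n → a ≢ b → UnitMod (f (suc a)) (f (suc b))
    pairwise a b a<n b<n a≢b with suc a ∣? suc b
    ... | no  a∤b = unit-factor (f-∣ b b<n) (unit a a<n (suc b) a∤b)
    ... | yes a∣b = unit-sym (unit-factor (f-∣ a a<n) (unit b b<n (suc a)
                      (λ b∣a → a≢b (ℕₚ.suc-injective (ℕ∣.∣-antisym a∣b b∣a)))))

    select-cancel : ∀ m d e A → d < n → e < n → d < e →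
      select f m (suc e) ∣′ select f m (suc d) *ₚ A → select f m (suc e) ∣′ A
    select-cancel m d e A d<n e<n d<e h with suc e ∣? m | suc d ∣? m
    ... | no _  | _     = 1∣′ A
    ... | yes _ | no _  = ∣′-resp (*ₚ-identityˡ A) h
    ... | yes _ | yes _ = unit-cancel {f (suc e)} (monic e e<n) (pairwise e d e<n d<n (λ { ≡.refl → ℕₚ.<-irrefl ≡.refl d<e })) h

    select²-cancel : ∀ m d e A → d < n → e < n → d < e → let s = select f m in
      s (suc e) *ₚ s (suc e) ∣′ s (suc d) *ₚ s (suc d) *ₚ A → s (suc e) *ₚ s (suc e) ∣′ A
    select²-cancel m d e A d<n e<n d<e h with suc e ∣? m | suc d ∣? m
    ... | no _  | _     = 1∣′ A
    ... | yes _ | no _  = ∣′-resp (*ₚ-identityˡ A) h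
    ... | yes _ | yes _ = unit-cancel² {f (suc e)} (monic e e<n) (unit-* u u) h
      where u = pairwise e d e<n d<n (λ { ≡.refl → ℕₚ.<-irrefl ≡.refl d<e })

  -- The new polynomial is the quotient of q^(n+1) - 1 by the product over proper divisors of n + 1;
  -- that this product divides follows from the coprimality of the polynomials already constructed.
  cyclotomic : ∀ n → Cyclotomic n
  cyclotomic zero = record { f = λ _ → 1ₚ ; monic = λ _ () ; product = λ _ () }
  cyclotomic (suc n) = record { f = f′ ; monic = monic′ ; product = product′ }
    where
    open Cyclotomic (cyclotomic n)
    s = select f (suc n)
    sel-∣ : ∀ d → d < n → s (suc d) ∣′ X^-1 (suc n)
    sel-∣ d d<n with suc d ∣? suc n
    ... | no  _   = 1∣′ _
    ... | yes d∣n = ∣′-trans {f (suc d)} (f-∣ d d<n) (X^-1-∣ d∣n)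
    proper : productTo s n ∣′ X^-1 (suc n)
    proper = productTo-∣-common s n sel-∣ (λ d e A d<e e<n → select-cancel (suc n) d e A (ℕₚ.<-trans d<e e<n) e<n d<e)
    Ψ = quotient proper
    sel-monic : ∀ d → d < n → Monic (s (suc d))
    sel-monic d d<n with suc d ∣? suc n
    ... | no  _ = monic-1
    ... | yes _ = monic d d<n
    f′ : ℕ → Poly
    f′ d = choose (d ℕ.≟ suc n) Ψ (f d)
    f′-new : f′ (suc n) ≡ Ψ
    f′-new with suc n ℕ.≟ suc n
    ... | yes _ = ≡.refl
    ... | no  h = ⊥-elim (h ≡.refl)
    f′-old : ∀ d → d ≤ n → f′ d ≡ f d
    f′-old d d≤n with d ℕ.≟ suc n
    ... | yes ≡.refl = ⊥-elim (ℕₚ.1+n≰n d≤n)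
    ... | no  _ = ≡.refl
    monic′ : ∀ d → d < suc n → Monic (f′ (suc d))
    monic′ d (s≤s d≤n) with ℕₚ.m≤n⇒m<n∨m≡n d≤n
    ... | inj₁ d<n    = ≡.subst Monic (≡.sym (f′-old (suc d) d<n)) (monic d d<n)
    ... | inj₂ ≡.refl = ≡.subst Monic (≡.sym f′-new) (monic-cofactor {productTo s n} (productTo-monic n sel-monic) (equality proper) (X^-1-monic n))
    select-old : ∀ m d → d ≤ n → select f′ m d ≋ select f m d
    select-old m d d≤n with d ∣? m
    ... | no  _ = ≋-refl
    ... | yes _ = ≋-reflexive (f′-old d d≤n)
    product′ : ∀ m → m < suc n → productTo (select f′ (suc m)) (suc m) ≋ X^-1 (suc m)
    product′ m (s≤s m≤n) with ℕₚ.m≤n⇒m<n∨m≡n m≤n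
    ... | inj₁ m<n = ≋-trans (productTo-cong (suc m) (λ d d≤m → select-old (suc m) d (ℕₚ.≤-trans d≤m m<n))) (product m m<n)
    ... | inj₂ ≡.refl = ≋-trans (*ₚ-cong (productTo-cong m (λ d d≤m → select-old (suc m) d d≤m))
            (≋-reflexive (≡.trans (select-yes f′ ℕ∣.∣-refl) f′-new))) (equality proper)

  square-∣ : ∀ n (Φ : Cyclotomic (suc n)) {A} → let f = Cyclotomic.f Φ in
    (∀ d → suc d ∣ suc n → f (suc d) *ₚ f (suc d) ∣′ A) → X^-1 (suc n) *ₚ X^-1 (suc n) ∣′ A
  square-∣ n Φ {A} h = let (c , e) = all in c , ≋-trans (*ₚ-congʳ {c} (≋-trans (*ₚ-cong (≋-sym pr) (≋-sym pr)) (≋-sym (productTo-square s (suc n))))) e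
    where
    open Cyclotomic Φ
    s = select f (suc n)
    pr = product n ℕₚ.≤-refl
    each : ∀ d → d < suc n → s (suc d) *ₚ s (suc d) ∣′ A
    each d _ with suc d ∣? suc n
    ... | no  _   = 1∣′ A
    ... | yes d∣n = h d d∣n
    all : productTo (λ d → s d *ₚ s d) (suc n) ∣′ A
    all = productTo-∣-common _ (suc n) each (λ d e A d<e e<n → select²-cancel (suc n) d e A (ℕₚ.<-trans d<e e<n) e<n d<e)

open PolynomialArithmetic
module PR = CommutativeRing PolyLaws.commutativeRing

-- Fields

record Field : Set₁ where
  field
    commutativeRing : CommutativeRing 0ℓ 0ℓ
  open CommutativeRing commutativeRing public
  infix 8 _⁻¹
  field
    _⁻¹       : Carrier → Carrier
    *-inverse : ∀ x → ¬ x ≈ 0# → x * x ⁻¹ ≈ 1#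
    1≉0       : ¬ 1# ≈ 0#

module FieldProperties (F : Field) where
  open Field F
  open IntSolver commutativeRing
  open import Relation.Binary.Reasoning.Setoid setoid

  *-cancelˡ : ∀ {a x y} → ¬ a ≈ 0# → a * x ≈ a * y → x ≈ y
  *-cancelˡ {a} {x} {y} a≉0 e = begin
    x                ≈⟨ *-identityˡ x ⟨
    1# * x           ≈⟨ *-congʳ (*-inverse a a≉0) ⟨
    a * a ⁻¹ * x     ≈⟨ solve 3 (λ a i x → a :* i :* x := i :* (a :* x)) refl a (a ⁻¹) x ⟩
    a ⁻¹ * (a * x)   ≈⟨ *-congˡ e ⟩
    a ⁻¹ * (a * y)   ≈⟨ solve 3 (λ a i x → a :* i :* x := i :* (a :* x)) refl a (a ⁻¹) y ⟨
    a * a ⁻¹ * y     ≈⟨ *-congʳ (*-inverse a a≉0) ⟩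
    1# * y           ≈⟨ *-identityˡ y ⟩
    y                ∎

  *-nonzero : ∀ {a b} → ¬ a ≈ 0# → ¬ b ≈ 0# → ¬ a * b ≈ 0#
  *-nonzero {a} {b} a≉0 b≉0 e = b≉0 (*-cancelˡ a≉0 (trans e (sym (zeroʳ a))))

  inverse-unique : ∀ {a b} → a * b ≈ 1# → b ≈ a ⁻¹
  inverse-unique {a} {b} e = *-cancelˡ a≉0 (trans e (sym (*-inverse a a≉0)))
    where
    a≉0 : ¬ a ≈ 0#
    a≉0 z = 1≉0 (trans (sym e) (trans (*-congʳ z) (zeroˡ b)))

  pow : Carrier → ℕ → Carrier
  pow x zero    = 1#
  pow x (suc k) = pow x k * x

  pow-+ : ∀ x m n → pow x (m ℕ.+ n) ≈ pow x m * pow x n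
  pow-+ x zero    n = sym (*-identityˡ _)
  pow-+ x (suc m) n = trans (*-congʳ (pow-+ x m n)) (solve 3 (λ a b x → a :* b :* x := a :* x :* b) refl _ _ _)

  pow-inverse : ∀ {x y} → x * y ≈ 1# → ∀ k → pow x k * pow y k ≈ 1#
  pow-inverse         e zero    = *-identityˡ _
  pow-inverse {x} {y} e (suc k) = trans (solve 4 (λ a x b y → a :* x :* (b :* y) := (a :* b) :* (x :* y)) refl _ x _ y)
    (trans (*-cong (pow-inverse e k) e) (*-identityˡ _))

  1-cong : ∀ {x y} → x ≈ y → 1# - x ≈ 1# - y
  1-cong e = +-congˡ (-‿cong e)

  poch : Carrier → Carrier → ℕ → Carrier
  poch x b zero    = 1#
  poch x b (suc k) = poch x b k * (1# - x * pow b k)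

  poch-cong : ∀ {x y} b k → x ≈ y → poch x b k ≈ poch y b k
  poch-cong b zero    e = refl
  poch-cong b (suc k) e = *-cong (poch-cong b k e) (1-cong (*-congʳ e))

  poch-shift : ∀ x b k → (1# - x) * poch (b * x) b k ≈ poch x b k * (1# - x * pow b k)
  poch-shift x b zero    = solve 1 (λ x → (con (+ 1) :- x) :* con (+ 1) := con (+ 1) :* (con (+ 1) :- x :* con (+ 1))) refl x
  poch-shift x b (suc k) = begin
    (1# - x) * (poch (b * x) b k * (1# - b * x * pow b k))
      ≈⟨ solve 4 (λ x b p w → (con (+ 1) :- x) :* (p :* (con (+ 1) :- b :* x :* w)) := (con (+ 1) :- x) :* p :* (con (+ 1) :- x :* (w :* b))) refl x b _ _ ⟩
    (1# - x) * poch (b * x) b k * (1# - x * pow b (suc k))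
      ≈⟨ *-congʳ (poch-shift x b k) ⟩
    poch x b (suc k) * (1# - x * pow b (suc k)) ∎

  sumℤ : ℕ → (ℤ → Carrier) → Carrier
  sumℤ zero    f = f (+ 0)
  sumℤ (suc L) f = sumℤ L f + (f (+ suc L) + f -[1+ L ])

  sumℤ-cong : ∀ L {f g : ℤ → Carrier} → (∀ m → f m ≈ g m) → sumℤ L f ≈ sumℤ L g
  sumℤ-cong zero    e = e (+ 0)
  sumℤ-cong (suc L) e = +-cong (sumℤ-cong L e) (+-cong (e _) (e _))

  sumℤ-+ : ∀ L f g → sumℤ L (λ m → f m + g m) ≈ sumℤ L f + sumℤ L g
  sumℤ-+ zero    f g = refl
  sumℤ-+ (suc L) f g = trans (+-congʳ (sumℤ-+ L f g))
    (solve 6 (λ a b c d e h → (a :+ b) :+ ((c :+ d) :+ (e :+ h)) := (a :+ (c :+ e)) :+ (b :+ (d :+ h))) refl _ _ _ _ _ _)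

  sumℤ-* : ∀ L a f → sumℤ L (λ m → a * f m) ≈ a * sumℤ L f
  sumℤ-* zero    a f = refl
  sumℤ-* (suc L) a f = trans (+-congʳ (sumℤ-* L a f))
    (solve 4 (λ a s x y → a :* s :+ (a :* x :+ a :* y) := a :* (s :+ (x :+ y))) refl a _ _ _)

  sumℤ-telescope : ∀ L (G : ℤ → Carrier) → sumℤ L (λ m → G (ℤ.suc m) - G m) ≈ G (+ suc L) - G (ℤ.- (+ L))
  sumℤ-telescope zero    G = refl
  sumℤ-telescope (suc L) G = trans (+-congʳ (sumℤ-telescope L G)) (trans
    (+-congˡ (+-congˡ (+-congʳ (reflexive (≡.cong G (suc-neg {L}))))))
    (solve 4 (λ a b c d → (a :- b) :+ ((c :- a) :+ (b :- d)) := c :- d) refl (G (+ suc L)) (G (ℤ.- (+ L))) (G (+ suc (suc L))) (G -[1+ L ])))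
    where
    suc-neg : ∀ {L} → ℤ.suc -[1+ L ] ≡ ℤ.- (+ L)
    suc-neg {zero}  = ≡.refl
    suc-neg {suc L} = ≡.refl

  sumℤ-single : ∀ L f → (∀ j → f (+ suc j) ≈ 0#) → (∀ j → f -[1+ j ] ≈ 0#) → sumℤ L f ≈ f (+ 0)
  sumℤ-single zero    f p n = refl
  sumℤ-single (suc L) f p n = trans (+-cong (sumℤ-single L f p n) (+-cong (p L) (n L))) (trans (+-congˡ (+-identityˡ _)) (+-identityʳ _))

record Embedding (F : Field) : Set where
  open Field F
  field
    ι           : Poly → Carrier
    ι-cong      : ∀ {a b} → a ≋ b → ι a ≈ ι b
    ι-+         : ∀ a b → ι (a +ₚ b) ≈ ι a + ι b
    ι-*         : ∀ a b → ι (a *ₚ b) ≈ ι a * ι b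
    ι-0         : ι 0ₚ ≈ 0#
    ι-1         : ι 1ₚ ≈ 1#
    ι-injective : ∀ {a} → ι a ≈ 0# → a ≋ []

-- The field of fractions of ℤ[q]

module FractionField where
  open PolyLaws using (commutativeRing)
  open CommutativeRing commutativeRing using () renaming
    ( +-cong to +ₚ-cong; *-cong to *ₚ-cong; -‿cong to negₚ-cong; *-congˡ to *ₚ-congˡ; *-congʳ to *ₚ-congʳ; *-identityʳ to *ₚ-identityʳ)
  open PS using (solve; con; _:+_; _:*_; _:-_; :-_; _:=_)
  open import Relation.Binary.Reasoning.Setoid ≋-setoid

  record Fraction : Set where
    constructor fraction
    field
      num den : Poly
      den≢0   : ¬ den ≋ []
  open Fraction

  infix 4 _≃_
  record _≃_ (f g : Fraction) : Set where
    constructor cross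
    field multiplied : num f *ₚ den g ≋ num g *ₚ den f

  1≢0 : ¬ 1ₚ ≋ []
  1≢0 e with at e 0
  ... | ()

  ι : Poly → Fraction
  ι a = fraction a 1ₚ 1≢0

  infixl 6 _⊕_
  infixl 7 _⊗_
  _⊕_ _⊗_ : Fraction → Fraction → Fraction
  fraction a b b≢0 ⊕ fraction c d d≢0 = fraction (a *ₚ d +ₚ c *ₚ b) (b *ₚ d) (*ₚ-nonzero b≢0 d≢0)
  fraction a b b≢0 ⊗ fraction c d d≢0 = fraction (a *ₚ c) (b *ₚ d) (*ₚ-nonzero b≢0 d≢0)

  ⊖_ : Fraction → Fraction
  ⊖ fraction a b b≢0 = fraction (negₚ a) b b≢0

  ≃-isEquivalence : IsEquivalence _≃_
  ≃-isEquivalence = record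
    { refl  = cross ≋-refl
    ; sym   = λ { (cross e) → cross (≋-sym e) }
    ; trans = λ { {fraction a b _} {fraction c d d≢0} {fraction e f _} (cross p) (cross r) → cross (*ₚ-cancelˡ d≢0 (begin
        d *ₚ (a *ₚ f)   ≈⟨ solve 3 (λ d a f → d :* (a :* f) := a :* d :* f) ≋-refl d a f ⟩
        a *ₚ d *ₚ f     ≈⟨ *ₚ-congʳ {f} p ⟩
        c *ₚ b *ₚ f     ≈⟨ solve 3 (λ c b f → c :* b :* f := b :* (c :* f)) ≋-refl c b f ⟩
        b *ₚ (c *ₚ f)   ≈⟨ *ₚ-congˡ {b} r ⟩
        b *ₚ (e *ₚ d)   ≈⟨ solve 3 (λ b e d → b :* (e :* d) := d :* (e :* b)) ≋-refl b e d ⟩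
        d *ₚ (e *ₚ b)   ∎)) }
    }

  ⊕-cong : ∀ {f f′ g g′} → f ≃ f′ → g ≃ g′ → f ⊕ g ≃ f′ ⊕ g′
  ⊕-cong {fraction a b _} {fraction a′ b′ _} {fraction c d _} {fraction c′ d′ _} (cross p) (cross r) = cross (begin
    (a *ₚ d +ₚ c *ₚ b) *ₚ (b′ *ₚ d′)
      ≈⟨ solve 6 (λ a d c b b′ d′ → (a :* d :+ c :* b) :* (b′ :* d′) := a :* b′ :* (d :* d′) :+ c :* d′ :* (b :* b′)) ≋-refl a d c b b′ d′ ⟩
    a *ₚ b′ *ₚ (d *ₚ d′) +ₚ c *ₚ d′ *ₚ (b *ₚ b′)
      ≈⟨ +ₚ-cong (*ₚ-congʳ {d *ₚ d′} p) (*ₚ-congʳ {b *ₚ b′} r) ⟩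
    a′ *ₚ b *ₚ (d *ₚ d′) +ₚ c′ *ₚ d *ₚ (b *ₚ b′)
      ≈⟨ solve 6 (λ a d c b b′ d′ → a :* b :* (d :* d′) :+ c :* d :* (b :* b′) := (a :* d′ :+ c :* b′) :* (b :* d)) ≋-refl a′ d c′ b b′ d′ ⟩
    (a′ *ₚ d′ +ₚ c′ *ₚ b′) *ₚ (b *ₚ d) ∎)

  ⊗-cong : ∀ {f f′ g g′} → f ≃ f′ → g ≃ g′ → f ⊗ g ≃ f′ ⊗ g′
  ⊗-cong {fraction a b _} {fraction a′ b′ _} {fraction c d _} {fraction c′ d′ _} (cross p) (cross r) = cross (begin
    a *ₚ c *ₚ (b′ *ₚ d′)      ≈⟨ solve 4 (λ a c b d → a :* c :* (b :* d) := a :* b :* (c :* d)) ≋-refl a c b′ d′ ⟩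
    a *ₚ b′ *ₚ (c *ₚ d′)      ≈⟨ *ₚ-cong p r ⟩
    a′ *ₚ b *ₚ (c′ *ₚ d)      ≈⟨ solve 4 (λ a c b d → a :* c :* (b :* d) := a :* b :* (c :* d)) ≋-refl a′ c′ b d ⟨
    a′ *ₚ c′ *ₚ (b *ₚ d)      ∎)

  fractionRing : CommutativeRing 0ℓ 0ℓ
  fractionRing = record
    { Carrier = Fraction ; _≈_ = _≃_ ; _+_ = _⊕_ ; _*_ = _⊗_ ; -_ = ⊖_ ; 0# = ι 0ₚ ; 1# = ι 1ₚ
    ; isCommutativeRing = record
      { isRing = record
        { +-isAbelianGroup = record
          { isGroup = record
            { isMonoid = record
              { isSemigroup = record
                { isMagma = record { isEquivalence = ≃-isEquivalence ; ∙-cong = ⊕-cong }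
                ; assoc = λ { (fraction a b _) (fraction c d _) (fraction e f _) → cross (solve 6 (λ a b c d e f →
                    ((a :* d :+ c :* b) :* f :+ e :* (b :* d)) :* (b :* (d :* f)) := (a :* (d :* f) :+ (c :* f :+ e :* d) :* b) :* (b :* d :* f)) ≋-refl a b c d e f) } }
              ; identity = (λ f → trans (⊕-comm (ι 0ₚ) f) (⊕-zero f)) , ⊕-zero }
            ; inverse = (λ f → trans (⊕-comm (⊖ f) f) (⊕-inverse f)) , ⊕-inverse
            ; ⁻¹-cong = λ { {fraction a b _} {fraction c d _} (cross e) → cross (≋-trans (solve 2 (λ a d → (:- a) :* d := :- (a :* d)) ≋-refl a d)
                (≋-trans (negₚ-cong e) (solve 2 (λ c b → :- (c :* b) := (:- c) :* b) ≋-refl c b))) } }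
          ; comm = ⊕-comm }
        ; *-cong = ⊗-cong
        ; *-assoc = λ { (fraction a b _) (fraction c d _) (fraction e f _) → cross (solve 6 (λ a b c d e f →
            a :* c :* e :* (b :* (d :* f)) := a :* (c :* e) :* (b :* d :* f)) ≋-refl a b c d e f) }
        ; *-identity = (λ f → trans (⊗-comm (ι 1ₚ) f) (⊗-one f)) , ⊗-one
        ; distrib = (λ f g h → trans (⊗-comm f (g ⊕ h)) (trans (⊗-distribʳ f g h) (⊕-cong (⊗-comm g f) (⊗-comm h f)))) , ⊗-distribʳ
        }
      ; *-comm = ⊗-comm
      }
    }
    where
    open IsEquivalence ≃-isEquivalence using (trans)
    ⊕-comm : ∀ f g → f ⊕ g ≃ g ⊕ f
    ⊕-comm (fraction a b _) (fraction c d _) = cross (solve 4 (λ a b c d → (a :* d :+ c :* b) :* (d :* b) := (c :* b :+ a :* d) :* (b :* d)) ≋-refl a b c d)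
    ⊗-comm : ∀ f g → f ⊗ g ≃ g ⊗ f
    ⊗-comm (fraction a b _) (fraction c d _) = cross (solve 4 (λ a b c d → a :* c :* (d :* b) := c :* a :* (b :* d)) ≋-refl a b c d)
    ⊕-zero : ∀ f → f ⊕ ι 0ₚ ≃ f
    ⊕-zero (fraction a b _) = cross (solve 2 (λ a b → (a :* con (+ 1) :+ con (+ 0) :* b) :* b := a :* (b :* con (+ 1))) ≋-refl a b)
    ⊕-inverse : ∀ f → f ⊕ (⊖ f) ≃ ι 0ₚ
    ⊕-inverse (fraction a b _) = cross (solve 2 (λ a b → (a :* b :+ (:- a) :* b) :* con (+ 1) := con (+ 0) :* (b :* b)) ≋-refl a b)
    ⊗-one : ∀ f → f ⊗ ι 1ₚ ≃ f
    ⊗-one (fraction a b _) = cross (solve 2 (λ a b → a :* con (+ 1) :* b := a :* (b :* con (+ 1))) ≋-refl a b)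
    ⊗-distribʳ : ∀ f g h → (g ⊕ h) ⊗ f ≃ g ⊗ f ⊕ h ⊗ f
    ⊗-distribʳ (fraction a b _) (fraction c d _) (fraction e f _) = cross (solve 6 (λ a b c d e f →
      (c :* f :+ e :* d) :* a :* (d :* b :* (f :* b)) := (c :* a :* (f :* b) :+ e :* a :* (d :* b)) :* (d :* f :* b)) ≋-refl a b c d e f)

  zero-num : ∀ {f} → num f ≋ [] → f ≃ ι 0ₚ
  zero-num {fraction a b _} e = cross (*ₚ-congʳ {1ₚ} e)

  fractionField : Field
  fractionField = record
    { commutativeRing = fractionRing
    ; _⁻¹ = λ f → reciprocal f (degree? (num f))
    ; *-inverse = λ f f≄0 → *-reciprocal f f≄0 (degree? (num f))
    ; 1≉0 = λ { (cross e) → 1≢0 e }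
    }
    where
    reciprocal : (f : Fraction) → num f ≋ [] ⊎ ∃ (HasDegree (num f)) → Fraction
    -- A default value for the inverse of zero, excluded by the hypothesis of `*-inverse`.
    reciprocal f                  (inj₁ _)       = f
    reciprocal (fraction a b b≢0) (inj₂ (d , h)) = fraction b a (degree-nonzero {a} h)
    *-reciprocal : ∀ f → ¬ f ≃ ι 0ₚ → ∀ d → f ⊗ reciprocal f d ≃ ι 1ₚ
    *-reciprocal f f≄0 (inj₁ z) = ⊥-elim (f≄0 (zero-num z))
    *-reciprocal (fraction a b _) _ (inj₂ _) = cross (solve 2 (λ a b → a :* b :* con (+ 1) := con (+ 1) :* (b :* a)) ≋-refl a b)

  ι-cong : ∀ {a b} → a ≋ b → ι a ≃ ι b
  ι-cong e = cross (*ₚ-congʳ {1ₚ} e)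

  ι-+ : ∀ a b → ι (a +ₚ b) ≃ ι a ⊕ ι b
  ι-+ a b = cross (solve 2 (λ a b → (a :+ b) :* (con (+ 1) :* con (+ 1)) := (a :* con (+ 1) :+ b :* con (+ 1)) :* con (+ 1)) ≋-refl a b)

  ι-* : ∀ a b → ι (a *ₚ b) ≃ ι a ⊗ ι b
  ι-* a b = cross (solve 2 (λ a b → a :* b :* (con (+ 1) :* con (+ 1)) := a :* b :* con (+ 1)) ≋-refl a b)

  ι-injective : ∀ {a} → ι a ≃ ι 0ₚ → a ≋ []
  ι-injective {a} (cross e) = ≋-trans (≋-sym (*ₚ-identityʳ a)) e

  embedding : Embedding fractionField
  embedding = record
    { ι = ι ; ι-cong = ι-cong ; ι-+ = ι-+ ; ι-* = ι-* ; ι-0 = Field.refl fractionField ; ι-1 = Field.refl fractionField ; ι-injective = ι-injective }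

-- The expansion of the truncated sum

module Powers (F : Field) (q : Field.Carrier F) (q≉0 : ¬ Field._≈_ F q (Field.0# F)) where
  open Field F
  open IntSolver commutativeRing
  open FieldProperties F
  open import Relation.Binary.Reasoning.Setoid setoid

  p : Carrier
  p = q ⁻¹

  qp≈1 : q * p ≈ 1#
  qp≈1 = *-inverse q q≉0

  qz : ℤ → Carrier
  qz (+ n)    = pow q n
  qz -[1+ n ] = pow p (suc n)

  qz-⊖ : ∀ m n → qz (m ℤ.⊖ n) ≈ pow q m * pow p n
  qz-⊖ zero    zero    = sym (*-identityˡ _)
  qz-⊖ zero    (suc n) = sym (*-identityˡ _)
  qz-⊖ (suc m) zero    = sym (*-identityʳ _)
  qz-⊖ (suc m) (suc n) = begin
    qz (suc m ℤ.⊖ suc n)                ≡⟨ ≡.cong qz (ℤₚ.[1+m]⊖[1+n]≡m⊖n m n) ⟩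
    qz (m ℤ.⊖ n)                        ≈⟨ qz-⊖ m n ⟩
    pow q m * pow p n                   ≈⟨ *-identityʳ _ ⟨
    pow q m * pow p n * 1#              ≈⟨ *-congˡ qp≈1 ⟨
    pow q m * pow p n * (q * p)         ≈⟨ solve 4 (λ a b q p → a :* b :* (q :* p) := a :* q :* (b :* p)) refl _ _ q p ⟩
    pow q (suc m) * pow p (suc n)       ∎

  qz-+ : ∀ a b → qz (a ℤ.+ b) ≈ qz a * qz b
  qz-+ (+ m)    (+ n)    = pow-+ q m n
  qz-+ (+ m)    -[1+ n ] = qz-⊖ m (suc n)
  qz-+ -[1+ m ] (+ n)    = trans (qz-⊖ n (suc m)) (*-comm _ _)
  qz-+ -[1+ m ] -[1+ n ] = trans (reflexive (≡.cong (λ k → pow p (suc k)) (≡.sym (ℕₚ.+-suc m n)))) (pow-+ p (suc m) (suc n))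

  qz-≡ : ∀ {a b} → a ≡ b → qz a ≈ qz b
  qz-≡ e = reflexive (≡.cong qz e)

  qz-neg : ∀ a → qz a * qz (ℤ.- a) ≈ 1#
  qz-neg a = trans (sym (qz-+ a (ℤ.- a))) (qz-≡ (ℤₚ.+-inverseʳ a))

  q³ q⁴ q⁶ p³ p⁶ : Carrier
  q³ = q * (q * q)
  q⁴ = q * q³
  q⁶ = q³ * q³
  p³ = p * (p * p)
  p⁶ = p³ * p³

  -- The polynomial identity behind the WZ pair.
  certificate : ∀ x c →
    let c² = c * c ; c³ = c * c² ; c⁴ = c * c³ in
    x * (1# - x * x) *
      (q * (1# - c² * (q * q)) * (1# - c² * q⁴) * (1# - c * q⁶) * (q³ - c) * (1# - c³ * x) * (x - c³)
       - (1# - c³ * q⁶) * (q - c²) * (1# - c² * q) * (q³ - c³) * (1# - c * q³ * x) * (x - c * q³))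
    ≈ c * (1# - c⁴ * q³) *
      ((1# - c³ * x) * (q⁶ * x - 1#) * (x - c * q³) * (x - c * q) * (q * x - c) * (q³ - x)
       - (x - c³) * (1# - c * q³ * x) * (1# - c * q * x) * (q - c * x) * (x - q⁶) * (1# - x * q³))
  certificate x c = solve 3 (λ x c q →
    let 1# = con (+ 1) ; c² = c :* c ; c³ = c :* c² ; c⁴ = c :* c³ ; q³ = q :* (q :* q) ; q⁴ = q :* q³ ; q⁶ = q³ :* q³ in
    x :* (1# :- x :* x) :*
      (q :* (1# :- c² :* (q :* q)) :* (1# :- c² :* q⁴) :* (1# :- c :* q⁶) :* (q³ :- c) :* (1# :- c³ :* x) :* (x :- c³)
       :- (1# :- c³ :* q⁶) :* (q :- c²) :* (1# :- c² :* q) :* (q³ :- c³) :* (1# :- c :* q³ :* x) :* (x :- c :* q³))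
    := c :* (1# :- c⁴ :* q³) :*
      ((1# :- c³ :* x) :* (q⁶ :* x :- 1#) :* (x :- c :* q³) :* (x :- c :* q) :* (q :* x :- c) :* (q³ :- x)
       :- (x :- c³) :* (1# :- c :* q³ :* x) :* (1# :- c :* q :* x) :* (q :- c :* x) :* (x :- q⁶) :* (1# :- x :* q³))) refl x c q

  module Reciprocal {x y : Carrier} (xy≈1 : x * y ≈ 1#) where
    1-a*y : ∀ a → 1# - a * y ≈ y * (x - a)
    1-a*y a = trans (+-congʳ (sym xy≈1)) (solve 3 (λ x y a → x :* y :- a :* y := y :* (x :- a)) refl x y a)

    -- `certificate` is polynomial in x, while the summands also contain y = 1/x. Each 1 - a y
    -- equals y (x - a), and rewriting y as y² x supplies the factor x on the left of `certificate`
    -- and the common factor y².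
    open-form : ∀ c →
      let c² = c * c ; c³ = c * c² ; c⁴ = c * c³ in
      q * (1# - c² * (q * q)) * (1# - c² * q⁴) * (1# - c * q⁶) * (q³ - c) * ((1# - c³ * x) * (1# - c³ * y) * (1# - x * x))
      ≈ (1# - c³ * q⁶) * (q - c²) * (1# - c² * q) * (q³ - c³) * ((1# - c * q³ * x) * (1# - c * q³ * y) * (1# - x * x))
      + c * (1# - c⁴ * q³) * (y * y) *
        ((1# - c³ * x) * (q⁶ * x - 1#) * (x - c * q³) * (x - c * q) * (q * x - c) * (q³ - x)
         - (x - c³) * (1# - c * q³ * x) * (1# - c * q * x) * (q - c * x) * (x - q⁶) * (1# - x * q³))
    open-form c = begin
      An * ((1# - c³ * x) * (1# - c³ * y) * X)
        ≈⟨ *-congˡ (*-congʳ (*-congˡ (trans (1-a*y c³) (y-expand _)))) ⟩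
      An * ((1# - c³ * x) * (y * y * x * (x - c³)) * X)
        ≈⟨ solve 8 (λ An c₃x y x xc₃ X Δ r → An :* (c₃x :* (y :* y :* x :* xc₃) :* X) :=
             Δ :* r :* (y :* y :* x) :* X :+ y :* y :* (x :* X :* (An :* c₃x :* xc₃ :- Δ :* r))) refl An (1# - c³ * x) y x (x - c³) X Δ ((1# - c * q³ * x) * (x - c * q³)) ⟩
      Δ * ((1# - c * q³ * x) * (x - c * q³)) * (y * y * x) * X + y * y * (x * X * (An * (1# - c³ * x) * (x - c³) - Δ * ((1# - c * q³ * x) * (x - c * q³))))
        ≈⟨ +-congˡ (*-congˡ (trans (*-congˡ (+-congˡ (-‿cong (sym (*-assoc Δ _ _))))) (certificate x c))) ⟩
      Δ * ((1# - c * q³ * x) * (x - c * q³)) * (y * y * x) * X + y * y * (c * (1# - c⁴ * q³) * B)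
        ≈⟨ solve 8 (λ Δ a b y x X g B → Δ :* (a :* b) :* (y :* y :* x) :* X :+ y :* y :* (g :* B) := Δ :* (a :* (y :* y :* x :* b) :* X) :+ g :* (y :* y) :* B)
             refl Δ (1# - c * q³ * x) (x - c * q³) y x X (c * (1# - c⁴ * q³)) B ⟩
      Δ * ((1# - c * q³ * x) * (y * y * x * (x - c * q³)) * X) + c * (1# - c⁴ * q³) * (y * y) * B
        ≈⟨ +-congʳ (*-congˡ (*-congʳ (*-congˡ (sym (trans (1-a*y (c * q³)) (y-expand _)))))) ⟩
      Δ * ((1# - c * q³ * x) * (1# - c * q³ * y) * X) + c * (1# - c⁴ * q³) * (y * y) * B ∎
      where
      c² = c * c
      c³ = c * c²
      c⁴ = c * c³
      X = 1# - x * x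
      An = q * (1# - c² * (q * q)) * (1# - c² * q⁴) * (1# - c * q⁶) * (q³ - c)
      Δ = (1# - c³ * q⁶) * (q - c²) * (1# - c² * q) * (q³ - c³)
      B = (1# - c³ * x) * (q⁶ * x - 1#) * (x - c * q³) * (x - c * q) * (q * x - c) * (q³ - x)
         - (x - c³) * (1# - c * q³ * x) * (1# - c * q * x) * (q - c * x) * (x - q⁶) * (1# - x * q³)
      y-expand : ∀ a → y * a ≈ y * y * x * a
      y-expand a = *-congʳ (sym (trans (solve 2 (λ x y → y :* y :* x := (x :* y) :* y) refl x y) (trans (*-congʳ xy≈1) (*-identityˡ y))))

  module Summation (q-not-root : ∀ n → ¬ pow q (suc n) ≈ 1#) where

    1-qz≉0 : ∀ z → z ≢ + 0 → ¬ 1# - qz z ≈ 0#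
    1-qz≉0 (+ zero)  z≢0 _ = z≢0 ≡.refl
    1-qz≉0 (+ suc n) _   e = q-not-root n (sym (trans (solve 2 (λ a b → a := (a :- b) :+ b) refl 1# _) (trans (+-congʳ e) (+-identityˡ _))))
    1-qz≉0 -[1+ n ]  _   e = q-not-root n (trans (sym (*-identityʳ _)) (trans (*-congˡ 1≈) (pow-inverse qp≈1 (suc n))))
      where
      1≈ : 1# ≈ pow p (suc n)
      1≈ = trans (solve 2 (λ a b → a := (a :- b) :+ b) refl 1# _) (trans (+-congʳ e) (+-identityˡ _))

    q² : Carrier
    q² = q * q

    qz2 : qz (+ 2) ≈ q²
    qz2 = solve 1 (λ q → con (+ 1) :* q :* q := q :* q) refl q
    qz3 : qz (+ 3) ≈ q³
    qz3 = solve 1 (λ q → con (+ 1) :* q :* q :* q := q :* (q :* q)) refl q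
    qz1 : qz (+ 1) ≈ q
    qz1 = *-identityˡ q
    qz-1 : qz -[1+ 0 ] ≈ p
    qz-1 = *-identityˡ p
    qz6 : qz (+ 6) ≈ q⁶
    qz6 = solve 1 (λ q → con (+ 1) :* q :* q :* q :* q :* q :* q := q :* (q :* q) :* (q :* (q :* q))) refl q
    qz-3 : qz -[1+ 2 ] ≈ p³
    qz-3 = solve 1 (λ q → con (+ 1) :* q :* q :* q := q :* (q :* q)) refl p
    qz-6 : qz -[1+ 5 ] ≈ p⁶
    qz-6 = solve 1 (λ q → con (+ 1) :* q :* q :* q :* q :* q :* q := q :* (q :* q) :* (q :* (q :* q))) refl p

    pq≈1 : p * q ≈ 1#
    pq≈1 = trans (*-comm p q) qp≈1

    p³q³≈1 : p³ * q³ ≈ 1#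
    p³q³≈1 = trans (solve 2 (λ p q → p :* (p :* p) :* (q :* (q :* q)) := p :* q :* ((p :* q) :* (p :* q))) refl p q)
      (trans (*-cong pq≈1 (trans (*-cong pq≈1 pq≈1) (*-identityʳ _))) (*-identityʳ _))

    c : ℕ → Carrier
    c k = pow q² k

    c-qz : ∀ k → c k ≈ qz (+ (k ℕ.+ k))
    c-qz zero    = refl
    c-qz (suc k) = trans (*-cong (c-qz k) (sym qz2)) (trans (sym (qz-+ (+ (k ℕ.+ k)) (+ 2))) (qz-≡ (≡.cong +_ (≡.trans (ℕₚ.+-comm (k ℕ.+ k) 2) (≡.cong suc (≡.sym (ℕₚ.+-suc k k)))))))

    c³-pow : ∀ k → pow q⁶ k ≈ c k * (c k * c k)
    c³-pow zero    = solve 0 (con (+ 1) := con (+ 1) :* (con (+ 1) :* con (+ 1))) refl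
    c³-pow (suc k) = trans (*-congʳ (c³-pow k)) (solve 2 (λ c q → c :* (c :* c) :* (q :* (q :* q) :* (q :* (q :* q)))
      := c :* (q :* q) :* (c :* (q :* q) :* (c :* (q :* q)))) refl (c k) q)

    q²-factor : ∀ n → 1# - q² * pow q² n ≈ 1# - qz (+ suc n ℤ.+ + suc n)
    q²-factor n = 1-cong (trans (*-comm q² _) (c-qz (suc n)))

    q²-poch≉0 : ∀ n → ¬ poch q² q² n ≈ 0#
    q²-poch≉0 zero    = 1≉0
    q²-poch≉0 (suc n) = *-nonzero (q²-poch≉0 n) (λ e → 1-qz≉0 (+ suc n ℤ.+ + suc n) (λ ()) (trans (sym (q²-factor n)) e))

    -- The reciprocal of (q²;q²)_z, with its natural value 0 at negative z.
    I : ℤ → Carrier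
    I (+ n)    = poch q² q² n ⁻¹
    I -[1+ n ] = 0#

    I-pred : ∀ z → I (ℤ.pred z) ≈ (1# - qz (z ℤ.+ z)) * I z
    I-pred (+ zero)  = solve 1 (λ i → con (+ 0) := (con (+ 1) :- con (+ 1)) :* i) refl (I (+ 0))
    I-pred -[1+ n ]  = sym (zeroʳ _)
    I-pred (+ suc n) = sym (inverse-unique (begin
      poch q² q² n * ((1# - qz (+ suc n ℤ.+ + suc n)) * I (+ suc n))
        ≈⟨ *-assoc _ _ _ ⟨
      poch q² q² n * (1# - qz (+ suc n ℤ.+ + suc n)) * I (+ suc n)
        ≈⟨ *-congʳ (*-congˡ (sym (q²-factor n))) ⟩
      poch q² q² (suc n) * I (+ suc n)
        ≈⟨ *-inverse _ (q²-poch≉0 (suc n)) ⟩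
      1# ∎))

    I-step : ∀ {z w s} → w ≡ ℤ.pred z → s ≈ qz (z ℤ.+ z) → I w ≈ (1# - s) * I z
    I-step {z} ≡.refl e = trans (I-pred z) (*-congʳ (1-cong (sym e)))

    -- The WZ pair `D̂`, `Ĝ`

    x y : ℤ → Carrier
    x m = qz (+ 6 ℤ.* m ℤ.+ + 1)
    y m = qz (ℤ.- (+ 6 ℤ.* m ℤ.+ + 1))

    xy≈1 : ∀ m → x m * y m ≈ 1#
    xy≈1 m = qz-neg (+ 6 ℤ.* m ℤ.+ + 1)

    sgn : ℤ → Carrier
    sgn (+ n)    = pow (- 1#) n
    sgn -[1+ n ] = pow (- 1#) (suc n)

    sgn-suc : ∀ m → sgn (ℤ.suc m) ≈ - sgn m
    sgn-suc (+ n)        = solve 1 (λ s → s :* (:- con (+ 1)) := :- s) refl (pow (- 1#) n)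
    sgn-suc -[1+ zero ]  = solve 0 (con (+ 1) := :- (con (+ 1) :* (:- con (+ 1)))) refl
    sgn-suc -[1+ suc n ] = solve 1 (λ s → s := :- (s :* (:- con (+ 1)))) refl (pow (- 1#) (suc n))

    -- From m to m + 1 it grows by 18 m + 12 = 3 (6 m + 1) + 9, so `σ` changes by -q⁹ x³. In `Ĝ-suc`
    -- this monomial absorbs three factors y and the powers of q that the shift of m produces.
    exponent : ℤ → ℤ
    exponent m = + 9 ℤ.* (m ℤ.* m) ℤ.+ + 3 ℤ.* m

    σ : ℤ → Carrier
    σ m = sgn m * qz (exponent m)

    private
      exponent-suc : ∀ m → + 9 ℤ.* ((+ 1 ℤ.+ m) ℤ.* (+ 1 ℤ.+ m)) ℤ.+ + 3 ℤ.* (+ 1 ℤ.+ m)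
        ≡ (+ 9 ℤ.* (m ℤ.* m) ℤ.+ + 3 ℤ.* m) ℤ.+ (((+ 6 ℤ.* m ℤ.+ + 1) ℤ.+ ((+ 6 ℤ.* m ℤ.+ + 1) ℤ.+ (+ 6 ℤ.* m ℤ.+ + 1))) ℤ.+ (+ 6 ℤ.+ + 3))
      exponent-suc = ℤ-solve
      x-exponent : ∀ m → + 6 ℤ.* (+ 1 ℤ.+ m) ℤ.+ + 1 ≡ + 6 ℤ.+ (+ 6 ℤ.* m ℤ.+ + 1)
      x-exponent = ℤ-solve
      y-exponent : ∀ m → ℤ.- (+ 6 ℤ.* (+ 1 ℤ.+ m) ℤ.+ + 1) ≡ -[1+ 5 ] ℤ.+ (ℤ.- (+ 6 ℤ.* m ℤ.+ + 1))
      y-exponent = ℤ-solve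
      e-exponent : ∀ m → + 6 ℤ.* (+ 1 ℤ.+ m) ℤ.+ -[1+ 1 ] ≡ + 6 ℤ.* m ℤ.+ + 4
      e-exponent = ℤ-solve
      x³-exponent : ∀ m → + 3 ℤ.+ (+ 6 ℤ.* m ℤ.+ + 1) ≡ + 6 ℤ.* m ℤ.+ + 4
      x³-exponent = ℤ-solve
      x-³-exponent : ∀ m → -[1+ 2 ] ℤ.+ (+ 6 ℤ.* m ℤ.+ + 1) ≡ + 6 ℤ.* m ℤ.+ -[1+ 1 ]
      x-³-exponent = ℤ-solve

    σ-suc : ∀ m → σ (ℤ.suc m) ≈ - (q⁶ * q³ * (x m * (x m * x m)) * σ m)
    σ-suc m = begin
      sgn (ℤ.suc m) * qz (exponent (ℤ.suc m))
        ≈⟨ *-cong (sgn-suc m) (trans (qz-≡ (exponent-suc m)) (trans (qz-+ (exponent m) _) (*-congˡ (trans (qz-+ (X ℤ.+ (X ℤ.+ X)) (+ 6 ℤ.+ + 3))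
             (*-cong (trans (qz-+ X (X ℤ.+ X)) (*-congˡ (qz-+ X X))) (trans (qz-+ (+ 6) (+ 3)) (*-cong qz6 qz3))))))) ⟩
      - sgn m * (qz (exponent m) * (x m * (x m * x m) * (q⁶ * q³)))
        ≈⟨ solve 4 (λ s e x q → (:- s) :* (e :* (x :* q)) := :- (q :* x :* (s :* e))) refl (sgn m) (qz (exponent m)) (x m * (x m * x m)) (q⁶ * q³) ⟩
      - (q⁶ * q³ * (x m * (x m * x m)) * σ m) ∎
      where X = + 6 ℤ.* m ℤ.+ + 1

    x-suc : ∀ m → x (ℤ.suc m) ≈ q⁶ * x m
    x-suc m = trans (qz-≡ (x-exponent m)) (trans (qz-+ (+ 6) (+ 6 ℤ.* m ℤ.+ + 1)) (*-congʳ qz6))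

    y-suc : ∀ m → y (ℤ.suc m) ≈ p⁶ * y m
    y-suc m = trans (qz-≡ (y-exponent m)) (trans (qz-+ -[1+ 5 ] (ℤ.- (+ 6 ℤ.* m ℤ.+ + 1))) (*-congʳ qz-6))

    -- Reciprocals of 1 - q^(N+3) and 1 - q^(N-3) for N = 6m + 1. A shift of m by one carries `e₂`
    -- to `e₁`.
    e₁ e₂ : ℤ → Carrier
    e₁ m = (1# - qz (+ 6 ℤ.* m ℤ.+ + 4)) ⁻¹
    e₂ m = (1# - qz (+ 6 ℤ.* m ℤ.+ -[1+ 1 ])) ⁻¹

    e₂-suc : ∀ m → e₂ (ℤ.suc m) ≈ e₁ m
    e₂-suc m = reflexive (≡.cong (λ z → (1# - qz z) ⁻¹) (e-exponent m))

    6m+4≢0 : ∀ m → + 6 ℤ.* m ℤ.+ + 4 ≢ + 0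
    6m+4≢0 (+ n) e with ℤₚ.+-injective (≡.trans (≡.cong (ℤ._+ + 4) (ℤₚ.pos-* 6 n)) e)
    ... | e′ = ℕₚ.1+n≢0 (≡.trans (ℕₚ.+-comm 4 (6 ℕ.* n)) e′)
    6m+4≢0 -[1+ n ] e = lemma (≡.trans (≡.sym (negative (+ n))) e)
      where
      negative : ∀ n → + 6 ℤ.* (ℤ.- (+ 1 ℤ.+ n)) ℤ.+ + 4 ≡ ℤ.- (+ 2 ℤ.+ + 6 ℤ.* n)
      negative = ℤ-solve
      lemma : ℤ.- (+ 2 ℤ.+ + 6 ℤ.* + n) ≢ + 0
      lemma rewrite ≡.sym (ℤₚ.pos-* 6 n) = λ ()

    6m-2≢0 : ∀ m → + 6 ℤ.* m ℤ.+ -[1+ 1 ] ≢ + 0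
    6m-2≢0 m e = 6m+4≢0 (ℤ.pred m) (≡.trans (lemma m) e)
      where
      lemma : ∀ m → + 6 ℤ.* (-[1+ 0 ] ℤ.+ m) ℤ.+ + 4 ≡ + 6 ℤ.* m ℤ.+ -[1+ 1 ]
      lemma = ℤ-solve

    e₁-inverse : ∀ m → (1# - x m * q³) * e₁ m ≈ 1#
    e₁-inverse m = trans (*-congʳ (1-cong (trans (*-comm _ _) (trans (*-congʳ (sym qz3)) (trans (sym (qz-+ (+ 3) (+ 6 ℤ.* m ℤ.+ + 1))) (qz-≡ (x³-exponent m)))))))
      (*-inverse _ (1-qz≉0 _ (6m+4≢0 m)))

    e₂-inverse : ∀ m → (1# - x m * p³) * e₂ m ≈ 1#
    e₂-inverse m = trans (*-congʳ (1-cong (trans (*-comm _ _) (trans (*-congʳ (sym qz-3)) (trans (sym (qz-+ -[1+ 2 ] (+ 6 ℤ.* m ℤ.+ + 1))) (qz-≡ (x-³-exponent m)))))))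
      (*-inverse _ (1-qz≉0 _ (6m-2≢0 m)))

    ρ : ℤ → Carrier
    ρ m = σ m * (1# - x m * x m) * (e₁ m * e₂ m)

    -- They are k + (1 + N)/2 and k + (1 - N)/2: their sum is 2k + 1 and their difference is N = 6m
    -- + 1.
    α β : ℕ → ℤ → ℤ
    α k m = + k ℤ.+ (+ 3 ℤ.* m ℤ.+ + 1)
    β k m = + k ℤ.- + 3 ℤ.* m

    -- `D̂` is the WZ summand and `Ĝ` its companion. `Ê` is `D̂` with both q⁶-products moved one
    -- step up. In `Ĝ` the product (y;q⁶)_{k+1} is written with its first factor split off, because
    -- y becomes q⁻⁶ y under m ↦ m + 1 and the remaining tail then becomes (y;q⁶)_k.
    D̂ Ê Ĝ : ℕ → ℤ → Carrier
    D̂ k m = poch (x m) q⁶ k * poch (y m) q⁶ k * (I (α k m) * I (β k m)) * ρ m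
    Ê k m = poch (q⁶ * x m) q⁶ k * poch (q⁶ * y m) q⁶ k * (I (α k m) * I (β k m)) * ρ m
    Ĝ k m = poch (x m) q⁶ k * ((1# - y m) * poch (q⁶ * y m) q⁶ k) * (I (ℤ.pred (ℤ.pred (α k m))) * I (β (suc k) m))
              * (y m * (x m - q⁶)) * (σ m * e₂ m)

    module Step (k : ℕ) (m : ℤ) where
      private
        X = x m
        Y = y m
        C₁ = c k
        c³ = C₁ * (C₁ * C₁)
      J = I (α (suc k) m) * I (β (suc k) m)
      -- The common factor of `D̂ (suc k) m`, `D̂ k m`, `Ĝ k m` and `Ĝ k (suc m)`. The reciprocals
      -- in `J` carry the largest indices that occur, so the others are polynomial multiples of
      -- them.
      core = poch X q⁶ k * poch Y q⁶ k * J * (σ m * (e₁ m * e₂ m))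

      scaled : ∀ z w {s} → s ≈ qz z → C₁ * s * qz w ≈ qz (+ (k ℕ.+ k) ℤ.+ (z ℤ.+ w))
      scaled z w e = trans (*-congʳ (*-cong (c-qz k) e)) (trans (*-assoc _ _ _)
        (trans (*-congˡ (sym (qz-+ z w))) (sym (qz-+ (+ (k ℕ.+ k)) (z ℤ.+ w)))))

      private
        α-pred : ∀ k m → k ℤ.+ (+ 3 ℤ.* m ℤ.+ + 1) ≡ -[1+ 0 ] ℤ.+ (+ 1 ℤ.+ k ℤ.+ (+ 3 ℤ.* m ℤ.+ + 1))
        α-pred = ℤ-solve
        β-pred : ∀ k m → k ℤ.- + 3 ℤ.* m ≡ -[1+ 0 ] ℤ.+ (+ 1 ℤ.+ k ℤ.- + 3 ℤ.* m)
        β-pred = ℤ-solve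
        s₁ : ∀ k m → (k ℤ.+ k) ℤ.+ (+ 3 ℤ.+ (+ 6 ℤ.* m ℤ.+ + 1)) ≡ (+ 1 ℤ.+ k ℤ.+ (+ 3 ℤ.* m ℤ.+ + 1)) ℤ.+ (+ 1 ℤ.+ k ℤ.+ (+ 3 ℤ.* m ℤ.+ + 1))
        s₁ = ℤ-solve
        s₂ : ∀ k m → (k ℤ.+ k) ℤ.+ (+ 3 ℤ.+ ℤ.- (+ 6 ℤ.* m ℤ.+ + 1)) ≡ (+ 1 ℤ.+ k ℤ.- + 3 ℤ.* m) ℤ.+ (+ 1 ℤ.+ k ℤ.- + 3 ℤ.* m)
        s₂ = ℤ-solve
        s₃ : ∀ k m → (k ℤ.+ k) ℤ.+ (+ 1 ℤ.+ (+ 6 ℤ.* m ℤ.+ + 1)) ≡ (k ℤ.+ (+ 3 ℤ.* m ℤ.+ + 1)) ℤ.+ (k ℤ.+ (+ 3 ℤ.* m ℤ.+ + 1))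
        s₃ = ℤ-solve
        s₄ : ∀ k m → (k ℤ.+ k) ℤ.+ (-[1+ 0 ] ℤ.+ (+ 6 ℤ.* m ℤ.+ + 1)) ≡ (-[1+ 0 ] ℤ.+ (k ℤ.+ (+ 3 ℤ.* m ℤ.+ + 1))) ℤ.+ (-[1+ 0 ] ℤ.+ (k ℤ.+ (+ 3 ℤ.* m ℤ.+ + 1)))
        s₄ = ℤ-solve
        s₅ : ∀ k m → (k ℤ.+ k) ℤ.+ (+ 1 ℤ.+ ℤ.- (+ 6 ℤ.* m ℤ.+ + 1)) ≡ (k ℤ.- + 3 ℤ.* m) ℤ.+ (k ℤ.- + 3 ℤ.* m)
        s₅ = ℤ-solve
        s₆ : ∀ k m → (k ℤ.+ k) ℤ.+ (-[1+ 0 ] ℤ.+ ℤ.- (+ 6 ℤ.* m ℤ.+ + 1)) ≡ (-[1+ 0 ] ℤ.+ (k ℤ.- + 3 ℤ.* m)) ℤ.+ (-[1+ 0 ] ℤ.+ (k ℤ.- + 3 ℤ.* m))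
        s₆ = ℤ-solve
        β-suc : ∀ k m → + 1 ℤ.+ k ℤ.- + 3 ℤ.* (+ 1 ℤ.+ m) ≡ -[1+ 0 ] ℤ.+ (-[1+ 0 ] ℤ.+ (k ℤ.- + 3 ℤ.* m))
        β-suc = ℤ-solve
        pp-ss : ∀ k m → -[1+ 0 ] ℤ.+ (-[1+ 0 ] ℤ.+ (k ℤ.+ (+ 3 ℤ.* (+ 1 ℤ.+ m) ℤ.+ + 1))) ≡ + 1 ℤ.+ k ℤ.+ (+ 3 ℤ.* m ℤ.+ + 1)
        pp-ss = ℤ-solve

      private
        X′ = + 6 ℤ.* m ℤ.+ + 1
        Y′ = ℤ.- X′

      Iα : I (α k m) ≈ (1# - C₁ * q³ * X) * I (α (suc k) m)
      Iα = I-step {α (suc k) m} (α-pred (+ k) m) (trans (scaled (+ 3) X′ (sym qz3)) (qz-≡ (s₁ (+ k) m)))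

      Iβ : I (β k m) ≈ (1# - C₁ * q³ * Y) * I (β (suc k) m)
      Iβ = I-step {β (suc k) m} (β-pred (+ k) m) (trans (scaled (+ 3) Y′ (sym qz3)) (qz-≡ (s₂ (+ k) m)))

      Iα⁻ : I (ℤ.pred (ℤ.pred (α k m))) ≈ (1# - C₁ * p * X) * ((1# - C₁ * q * X) * ((1# - C₁ * q³ * X) * I (α (suc k) m)))
      Iα⁻ = trans (I-step {ℤ.pred (α k m)} ≡.refl (trans (scaled -[1+ 0 ] X′ (sym qz-1)) (qz-≡ (s₄ (+ k) m))))
        (*-congˡ (trans (I-step {α k m} ≡.refl (trans (scaled (+ 1) X′ (sym qz1)) (qz-≡ (s₃ (+ k) m)))) (*-congˡ Iα)))

      Iβ⁻ : I (β (suc k) (ℤ.suc m)) ≈ (1# - C₁ * p * Y) * ((1# - C₁ * q * Y) * ((1# - C₁ * q³ * Y) * I (β (suc k) m)))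
      Iβ⁻ = trans (I-step {ℤ.pred (β k m)} (β-suc (+ k) m) (trans (scaled -[1+ 0 ] Y′ (sym qz-1)) (qz-≡ (s₆ (+ k) m))))
        (*-congˡ (trans (I-step {β k m} ≡.refl (trans (scaled (+ 1) Y′ (sym qz1)) (qz-≡ (s₅ (+ k) m)))) (*-congˡ Iβ)))

      Iα⁺ : I (ℤ.pred (ℤ.pred (α k (ℤ.suc m)))) ≈ I (α (suc k) m)
      Iα⁺ = reflexive (≡.cong I (pp-ss (+ k) m))

      private
        c⁴ = C₁ * c³
        px = poch X q⁶ k
        py = poch Y q⁶ k
        E = σ m * (e₁ m * e₂ m)
        open Reciprocal {X} {Y} (xy≈1 m)

        absorb : ∀ {u} t → u ≈ 1# → u * t ≈ t
        absorb t e = trans (*-congʳ e) (*-identityˡ t)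

        one³ : ∀ {u} → u ≈ 1# → u * u * u ≈ 1#
        one³ e = trans (*-cong (*-cong e e) e) (trans (*-identityʳ _) (*-identityʳ _))

        p⁶q⁶≈1 : p⁶ * q⁶ ≈ 1#
        p⁶q⁶≈1 = trans (solve 2 (λ p q → p :* p :* (q :* q) := p :* q :* (p :* q)) refl p³ q³) (trans (*-cong p³q³≈1 p³q³≈1) (*-identityʳ _))

        end-X : 1# - X * pow q⁶ k ≈ 1# - c³ * X
        end-X = 1-cong (trans (*-comm _ _) (*-congʳ (c³-pow k)))

        end-Y : 1# - Y * pow q⁶ k ≈ 1# - c³ * Y
        end-Y = 1-cong (trans (*-comm _ _) (*-congʳ (c³-pow k)))

        e₁≈ : e₁ m ≈ e₁ m * e₂ m * (1# - X * p³)
        e₁≈ = sym (trans (solve 3 (λ a b c → a :* b :* c := c :* b :* a) refl _ _ _) (absorb _ (e₂-inverse m)))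

        e₂≈ : e₂ m ≈ e₁ m * e₂ m * (1# - X * q³)
        e₂≈ = sym (trans (solve 3 (λ a b c → a :* b :* c := c :* a :* b) refl _ _ _) (absorb _ (e₁-inverse m)))

      D̂-suc : D̂ (suc k) m ≈ core * ((1# - c³ * X) * (1# - c³ * Y) * (1# - X * X))
      D̂-suc = trans (*-congʳ (*-congʳ (*-cong (*-congˡ end-X) (*-congˡ end-Y))))
        (solve 8 (λ px a py b J s w e → px :* a :* (py :* b) :* J :* (s :* w :* e) := px :* py :* J :* (s :* e) :* (a :* b :* w)) refl px _ py _ J (σ m) _ (e₁ m * e₂ m))

      D̂-at : D̂ k m ≈ core * ((1# - C₁ * q³ * X) * (1# - C₁ * q³ * Y) * (1# - X * X))
      D̂-at = trans (*-congʳ (*-congˡ (*-cong Iα Iβ)))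
        (solve 9 (λ px py a i b j s w e → px :* py :* (a :* i :* (b :* j)) :* (s :* w :* e) := px :* py :* (i :* j) :* (s :* e) :* (a :* b :* w)) refl px py _ _ _ _ (σ m) _ (e₁ m * e₂ m))

      private
        B₁ = (1# - c³ * X) * (q⁶ * X - 1#) * (X - C₁ * q³) * (X - C₁ * q) * (q * X - C₁) * (q³ - X)
        B₂ = (X - c³) * (1# - C₁ * q³ * X) * (1# - C₁ * q * X) * (q - C₁ * X) * (X - q⁶) * (1# - X * q³)

        1-cpX : 1# - C₁ * p * X ≈ p * (q - C₁ * X)
        1-cpX = trans (+-congʳ (sym pq≈1)) (solve 4 (λ p q c x → p :* q :- c :* p :* x := p :* (q :- c :* x)) refl p q C₁ X)

        1-cpY : 1# - C₁ * p * Y ≈ Y * (p * (q * X - C₁))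
        1-cpY = trans (1-a*y (C₁ * p)) (*-congˡ (trans (+-congʳ (sym (absorb X pq≈1))) (solve 4 (λ p q x c → p :* q :* x :- c :* p := p :* (q :* x :- c)) refl p q X C₁)))

        1-p⁶Y : 1# - p⁶ * Y ≈ Y * (p⁶ * (q⁶ * X - 1#))
        1-p⁶Y = trans (1-a*y p⁶) (*-congˡ (trans (+-congʳ (sym (absorb X p⁶q⁶≈1))) (solve 3 (λ p q x → p :* q :* x :- p := p :* (q :* x :- con (+ 1))) refl p⁶ q⁶ X)))

        1-p³X : 1# - X * p³ ≈ p³ * (q³ - X)
        1-p³X = trans (+-congʳ (sym p³q³≈1)) (solve 3 (λ p q x → p :* q :- x :* p := p :* (q :- x)) refl p³ q³ X)

      Ĝ-at : Ĝ k m ≈ core * (p * (Y * Y) * B₂)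
      Ĝ-at = trans (*-cong (*-congʳ (*-cong (*-congˡ (trans (poch-shift Y q⁶ k) (*-congˡ (trans end-Y (1-a*y c³))))) (*-congʳ (trans Iα⁻ (*-congʳ 1-cpX)))))
                     (*-congˡ e₂≈))
        (solve 14 (λ px py y a p r s t i j w σ e u → px :* (py :* (y :* a)) :* (p :* r :* (s :* (t :* i)) :* j) :* (y :* w) :* (σ :* (e :* u))
           := px :* py :* (i :* j) :* (σ :* e) :* (p :* (y :* y) :* (a :* t :* s :* r :* w :* u)))
           refl px py Y (X - c³) p (q - C₁ * X) (1# - C₁ * q * X) (1# - C₁ * q³ * X) (I (α (suc k) m)) (I (β (suc k) m)) (X - q⁶) (σ m) (e₁ m * e₂ m) (1# - X * q³))

      Ĝ-suc : Ĝ k (ℤ.suc m) ≈ core * (p * (Y * Y) * B₁)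
      Ĝ-suc = begin
        Ĝ k (ℤ.suc m)
          ≈⟨ *-cong (*-cong (*-cong (*-cong (poch-cong q⁶ k (x-suc m)) (*-cong (trans (1-cong (y-suc m)) 1-p⁶Y)
                (poch-cong q⁶ k (trans (*-congˡ (y-suc m)) (trans (sym (*-assoc _ _ _)) (absorb Y (trans (*-comm _ _) p⁶q⁶≈1)))))))
               (*-cong Iα⁺ (trans Iβ⁻ (*-cong 1-cpY (*-cong (1-a*y (C₁ * q)) (*-congʳ (1-a*y (C₁ * q³))))))))
              (*-cong (y-suc m) (+-congʳ (x-suc m)))) (*-cong (σ-suc m) (trans (e₂-suc m) (trans e₁≈ (*-congˡ 1-p³X)))) ⟩
        px⁺ * (Y * (p⁶ * b) * py) * (i * (Y * (p * r) * (Y * s * (Y * t * j)))) * (p⁶ * Y * (q⁶ * X - q⁶)) * (- (q⁶ * q³ * (X * (X * X)) * σ m) * (ee * (p³ * u)))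
          ≈⟨ solve 15 (λ px⁺ y b py i p r s t j q x σ ee u →
               let q³ = q :* (q :* q) ; q⁶ = q³ :* q³ ; p³ = p :* (p :* p) ; p⁶ = p³ :* p³ in
               px⁺ :* (y :* (p⁶ :* b) :* py) :* (i :* (y :* (p :* r) :* (y :* s :* (y :* t :* j)))) :* (p⁶ :* y :* (q⁶ :* x :- q⁶)) :* (:- (q⁶ :* q³ :* (x :* (x :* x)) :* σ) :* (ee :* (p³ :* u)))
               := (x :* y :* (x :* y) :* (x :* y)) :* ((p³ :* q³) :* (p⁶ :* q⁶ :* (p⁶ :* q⁶))) :* (((con (+ 1) :- x) :* px⁺) :* py :* (i :* j) :* (σ :* ee) :* (p :* (y :* y) :* (b :* t :* s :* r :* u))))
               refl px⁺ Y b py i p r s t j q X (σ m) ee u ⟩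
        X * Y * (X * Y) * (X * Y) * (p³ * q³ * (p⁶ * q⁶ * (p⁶ * q⁶))) * ((1# - X) * px⁺ * py * (i * j) * (σ m * ee) * (p * (Y * Y) * (b * t * s * r * u)))
          ≈⟨ absorb _ (trans (*-cong (one³ (xy≈1 m)) (trans (*-cong p³q³≈1 (trans (*-cong p⁶q⁶≈1 p⁶q⁶≈1) (*-identityʳ _))) (*-identityʳ _))) (*-identityʳ _)) ⟩
        (1# - X) * px⁺ * py * (i * j) * (σ m * ee) * (p * (Y * Y) * (b * t * s * r * u))
          -- The factor 1 - X, left over from q⁶ X - q⁶ and the sign of `σ`, completes the shifted
          -- product to (X;q⁶)_{k+1}.
          ≈⟨ *-congʳ (*-congʳ (*-congʳ (*-congʳ (trans (poch-shift X q⁶ k) (*-congˡ end-X))))) ⟩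
        px * (1# - c³ * X) * py * (i * j) * (σ m * ee) * (p * (Y * Y) * (b * t * s * r * u))
          ≈⟨ solve 12 (λ px a py J E p y b t s r u → px :* a :* py :* J :* E :* (p :* (y :* y) :* (b :* t :* s :* r :* u))
               := px :* py :* J :* E :* (p :* (y :* y) :* (a :* b :* t :* s :* r :* u))) refl px _ py _ _ p Y b t s r u ⟩
        core * (p * (Y * Y) * B₁) ∎
        where
        px⁺ = poch (q⁶ * X) q⁶ k
        b = q⁶ * X - 1#
        i = I (α (suc k) m)
        j = I (β (suc k) m)
        r = q * X - C₁
        s = X - C₁ * q
        t = X - C₁ * q³
        u = q³ - X
        ee = e₁ m * e₂ m

      -- After division by `core` this is `open-form` at c = q^(2k). Both coefficients of `D̂` are
      -- free of m, so the equation can be summed over m.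
      wz : q * (1# - C₁ * C₁ * (q * q)) * (1# - C₁ * C₁ * q⁴) * (1# - C₁ * q⁶) * (q³ - C₁) * D̂ (suc k) m
         ≈ (1# - c³ * q⁶) * (q - C₁ * C₁) * (1# - C₁ * C₁ * q) * (q³ - c³) * D̂ k m
         + q * (C₁ * (1# - c⁴ * q³)) * (Ĝ k (ℤ.suc m) - Ĝ k m)
      wz = begin
        An * D̂ (suc k) m ≈⟨ *-congˡ D̂-suc ⟩
        An * (core * d₁)  ≈⟨ solve 3 (λ a b c → a :* (b :* c) := b :* (a :* c)) refl An core d₁ ⟩
        core * (An * d₁)  ≈⟨ *-congˡ (open-form C₁) ⟩
        core * (Δ * d₀ + g * (Y * Y) * (B₁ - B₂))
          -- Both values of `Ĝ` carry a factor p, from `1-cpX` and `1-cpY`; q p = 1 is inserted to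
          -- match it.
          ≈⟨ *-congˡ (+-congˡ (sym (absorb _ qp≈1))) ⟩
        core * (Δ * d₀ + q * p * (g * (Y * Y) * (B₁ - B₂)))
          ≈⟨ solve 9 (λ c Δ d q p g Y b₁ b₂ → c :* (Δ :* d :+ q :* p :* (g :* (Y :* Y) :* (b₁ :- b₂)))
               := Δ :* (c :* d) :+ q :* g :* (c :* (p :* (Y :* Y) :* b₁) :- c :* (p :* (Y :* Y) :* b₂))) refl core Δ d₀ q p g Y B₁ B₂ ⟩
        Δ * (core * d₀) + q * g * (core * (p * (Y * Y) * B₁) - core * (p * (Y * Y) * B₂))
          ≈⟨ +-cong (*-congˡ (sym D̂-at)) (*-congˡ (+-cong (sym Ĝ-suc) (-‿cong (sym Ĝ-at)))) ⟩
        Δ * D̂ k m + q * g * (Ĝ k (ℤ.suc m) - Ĝ k m) ∎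
        where
        An = q * (1# - C₁ * C₁ * (q * q)) * (1# - C₁ * C₁ * q⁴) * (1# - C₁ * q⁶) * (q³ - C₁)
        Δ = (1# - c³ * q⁶) * (q - C₁ * C₁) * (1# - C₁ * C₁ * q) * (q³ - c³)
        d₁ = (1# - c³ * X) * (1# - c³ * Y) * (1# - X * X)
        d₀ = (1# - C₁ * q³ * X) * (1# - C₁ * q³ * Y) * (1# - X * X)
        g = C₁ * (1# - c⁴ * q³)

    I-negative : ∀ {z} n → z ≡ -[1+ n ] → I z ≈ 0#
    I-negative n ≡.refl = refl

    private
      left-end : ∀ k j → -[1+ 0 ] ℤ.+ (-[1+ 0 ] ℤ.+ (k ℤ.+ (+ 3 ℤ.* (ℤ.- (k ℤ.+ j)) ℤ.+ + 1))) ≡ ℤ.- (+ 1 ℤ.+ (k ℤ.+ k ℤ.+ (j ℤ.+ j ℤ.+ j)))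
      left-end = ℤ-solve
      right-end : ∀ k j → + 1 ℤ.+ k ℤ.- + 3 ℤ.* (+ 1 ℤ.+ (k ℤ.+ j)) ≡ ℤ.- (+ 1 ℤ.+ (+ 1 ℤ.+ (k ℤ.+ k ℤ.+ (j ℤ.+ j ℤ.+ j))))
      right-end = ℤ-solve
      kill : ∀ {a b c d e} → e ≈ 0# → a * b * (c * e) * d ≈ 0#
      kill {a} {b} {c} {d} z = trans (*-congʳ (trans (*-congˡ (trans (*-congˡ z) (zeroʳ c))) (zeroʳ _))) (zeroˡ d)

    -- At this end the first reciprocal has index -(2k + 3j + 1); at the other end, in `Ĝ-right`,
    -- the second has index -(2k + 3j + 2). The boundary terms therefore vanish for every range |m|
    -- ≤ k + j.
    Ĝ-left : ∀ k j → Ĝ k (ℤ.- (+ (k ℕ.+ j))) ≈ 0#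
    Ĝ-left k j = trans (*-congʳ (*-congʳ (*-congˡ (*-comm _ _)))) (trans (*-congʳ (kill (I-negative _ (left-end (+ k) (+ j))))) (zeroˡ _))

    Ĝ-right : ∀ k j → Ĝ k (+ suc (k ℕ.+ j)) ≈ 0#
    Ĝ-right k j = trans (*-congʳ (kill (I-negative _ (right-end (+ k) (+ j))))) (zeroˡ _)

    U : ℕ → ℕ → Carrier
    U L k = sumℤ L (D̂ k)

    U-rec : ∀ k j → let L = k ℕ.+ j ; c² = c k * c k ; c³ = c k * c² in
      q * (1# - c² * (q * q)) * (1# - c² * q⁴) * (1# - c k * q⁶) * (q³ - c k) * U L (suc k)
      ≈ (1# - c³ * q⁶) * (q - c²) * (1# - c² * q) * (q³ - c³) * U L k
    U-rec k j = begin
      An * U L (suc k)                              ≈⟨ sumℤ-* L An (D̂ (suc k)) ⟨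
      sumℤ L (λ m → An * D̂ (suc k) m)               ≈⟨ sumℤ-cong L (λ m → Step.wz k m) ⟩
      sumℤ L (λ m → Δ * D̂ k m + g * ΔG m)           ≈⟨ sumℤ-+ L (λ m → Δ * D̂ k m) (λ m → g * ΔG m) ⟩
      sumℤ L (λ m → Δ * D̂ k m) + sumℤ L (λ m → g * ΔG m)
        ≈⟨ +-cong (sumℤ-* L Δ (D̂ k)) (trans (sumℤ-* L g ΔG) (*-congˡ (trans (sumℤ-telescope L (Ĝ k)) (+-cong (Ĝ-right k j) (-‿cong (Ĝ-left k j)))))) ⟩
      Δ * U L k + g * (0# - 0#)
        ≈⟨ solve 2 (λ a g → a :+ g :* (con (+ 0) :- con (+ 0)) := a) refl (Δ * U L k) g ⟩
      Δ * U L k ∎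
      where
      L = k ℕ.+ j
      c² = c k * c k
      c³ = c k * c²
      An = q * (1# - c² * (q * q)) * (1# - c² * q⁴) * (1# - c k * q⁶) * (q³ - c k)
      Δ = (1# - c³ * q⁶) * (q - c²) * (1# - c² * q) * (q³ - c³)
      g = q * (c k * (1# - c k * c³ * q³))
      ΔG : ℤ → Carrier
      ΔG m = Ĝ k (ℤ.suc m) - Ĝ k m

    -- Closed form of the sum over m

    poch≉0 : ∀ {u b} k → (∀ i → ∃ λ z → z ≢ + 0 × u * pow b i ≈ qz z) → ¬ poch u b k ≈ 0#
    poch≉0 zero    h = 1≉0
    poch≉0 (suc k) h = *-nonzero (poch≉0 k h) (λ e → let (z , z≢0 , eq) = h k in 1-qz≉0 z z≢0 (trans (sym (1-cong eq)) e))

    A B w P′ Q′ Q : ℕ → Carrier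
    A k = poch q q² k
    B k = poch q⁶ q⁶ k
    w k = B k ⁻¹
    P′ k = poch q q² (2 ℕ.* k) * poch p³ q⁶ k
    Q′ k = poch q² q² (2 ℕ.* k) * poch p³ q² k * poch q⁶ q² k
    Q k = poch q² q² (2 ℕ.* k) * B k * poch p³ q² k * poch q⁶ q² k

    -- The summand of the theorem: c k = q^(2k), so the first two factors form [8k + 1].
    t : ℕ → Carrier
    t k = (1# - c k * (c k * (c k * c k)) * q) * (1# - q) ⁻¹ * (A k * A k) * P′ k * c k * Q k ⁻¹

    -- A normalisation: `U L 0` reduces to `e₁ (+ 0) * e₂ (+ 0)`, the reciprocal of (1 - q⁴)(1 -
    -- q⁻²), and `U-closed` at k = 0 then forces this value.
    K : Carrier
    K = (1# - qz (+ 4)) * (1# - qz -[1+ 1 ]) * ((1# - q) ⁻¹ * (1# - q) ⁻¹)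

    -- `δ k` is the ratio of the summand to the sum `U`. `ε k` is the prefactor that makes
    -- `ε k * Ê k m` an antidifference in k of `δ k * D̂ k m`; note its index k + 1 in `A` against k
    -- in `w`.
    δ ε : ℕ → Carrier
    δ k = K * (A k * A k) * (w k * w k) * (c k * (c k * c k - q) * (1# - c k * (c k * (c k * c k)) * q))
    ε k = K * (A (suc k) * A (suc k)) * (w k * w k)

    1-q≉0 : ¬ 1# - q ≈ 0#
    1-q≉0 e = 1-qz≉0 (+ 1) (λ ()) (trans (1-cong qz1) e)

    q²-even : ∀ i z → qz z * pow q² i ≈ qz (+ (i ℕ.+ i) ℤ.+ z)
    q²-even i z = trans (*-comm _ _) (trans (*-congʳ (c-qz i)) (sym (qz-+ (+ (i ℕ.+ i)) z)))

    B≉0 : ∀ k → ¬ B k ≈ 0#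
    B≉0 k = poch≉0 k (λ i → + (i ℕ.+ i ℕ.+ (i ℕ.+ i ℕ.+ (i ℕ.+ i)) ℕ.+ 6) , (λ e → ℕₚ.1+n≢0 (≡.trans (ℕₚ.+-comm 6 _) (ℤₚ.+-injective e))) ,
      trans (*-comm _ _) (trans (*-cong (trans (c³-pow i) (trans (*-cong (c-qz i) (trans (*-cong (c-qz i) (c-qz i)) (sym (qz-+ (+ (i ℕ.+ i)) (+ (i ℕ.+ i))))))
        (sym (qz-+ (+ (i ℕ.+ i)) (+ (i ℕ.+ i ℕ.+ (i ℕ.+ i))))))) (sym qz6)) (sym (qz-+ (+ (i ℕ.+ i ℕ.+ (i ℕ.+ i ℕ.+ (i ℕ.+ i)))) (+ 6)))))

    -- As 3 is odd, no factor of (q⁻³;q²)_k is 1 - q⁰, although the exponents change sign between i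
    -- = 1 and i = 2.
    2i-3≢0 : ∀ i → + (i ℕ.+ i) ℤ.+ -[1+ 2 ] ≢ + 0
    2i-3≢0 0 ()
    2i-3≢0 1 ()
    2i-3≢0 (suc (suc i)) e rewrite ℕₚ.+-suc i (suc i) | ℕₚ.+-suc i i = ℕₚ.1+n≢0 (ℤₚ.+-injective e)

    Q≉0 : ∀ k → ¬ Q k ≈ 0#
    Q≉0 k = *-nonzero (*-nonzero (*-nonzero (q²-poch≉0 (2 ℕ.* k)) (B≉0 k))
      (poch≉0 k (λ i → + (i ℕ.+ i) ℤ.+ -[1+ 2 ] , 2i-3≢0 i , trans (*-congʳ (sym qz-3)) (q²-even i -[1+ 2 ]))))
      (poch≉0 k (λ i → + (i ℕ.+ i ℕ.+ 6) , (λ e → ℕₚ.1+n≢0 (≡.trans (ℕₚ.+-comm 6 _) (ℤₚ.+-injective e))) , trans (*-congʳ (sym qz6)) (q²-even i (+ 6))))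

    double : ∀ k → 2 ℕ.* suc k ≡ suc (suc (2 ℕ.* k))
    double k = ≡.cong suc (ℕₚ.+-suc k (k ℕ.+ 0))

    c²-pow : ∀ k → pow q² (2 ℕ.* k) ≈ c k * c k
    c²-pow k = trans (pow-+ q² k (k ℕ.+ 0)) (*-congˡ (reflexive (≡.cong (pow q²) (ℕₚ.+-identityʳ k))))

    poch-double : ∀ u k → poch u q² (2 ℕ.* suc k) ≈ poch u q² (2 ℕ.* k) * (1# - c k * c k * u) * (1# - c k * c k * q² * u)
    poch-double u k = trans (reflexive (≡.cong (poch u q²) (double k)))
      (*-cong (*-congˡ (1-cong (trans (*-comm _ _) (*-congʳ (c²-pow k))))) (1-cong (trans (*-comm _ _) (*-congʳ (*-congʳ (c²-pow k))))))

    w-step : ∀ k → w k ≈ (1# - c k * (c k * c k) * q⁶) * w (suc k)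
    w-step k = sym (inverse-unique (trans (sym (*-assoc _ _ _)) (trans (*-congʳ (*-congˡ (sym (1-cong (trans (*-comm _ _) (*-congʳ (c³-pow k)))))))
      (*-inverse _ (B≉0 (suc k))))))

    -- Induction on k: `U-rec` is first order, and `P′`, `Q′`, `w` and c² - q change from k to k + 1
    -- by exactly its coefficients.
    U-closed : ∀ k j → P′ k * (1# - q) ⁻¹ ≈ Q′ k * K * w k * (c k * c k - q) * U (k ℕ.+ j) k
    U-closed zero j = sym (begin
      1# * 1# * 1# * K * w 0 * (1# * 1# - q) * U j 0
        ≈⟨ *-cong (*-congʳ (*-congˡ w0)) U0 ⟩
      1# * 1# * 1# * (a * b * (r * r)) * 1# * (1# * 1# - q) * (1# * 1# * (i * i₁) * (1# * 1# * (1# - q * q) * (a⁻ * b⁻)))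
        ≈⟨ solve 8 (λ a a⁻ b b⁻ r q i i₁ → let o = con (+ 1) in
             o :* o :* o :* (a :* b :* (r :* r)) :* o :* (o :* o :- q) :* (o :* o :* (i :* i₁) :* (o :* o :* (o :- q :* q) :* (a⁻ :* b⁻)))
             := (a :* a⁻) :* (b :* b⁻) :* ((o :- q) :* r) :* (o :* i₁) :* ((o :* (o :- q :* q :* o)) :* i) :* (o :* o :* r)) refl a a⁻ b b⁻ r q i i₁ ⟩
      a * a⁻ * (b * b⁻) * ((1# - q) * r) * (1# * i₁) * (1# * (1# - q * q * 1#) * i) * (1# * 1# * r)
        ≈⟨ *-congʳ (trans (*-cong (trans (*-cong (trans (*-cong (trans (*-cong ia ib) o²) ir) o²) i₁1) o²) i1) o²) ⟩
      1# * (1# * 1# * r)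
        ≈⟨ *-identityˡ _ ⟩
      1# * 1# * r ∎)
      where
      a = 1# - qz (+ 4)
      b = 1# - qz -[1+ 1 ]
      a⁻ = e₁ (+ 0)
      b⁻ = e₂ (+ 0)
      r = (1# - q) ⁻¹
      i = I (+ 1)
      i₁ = I (+ 0)
      o² : 1# * 1# ≈ 1#
      o² = *-identityˡ 1#
      w0 : w 0 ≈ 1#
      w0 = sym (inverse-unique o²)
      ia : a * a⁻ ≈ 1#
      ia = *-inverse a (1-qz≉0 (+ 4) (λ ()))
      ib : b * b⁻ ≈ 1#
      ib = *-inverse b (1-qz≉0 -[1+ 1 ] (λ ()))
      ir : (1# - q) * r ≈ 1#
      ir = *-inverse _ 1-q≉0
      i1 : 1# * (1# - q * q * 1#) * i ≈ 1#
      i1 = *-inverse _ (q²-poch≉0 1)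
      i₁1 : 1# * i₁ ≈ 1#
      i₁1 = *-inverse _ 1≉0
      D̂0 : D̂ 0 (+ 0) ≈ 1# * 1# * (i * i₁) * (1# * 1# * (1# - q * q) * (a⁻ * b⁻))
      D̂0 = *-congˡ (*-congʳ (*-congˡ (1-cong (*-cong qz1 qz1))))
      D̂0-zero : ∀ {m} → I (α 0 m) * I (β 0 m) ≈ 0# → D̂ 0 m ≈ 0#
      D̂0-zero e = trans (*-congʳ (trans (*-congˡ e) (zeroʳ _))) (zeroˡ _)
      β-pos : ∀ j → + 0 ℤ.- + 3 ℤ.* (+ 1 ℤ.+ j) ≡ ℤ.- (+ 1 ℤ.+ (+ 2 ℤ.+ (j ℤ.+ j ℤ.+ j)))
      β-pos = ℤ-solve
      α-neg : ∀ j → + 0 ℤ.+ (+ 3 ℤ.* (ℤ.- (+ 1 ℤ.+ j)) ℤ.+ + 1) ≡ ℤ.- (+ 1 ℤ.+ (+ 1 ℤ.+ (j ℤ.+ j ℤ.+ j)))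
      α-neg = ℤ-solve
      -- Only m = 0 survives: for m > 0 the index -3m is negative, for m < 0 the index 3m + 1 is.
      U0 : U j 0 ≈ 1# * 1# * (i * i₁) * (1# * 1# * (1# - q * q) * (a⁻ * b⁻))
      U0 = trans (sumℤ-single j (D̂ 0)
             (λ n → D̂0-zero {+ suc n} (trans (*-congˡ (I-negative _ (β-pos (+ n)))) (zeroʳ _)))
             (λ n → D̂0-zero { -[1+ n ]} (trans (*-congʳ (I-negative _ (α-neg (+ n)))) (zeroˡ _)))) D̂0
    U-closed (suc k) j = begin
      poch q q² (2 ℕ.* suc k) * (poch p³ q⁶ k * (1# - p³ * pow q⁶ k)) * r
        ≈⟨ *-congʳ (*-cong (poch-double q k) (*-congˡ (trans (1-cong (*-congˡ (c³-pow k))) (trans (+-congʳ (sym p³q³≈1)) (solve 3 (λ p q c → p :* q :- p :* c := p :* (q :- c)) refl p³ q³ c³))))) ⟩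
      poch q q² (2 ℕ.* k) * (1# - c² * q) * (1# - c² * q² * q) * (poch p³ q⁶ k * (p³ * (q³ - c³))) * r
        ≈⟨ solve 6 (λ a b d e f r → a :* b :* d :* (e :* f) :* r := (a :* e :* r) :* (b :* d :* f)) refl (poch q q² (2 ℕ.* k)) (1# - c² * q) (1# - c² * q² * q) (poch p³ q⁶ k) (p³ * (q³ - c³)) r ⟩
      P′ k * r * ((1# - c² * q) * (1# - c² * q² * q) * (p³ * (q³ - c³)))
        -- The hypothesis is taken with one more unit of slack, so that the range is that of the
        -- case k + 1.
        ≈⟨ *-congʳ (trans (U-closed k (suc j)) (*-cong (*-congʳ (*-congˡ (w-step k))) (reflexive (≡.cong (λ L → U L k) (ℕₚ.+-suc k j))))) ⟩
      Q′ k * K * ((1# - c³ * q⁶) * w (suc k)) * (c² - q) * U L k * ((1# - c² * q) * (1# - c² * q² * q) * (p³ * (q³ - c³)))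
        ≈⟨ solve 9 (λ Q K w a c² q p³ d u → let o = con (+ 1) in Q :* K :* (a :* w) :* (c² :- q) :* u :* ((o :- c² :* q) :* (o :- c² :* (q :* q) :* q) :* (p³ :* d))
             := Q :* K :* w :* (p³ :* (c² :* (q :* q) :* q :- o)) :* (a :* (q :- c²) :* (o :- c² :* q) :* d :* u)) refl (Q′ k) K (w (suc k)) (1# - c³ * q⁶) c² q p³ (q³ - c³) (U L k) ⟩
      Q′ k * K * w (suc k) * (p³ * (c² * q² * q - 1#)) * ((1# - c³ * q⁶) * (q - c²) * (1# - c² * q) * (q³ - c³) * U L k)
        ≈⟨ *-congˡ rec ⟨
      Q′ k * K * w (suc k) * (p³ * (c² * q² * q - 1#)) * (q * (1# - c² * (q * q)) * (1# - c² * q⁴) * (1# - c k * q⁶) * (q³ - c k) * U L (suc k))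
        ≈⟨ solve 9 (λ a b d K w p³ q c u → let o = con (+ 1) ; q³ = q :* (q :* q) ; q² = q :* q in
             (a :* b :* d) :* K :* w :* (p³ :* (c :* c :* q² :* q :- o)) :* (q :* (o :- c :* c :* (q :* q)) :* (o :- c :* c :* (q :* q³)) :* (o :- c :* (q³ :* q³)) :* (q³ :- c) :* u)
             := (a :* (o :- c :* c :* q²) :* (o :- c :* c :* q² :* q²)) :* (b :* (p³ :* (q³ :- c))) :* (d :* (o :- (q³ :* q³) :* c)) :* K :* w :* (c :* q² :* (c :* q²) :- q) :* u)
             refl (poch q² q² (2 ℕ.* k)) (poch p³ q² k) (poch q⁶ q² k) K (w (suc k)) p³ q (c k) (U L (suc k)) ⟩
      (poch q² q² (2 ℕ.* k) * (1# - c² * q²) * (1# - c² * q² * q²)) * (poch p³ q² k * (p³ * (q³ - c k))) * (poch q⁶ q² k * (1# - q⁶ * c k)) * K * w (suc k) * (c (suc k) * c (suc k) - q) * U L (suc k)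
        ≈⟨ *-congʳ (*-congʳ (*-congʳ (*-congʳ (*-congʳ (*-cong (sym (poch-double q² k)) (*-congˡ (sym (trans (+-congʳ (sym p³q³≈1)) (solve 3 (λ p q c → p :* q :- p :* c := p :* (q :- c)) refl p³ q³ (c k)))))))))) ⟩
      Q′ (suc k) * K * w (suc k) * (c (suc k) * c (suc k) - q) * U L (suc k) ∎
      where
      r = (1# - q) ⁻¹
      c² = c k * c k
      c³ = c k * c²
      L = suc k ℕ.+ j
      rec : q * (1# - c² * (q * q)) * (1# - c² * q⁴) * (1# - c k * q⁶) * (q³ - c k) * U L (suc k)
        ≈ (1# - c³ * q⁶) * (q - c²) * (1# - c² * q) * (q³ - c³) * U L k
      rec = ≡.subst (λ L → q * (1# - c² * (q * q)) * (1# - c² * q⁴) * (1# - c k * q⁶) * (q³ - c k) * U L (suc k)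
        ≈ (1# - c³ * q⁶) * (q - c²) * (1# - c² * q) * (q³ - c³) * U L k) (ℕₚ.+-suc k j) (U-rec k (suc j))

    t≈δU : ∀ k j → t k ≈ δ k * U (k ℕ.+ j) k
    t≈δU k j = begin
      g * r * (A k * A k) * P′ k * c k * Q⁻
        ≈⟨ solve 6 (λ g r a p c Q → g :* r :* a :* p :* c :* Q := g :* a :* c :* Q :* (p :* r)) refl g r (A k * A k) (P′ k) (c k) Q⁻ ⟩
      g * (A k * A k) * c k * Q⁻ * (P′ k * r)
        ≈⟨ *-congˡ (U-closed k j) ⟩
      g * (A k * A k) * c k * Q⁻ * (Q′ k * K * w k * (c k * c k - q) * U (k ℕ.+ j) k)
        ≈⟨ solve 9 (λ g a c Q Q′ K w d u → g :* a :* c :* Q :* (Q′ :* K :* w :* d :* u) := (Q′ :* Q) :* (g :* a :* c :* K :* w :* d :* u)) refl g (A k * A k) (c k) Q⁻ (Q′ k) K (w k) (c k * c k - q) (U (k ℕ.+ j) k) ⟩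
      Q′ k * Q⁻ * (g * (A k * A k) * c k * K * w k * (c k * c k - q) * U (k ℕ.+ j) k)
        ≈⟨ *-congʳ Q′Q⁻ ⟩
      w k * (g * (A k * A k) * c k * K * w k * (c k * c k - q) * U (k ℕ.+ j) k)
        ≈⟨ solve 7 (λ w g a c K d u → w :* (g :* a :* c :* K :* w :* d :* u) := K :* a :* (w :* w) :* (c :* d :* g) :* u) refl (w k) g (A k * A k) (c k) K (c k * c k - q) (U (k ℕ.+ j) k) ⟩
      δ k * U (k ℕ.+ j) k ∎
      where
      g = 1# - c k * (c k * (c k * c k)) * q
      r = (1# - q) ⁻¹
      Q⁻ = Q k ⁻¹
      Q′Q⁻ : Q′ k * Q⁻ ≈ w k
      Q′Q⁻ = inverse-unique (trans (solve 5 (λ B a b d Q → B :* (a :* b :* d :* Q) := a :* B :* b :* d :* Q) refl (B k) _ _ _ Q⁻) (*-inverse _ (Q≉0 k)))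

    -- The summand for N = 6m + 1: x m = q^N, and the two reciprocals in Ê confine N to |N| ≤ 2k + 1.
    E : ℕ → ℤ → Carrier
    E k m = ε k * Ê k m

    E-zero : ∀ m → E 0 m ≈ δ 0 * D̂ 0 m
    E-zero m = solve 5 (λ K w q J r → let o = con (+ 1) in K :* (o :* (o :- q :* o) :* (o :* (o :- q :* o))) :* w :* (o :* o :* J :* r)
      := K :* (o :* o) :* w :* (o :* (o :* o :- q) :* (o :- o :* (o :* (o :* o)) :* q)) :* (o :* o :* J :* r)) refl K (w 0 * w 0) q (I (α 0 m) * I (β 0 m)) (ρ m)

    -- Since x y = 1, each product (1 - a x)(1 - a y) is affine in x + y. The three terms carry a =
    -- q^(6k+6), a = q^(2k+3) and a = 1, so the claim reduces to a linear relation between three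
    -- affine functions with coefficients in q and q^(2k).
    E-suc : ∀ k m → E (suc k) m ≈ E k m + δ (suc k) * D̂ (suc k) m
    E-suc k m = begin
      ε (suc k) * (u * (1# - q⁶ * x m * pow q⁶ k) * (v * (1# - q⁶ * y m * pow q⁶ k)) * J * ρ m)
        ≈⟨ *-congˡ (*-congʳ (*-congʳ (*-cong (*-congˡ (end (x m))) (*-congˡ (end (y m)))))) ⟩
      ε (suc k) * (u * (1# - b * x m) * (v * (1# - b * y m)) * J * ρ m)
        ≈⟨ solve 9 (λ K a w u s v t J r → K :* a :* w :* (u :* s :* (v :* t) :* J :* r) := K :* w :* (u :* v :* J :* r) :* (a :* (s :* t))) refl K (A (suc (suc k)) * A (suc (suc k))) (w (suc k) * w (suc k)) u _ v _ J (ρ m) ⟩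
      K * (w (suc k) * w (suc k)) * core * (A (suc (suc k)) * A (suc (suc k)) * ((1# - b * x m) * (1# - b * y m)))
        ≈⟨ *-congˡ (*-congˡ (linear b)) ⟩
      K * (w (suc k) * w (suc k)) * core * (A (suc (suc k)) * A (suc (suc k)) * (1# + b * b - b * (x m + y m)))
        ≈⟨ solve 8 (λ K w z a c q x y → let o = con (+ 1) ; q² = q :* q ; q³ = q :* q² ; b = c :* (c :* c) :* (q³ :* q³) ; d = c :* q³ ; c′ = c :* q² in
             K :* (w :* w) :* z :* (a :* (o :- q :* c′) :* (a :* (o :- q :* c′)) :* (o :+ b :* b :- b :* (x :+ y)))
             := K :* (w :* w) :* z :* (a :* a) :* ((o :- b) :* (o :- b)) :* (o :+ d :* d :- d :* (x :+ y))
             :+ K :* (w :* w) :* z :* (a :* a) :* (c′ :* (c′ :* c′ :- q) :* (o :- c′ :* (c′ :* (c′ :* c′)) :* q)) :* (o :+ o :* o :- o :* (x :+ y))) refl K (w (suc k)) core (A (suc k)) (c k) q (x m) (y m) ⟩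
      K * (w (suc k) * w (suc k)) * core * (A (suc k) * A (suc k)) * ((1# - b) * (1# - b)) * (1# + d * d - d * (x m + y m))
        + K * (w (suc k) * w (suc k)) * core * (A (suc k) * A (suc k)) * γ * (1# + 1# * 1# - 1# * (x m + y m))
        ≈⟨ +-cong (*-congˡ (sym (linear d))) (*-congˡ (trans (sym (linear 1#)) (*-cong (1-cong (*-identityˡ _)) (1-cong (*-identityˡ _))))) ⟩
      K * (w (suc k) * w (suc k)) * core * (A (suc k) * A (suc k)) * ((1# - b) * (1# - b)) * ((1# - d * x m) * (1# - d * y m))
        + K * (w (suc k) * w (suc k)) * core * (A (suc k) * A (suc k)) * γ * ((1# - x m) * (1# - y m))
        ≈⟨ +-cong
            (solve 11 (λ K w u v i j r a b s t → K :* (w :* w) :* (u :* v :* (i :* j) :* r) :* a :* (b :* b) :* (s :* t) := K :* a :* ((b :* w) :* (b :* w)) :* (u :* v :* ((s :* i) :* (t :* j)) :* r))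
              refl K (w (suc k)) u v _ _ (ρ m) (A (suc k) * A (suc k)) (1# - b) (1# - d * x m) (1# - d * y m))
            (solve 10 (λ K w u v J r a g s t → K :* w :* (u :* v :* J :* r) :* a :* g :* (s :* t) := K :* a :* w :* g :* (s :* u :* (t :* v) :* J :* r))
              refl K (w (suc k) * w (suc k)) u v J (ρ m) (A (suc k) * A (suc k)) γ (1# - x m) (1# - y m)) ⟩
      K * (A (suc k) * A (suc k)) * ((1# - b) * w (suc k) * ((1# - b) * w (suc k))) * (u * v * ((1# - d * x m) * I (α (suc k) m) * ((1# - d * y m) * I (β (suc k) m))) * ρ m)
        + δ (suc k) * ((1# - x m) * u * ((1# - y m) * v) * J * ρ m)
        ≈⟨ +-cong (*-cong (*-congˡ (*-cong (sym (w-step k)) (sym (w-step k)))) (*-congʳ (*-congˡ (*-cong (sym (Step.Iα k m)) (sym (Step.Iβ k m))))))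
                  (*-congˡ (*-congʳ (*-congʳ (*-cong (poch-shift (x m) q⁶ k) (poch-shift (y m) q⁶ k))))) ⟩
      E k m + δ (suc k) * D̂ (suc k) m ∎
      where
      u = poch (q⁶ * x m) q⁶ k
      v = poch (q⁶ * y m) q⁶ k
      J = I (α (suc k) m) * I (β (suc k) m)
      core = u * v * J * ρ m
      b = c k * (c k * c k) * q⁶
      d = c k * q³
      γ = c (suc k) * (c (suc k) * c (suc k) - q) * (1# - c (suc k) * (c (suc k) * (c (suc k) * c (suc k))) * q)
      end : ∀ z → 1# - q⁶ * z * pow q⁶ k ≈ 1# - b * z
      end z = 1-cong (trans (*-congˡ (c³-pow k)) (solve 3 (λ q z c → q :* z :* c := c :* q :* z) refl q⁶ z _))
      linear : ∀ a → (1# - a * x m) * (1# - a * y m) ≈ 1# + a * a - a * (x m + y m)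
      linear a = trans (solve 3 (λ a x y → let o = con (+ 1) in (o :- a :* x) :* (o :- a :* y) := o :+ a :* a :* (x :* y) :- a :* (x :+ y)) refl a (x m) (y m))
        (+-congʳ (+-congˡ (trans (*-congˡ (xy≈1 m)) (*-identityʳ _))))

    -- Interchange of the summations over k and m

    partialSum : (ℕ → Carrier) → ℕ → Carrier
    partialSum f zero    = f 0
    partialSum f (suc k) = partialSum f k + f (suc k)

    -- Replacing `t` by `δ * U` and applying `E-suc` under the sum over m. The slack j lets the
    -- hypothesis for k be used on the larger range of k + 1.
    partialSum-t : ∀ k j → partialSum t k ≈ sumℤ (k ℕ.+ j) (E k)
    partialSum-t zero    j = trans (t≈δU 0 j) (trans (sym (sumℤ-* j (δ 0) (D̂ 0))) (sumℤ-cong j (λ m → sym (E-zero m))))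
    partialSum-t (suc k) j = begin
      partialSum t k + t (suc k)
        ≈⟨ +-cong (trans (partialSum-t k (suc j)) (reflexive (≡.cong (λ L → sumℤ L (E k)) (ℕₚ.+-suc k j)))) (t≈δU (suc k) j) ⟩
      sumℤ L (E k) + δ (suc k) * U L (suc k)
        ≈⟨ +-congˡ (sumℤ-* L (δ (suc k)) (D̂ (suc k))) ⟨
      sumℤ L (E k) + sumℤ L (λ m → δ (suc k) * D̂ (suc k) m)
        ≈⟨ sumℤ-+ L (E k) (λ m → δ (suc k) * D̂ (suc k) m) ⟨
      sumℤ L (λ m → E k m + δ (suc k) * D̂ (suc k) m)
        ≈⟨ sumℤ-cong L (λ m → sym (E-suc k m)) ⟩
      sumℤ L (E (suc k)) ∎
      where L = suc k ℕ.+ j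

    expansion : ∀ k → partialSum t k ≈ sumℤ k (E k)
    expansion k = trans (partialSum-t k 0) (reflexive (≡.cong (λ L → sumℤ L (E k)) (ℕₚ.+-identityʳ k)))

-- Counting multiples of d

indicator : ∀ {A : Set} → Dec A → ℕ
indicator (yes _) = 1
indicator (no  _) = 0

indicator-≤1 : ∀ {A : Set} (p : Dec A) → indicator p ≤ 1
indicator-≤1 (yes _) = ℕₚ.≤-refl
indicator-≤1 (no  _) = z≤n

indicator-yes : ∀ {A : Set} (p : Dec A) → A → indicator p ≡ 1
indicator-yes (yes _) _ = ≡.refl
indicator-yes (no ¬a) a = ⊥-elim (¬a a)

indicator-no : ∀ {A : Set} (p : Dec A) → ¬ A → indicator p ≡ 0
indicator-no (yes a) ¬a = ⊥-elim (¬a a)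
indicator-no (no _)  _  = ≡.refl

indicator-⇔ : ∀ {A B : Set} (p : Dec A) (r : Dec B) → (A → B) → (B → A) → indicator p ≡ indicator r
indicator-⇔ (yes a) r f g = ≡.sym (indicator-yes r (f a))
indicator-⇔ (no ¬a) r f g = ≡.sym (indicator-no r (λ b → ¬a (g b)))

∣ℤ-combine : ∀ {d a b c} → d ∣ℤ a → d ∣ℤ b → c ≡ a ℤ.- b → d ∣ℤ c
∣ℤ-combine (divides s ≡.refl) (divides t ≡.refl) e = divides (s ℤ.- t) (≡.trans e (lemma s t _))
  where
  lemma : ∀ s t d → s ℤ.* d ℤ.- t ℤ.* d ≡ (s ℤ.- t) ℤ.* d
  lemma = ℤ-solve

∣ℤ-sum : ∀ {d a b c} → d ∣ℤ a → d ∣ℤ b → c ≡ a ℤ.+ b → d ∣ℤ c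
∣ℤ-sum (divides s ≡.refl) (divides t ≡.refl) e = divides (s ℤ.+ t) (≡.trans e (≡.sym (ℤₚ.*-distribʳ-+ _ s t)))

∣ℤ-times : ∀ {d a c} k → d ∣ℤ a → c ≡ k ℤ.* a → d ∣ℤ c
∣ℤ-times {d} k (divides s ≡.refl) e = divides (k ℤ.* s) (≡.trans e (≡.sym (ℤₚ.*-assoc k s d)))

-- The data h and u are explicit inverses modulo d: -h inverts 2 and u inverts 6.
module Counting (d h : ℕ) (d≡2h+1 : d ≡ suc (h ℕ.+ h))
  (d∤6 : ¬ (+ d) ∣ℤ (+ 6)) (u k : ℤ) (6u≡1+kd : + 6 ℤ.* u ≡ + 1 ℤ.+ k ℤ.* + d) where
  open import Data.Nat using (_+_; _*_)

  v : ℤ → ℕ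
  v z = indicator ((+ d) ∣ℤ? z)

  count : (ℕ → ℤ) → ℕ → ℕ
  count z zero    = 0
  count z (suc k) = count z k + v (z k)

  count-mono : ∀ z {j k} → j ≤ k → count z j ≤ count z k
  count-mono z {j} {zero}  z≤n = z≤n
  count-mono z {j} {suc k} j≤ with ℕₚ.m≤n⇒m<n∨m≡n j≤
  ... | inj₁ (s≤s j≤k) = ℕₚ.≤-trans (count-mono z j≤k) (ℕₚ.m≤m+n _ _)
  ... | inj₂ ≡.refl    = ℕₚ.≤-refl

  count-cong : ∀ {z z′} k → (∀ i → v (z i) ≡ v (z′ i)) → count z k ≡ count z′ k
  count-cong zero    e = ≡.refl
  count-cong (suc k) e = cong₂ _+_ (count-cong k e) (e k)

  count-≥ : ∀ z i₀ J k → (∀ j → (+ d) ∣ℤ z (i₀ + d * j)) → i₀ + d * J < k → suc J ≤ count z k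
  count-≥ z i₀ J k hit lt = ℕₚ.≤-trans (enough J) (count-mono z lt)
    where
    one : ∀ j → suc (count z (i₀ + d * j)) ≡ count z (suc (i₀ + d * j))
    one j = ≡.trans (ℕₚ.+-comm 1 _) (cong (_+_ (count z (i₀ + d * j))) (≡.sym (indicator-yes (_ ∣ℤ? _) (hit j))))
    next : ∀ j → suc (i₀ + d * j) ≤ i₀ + d * suc j
    next j = ℕₚ.≤-trans (ℕₚ.m≤m+n _ (h + h)) (ℕₚ.≤-reflexive (≡.trans (lemma i₀ (d * j) h) (cong (_+_ i₀) (≡.trans (cong (_+ d * j) (≡.sym d≡2h+1)) (≡.sym (ℕₚ.*-suc d j))))))
      where
      lemma : ∀ i e h → suc (i + e) + (h + h) ≡ i + (suc (h + h) + e)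
      lemma = ℕ-solve
    enough : ∀ J → suc J ≤ count z (suc (i₀ + d * J))
    enough zero    = ≡.subst (1 ≤_) (one 0) (s≤s z≤n)
    enough (suc J) = ≡.subst (suc (suc J) ≤_) (one (suc J)) (s≤s (ℕₚ.≤-trans (enough J) (count-mono z (next J))))

  -- The two inequalities make s the integer part of k / d. It grows exactly when the next index
  -- reaches a multiple of d, the only moment at which a hit is possible.
  count-≤ : ∀ z → (∀ i → (+ d) ∣ℤ z i → (+ d) ∣ℤ (+ suc i)) → ∀ k → ∃ λ s → count z k ≤ s × s * d ≤ k × k < suc s * d
  count-≤ z hit zero = 0 , z≤n , z≤n , ≡.subst (0 <_) (≡.sym (≡.trans (ℕₚ.+-identityʳ d) d≡2h+1)) (s≤s z≤n)
  count-≤ z hit (suc k) with count-≤ z hit k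
  ... | s , c≤s , sd≤k , k<sd with ℕₚ.m≤n⇒m<n∨m≡n k<sd
  ...   | inj₂ e = suc s , ℕₚ.≤-trans (ℕₚ.+-mono-≤ c≤s (indicator-≤1 ((+ d) ∣ℤ? z k))) (ℕₚ.≤-reflexive (ℕₚ.+-comm s 1))
                 , ℕₚ.≤-reflexive (≡.sym e) , ≡.subst (_< suc (suc s) * d) (≡.sym e) (ℕₚ.m<n+m (suc s * d) (≡.subst (0 <_) (≡.sym d≡2h+1) (s≤s z≤n)))
  ...   | inj₁ lt = s , ≡.subst (_≤ s) (≡.sym (≡.trans (cong (_+_ (count z k)) (indicator-no (_ ∣ℤ? _) (λ dv → miss (hit k dv)))) (ℕₚ.+-identityʳ _))) c≤s
                  , ℕₚ.m≤n⇒m≤1+n sd≤k , lt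
    where
    miss : ¬ (+ d) ∣ℤ (+ suc k)
    miss dv with ℤ∣.∣⇒∣ᵤ dv
    ... | dvn = absurd dvn
      where
      open import Data.Nat.Divisibility using () renaming (_∣_ to _∣ℕ_; divides to dividesℕ)
      absurd : d ∣ℕ suc k → ⊥
      absurd (dividesℕ t e) = ℕₚ.<-irrefl ≡.refl (ℕₚ.<-≤-trans (ℕₚ.*-cancelʳ-< d t (suc s) (≡.subst (_< suc s * d) e lt))
                                                                (ℕₚ.*-cancelʳ-< d s t (≡.subst (s * d <_) e (s≤s sd≤k))))

  -- Exponents of q in the i-th factors of (q;q²), (q²;q²) and (q⁶;q⁶); those of (q^(6+N);q⁶) are
  -- given by `z±`.
  z₁ z₂ z₆ : ℕ → ℤ
  z₁ i = + 2 ℤ.* + i ℤ.+ + 1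
  z₂ i = + 2 ℤ.* (+ i ℤ.+ + 1)
  z₆ i = + 6 ℤ.* (+ i ℤ.+ + 1)

  z± : ℤ → ℕ → ℤ
  z± N i = + 6 ℤ.* (+ i ℤ.+ + 1) ℤ.+ N

  d∣d : (+ d) ∣ℤ (+ d)
  d∣d = divides (+ 1) (≡.sym (ℤₚ.*-identityˡ (+ d)))

  d-ℤ : + d ≡ + 1 ℤ.+ (+ h ℤ.+ + h)
  d-ℤ = cong +_ d≡2h+1

  halve : ∀ {a} → (+ d) ∣ℤ (+ 2 ℤ.* a) → (+ d) ∣ℤ a
  halve {a} dv = ∣ℤ-combine {a = a ℤ.* + d} (∣ℤ-times a d∣d ≡.refl) (∣ℤ-times (+ h) dv ≡.refl) (≡.trans (lemma a (+ h)) (cong (λ e → a ℤ.* e ℤ.- + h ℤ.* (+ 2 ℤ.* a)) (≡.sym d-ℤ)))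
    where
    lemma : ∀ a h → a ≡ a ℤ.* (+ 1 ℤ.+ (h ℤ.+ h)) ℤ.- h ℤ.* (+ 2 ℤ.* a)
    lemma = ℤ-solve

  cancel-6 : ∀ {a} → (+ d) ∣ℤ (+ 6 ℤ.* a) → (+ d) ∣ℤ a
  cancel-6 {a} dv = ∣ℤ-combine {a = u ℤ.* (+ 6 ℤ.* a)} (∣ℤ-times u dv ≡.refl) (∣ℤ-times (k ℤ.* a) d∣d ≡.refl)
          (≡.trans (lemma₁ a k (+ d)) (≡.trans (cong (λ w → w ℤ.* a ℤ.- k ℤ.* a ℤ.* + d) (≡.sym 6u≡1+kd)) (cong (ℤ._- (k ℤ.* a ℤ.* + d)) (lemma₂ u a))))
    where
    lemma₁ : ∀ a k d → a ≡ (+ 1 ℤ.+ k ℤ.* d) ℤ.* a ℤ.- k ℤ.* a ℤ.* d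
    lemma₁ = ℤ-solve
    lemma₂ : ∀ u a → + 6 ℤ.* u ℤ.* a ≡ u ℤ.* (+ 6 ℤ.* a)
    lemma₂ = ℤ-solve

  hit₂ : ∀ i → (+ d) ∣ℤ z₂ i → (+ d) ∣ℤ (+ suc i)
  hit₂ i dv = ≡.subst ((+ d) ∣ℤ_) (cong +_ (ℕₚ.+-comm i 1)) (halve dv)

  hit₆ : ∀ i → (+ d) ∣ℤ z₆ i → (+ d) ∣ℤ (+ suc i)
  hit₆ i dv = ≡.subst ((+ d) ∣ℤ_) (cong +_ (ℕₚ.+-comm i 1)) (cancel-6 dv)

  d>0 : 0 < d
  d>0 = ≡.subst (0 <_) (≡.sym d≡2h+1) (s≤s z≤n)

  instance
    d-nonZero : NonZero d
    d-nonZero = ℕ.>-nonZero d>0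

  -- The first odd multiple of d is d = 2h + 1, at index h, and the hits recur with period d.
  count₁ : ∀ M J → h + d * J ≤ M → suc J ≤ count z₁ (suc M)
  count₁ M J le = count-≥ z₁ h J (suc M) hit (s≤s le)
    where
    lemma : ∀ h d j → + 2 ℤ.* (h ℤ.+ d ℤ.* j) ℤ.+ + 1 ≡ (+ 1 ℤ.+ (h ℤ.+ h)) ℤ.+ (+ 2 ℤ.* j) ℤ.* d
    lemma = ℤ-solve
    hit : ∀ j → (+ d) ∣ℤ z₁ (h + d * j)
    hit j = ∣ℤ-sum d∣d (∣ℤ-times (+ 2 ℤ.* + j) d∣d ≡.refl) (≡.trans (cong (λ w → + 2 ℤ.* (+ h ℤ.+ w) ℤ.+ + 1) (ℤₚ.pos-* d j))
      (≡.trans (lemma (+ h) (+ d) (+ j)) (cong (ℤ._+ (+ 2 ℤ.* + j) ℤ.* + d) (≡.sym d-ℤ))))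

  count₆ : ∀ M J → M < d * suc J → count z₆ M ≤ J
  count₆ M J lt with count-≤ z₆ hit₆ M
  ... | s , c≤s , sd≤M , _ = ℕₚ.≤-trans c≤s (ℕₚ.≤-pred (ℕₚ.*-cancelʳ-< d s (suc J) (ℕₚ.≤-<-trans sd≤M (≡.subst (M <_) (ℕₚ.*-comm d (suc J)) lt))))

  count₂ : ∀ a b J → a + b < d * J → count z₂ a + count z₂ b < J
  count₂ a b J lt with count-≤ z₂ hit₂ a | count-≤ z₂ hit₂ b
  ... | s , c≤s , sd≤a , _ | t , c≤t , td≤b , _ = ℕₚ.≤-<-trans (ℕₚ.+-mono-≤ c≤s c≤t) (ℕₚ.*-cancelʳ-< d (s + t) J
        (ℕₚ.≤-<-trans (ℕₚ.≤-trans (ℕₚ.≤-reflexive (ℕₚ.*-distribʳ-+ d s t)) (ℕₚ.+-mono-≤ sd≤a td≤b)) (≡.subst (a + b <_) (ℕₚ.*-comm d J) lt)))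

  -- When d ∤ a, rounding a / d down loses something, so the two integer parts add up to less than
  -- (a + b) / d.
  count₂-strict : ∀ a b J → a + b ≡ d * J → ¬ (+ d) ∣ℤ (+ a) → count z₂ a + count z₂ b < J
  count₂-strict a b J e d∤a with count-≤ z₂ hit₂ a | count-≤ z₂ hit₂ b
  ... | s , c≤s , sd≤a , _ | t , c≤t , td≤b , _ = ℕₚ.≤-<-trans (ℕₚ.+-mono-≤ c≤s c≤t) (ℕₚ.*-cancelʳ-< d (s + t) J
        (≡.subst₂ _<_ (≡.sym (ℕₚ.*-distribʳ-+ d s t)) (≡.trans e (ℕₚ.*-comm d J))
          (ℕₚ.+-mono-<-≤ (ℕₚ.≤∧≢⇒< sd≤a (λ sd≡a → d∤a (divides (+ s) (≡.trans (cong +_ (≡.sym sd≡a)) (ℤₚ.pos-* s d))))) td≤b)))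

  -- The residue classes of the zeros of 6s + N and 6s − N modulo d are opposite.
  root : ∀ N → ¬ (+ d) ∣ℤ N → ∃ λ s → ∃ λ s′ → suc s + suc s′ ≡ d × (∀ j → (+ d) ∣ℤ z± N (s + d * j)) × (∀ j → (+ d) ∣ℤ z± (ℤ.- N) (s′ + d * j))
  root N d∤N = go (Z ℤ÷.%ℕ d) ≡.refl
    where
    -- Since 6 u is 1 modulo d, this is a zero of 6s + N modulo d.
    Z = ℤ.- (u ℤ.* N)
    hitZ : ∀ s → s ≡ Z ℤ÷.%ℕ d → (+ d) ∣ℤ (+ 6 ℤ.* + s ℤ.+ N)
    hitZ s ≡.refl = divides (ℤ.- (k ℤ.* N) ℤ.- + 6 ℤ.* D) (≡.trans (lemma₁ (+ s) (+ d) D N) (≡.trans (cong (λ w → + 6 ℤ.* w ℤ.- + 6 ℤ.* (D ℤ.* + d) ℤ.+ N) (≡.sym (ℤ÷.a≡a%ℕn+[a/ℕn]*n Z d)))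
        (≡.trans (lemma₂ u N D (+ d)) (≡.trans (cong (λ w → ℤ.- (w ℤ.* N) ℤ.- + 6 ℤ.* (D ℤ.* + d) ℤ.+ N) 6u≡1+kd) (lemma₃ k (+ d) N D)))))
      where
      D = Z ℤ÷./ℕ d
      lemma₁ : ∀ s d D N → + 6 ℤ.* s ℤ.+ N ≡ + 6 ℤ.* (s ℤ.+ D ℤ.* d) ℤ.- + 6 ℤ.* (D ℤ.* d) ℤ.+ N
      lemma₁ = ℤ-solve
      lemma₂ : ∀ u N D d → + 6 ℤ.* (ℤ.- (u ℤ.* N)) ℤ.- + 6 ℤ.* (D ℤ.* d) ℤ.+ N ≡ ℤ.- (+ 6 ℤ.* u ℤ.* N) ℤ.- + 6 ℤ.* (D ℤ.* d) ℤ.+ N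
      lemma₂ = ℤ-solve
      lemma₃ : ∀ k d N D → ℤ.- ((+ 1 ℤ.+ k ℤ.* d) ℤ.* N) ℤ.- + 6 ℤ.* (D ℤ.* d) ℤ.+ N ≡ (ℤ.- (k ℤ.* N) ℤ.- + 6 ℤ.* D) ℤ.* d
      lemma₃ = ℤ-solve
    go : ∀ s → s ≡ Z ℤ÷.%ℕ d → ∃ λ s → ∃ λ s′ → suc s + suc s′ ≡ d × (∀ j → (+ d) ∣ℤ z± N (s + d * j)) × (∀ j → (+ d) ∣ℤ z± (ℤ.- N) (s′ + d * j))
    -- Residue 0 would mean d ∣ N. Any other residue has a predecessor, which is the index wanted,
    -- since `z±` at i is 6 (i + 1) + N.
    go zero    s≡ = ⊥-elim (d∤N (≡.subst ((+ d) ∣ℤ_) (ℤₚ.+-identityˡ N) (hitZ 0 s≡)))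
    go (suc s) s≡ = s , s′ , sum , hit , hit′
      where
      s<d : suc s < d
      s<d = ≡.subst (_< d) (≡.sym s≡) (ℤ÷.n%ℕd<d Z d)
      s′ = d ℕ.∸ suc (suc s)
      sum : suc s + suc s′ ≡ d
      sum = ≡.trans (ℕₚ.+-suc (suc s) s′) (ℕₚ.m+[n∸m]≡n s<d)
      sumℤ : + 1 ℤ.+ + s ℤ.+ (+ 1 ℤ.+ + s′) ≡ + d
      sumℤ = cong +_ sum
      hit : ∀ j → (+ d) ∣ℤ z± N (s + d * j)
      hit j = ∣ℤ-sum (hitZ (suc s) s≡) (∣ℤ-times (+ 6 ℤ.* + j) d∣d ≡.refl) (≡.trans (cong (λ w → + 6 ℤ.* (+ s ℤ.+ w ℤ.+ + 1) ℤ.+ N) (ℤₚ.pos-* d j)) (lemma (+ s) (+ d) (+ j) N))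
        where
        lemma : ∀ s d j N → + 6 ℤ.* (s ℤ.+ d ℤ.* j ℤ.+ + 1) ℤ.+ N ≡ (+ 6 ℤ.* (+ 1 ℤ.+ s) ℤ.+ N) ℤ.+ (+ 6 ℤ.* j) ℤ.* d
        lemma = ℤ-solve
      hit′ : ∀ j → (+ d) ∣ℤ z± (ℤ.- N) (s′ + d * j)
      hit′ j = ∣ℤ-combine (∣ℤ-times (+ 6 ℤ.* (+ 1 ℤ.+ + j)) d∣d ≡.refl) (hitZ (suc s) s≡) (≡.trans (cong (λ w → + 6 ℤ.* (+ s′ ℤ.+ w ℤ.+ + 1) ℤ.+ ℤ.- N) (ℤₚ.pos-* d j))
          (≡.trans (lemma (+ s) (+ s′) (+ j) (+ d) N) (cong (λ w → + 6 ℤ.* (w ℤ.+ + d ℤ.* + j) ℤ.- (+ 6 ℤ.* (+ 1 ℤ.+ + s) ℤ.+ N)) sumℤ |> lemma′ (+ j) (+ d) (+ 6 ℤ.* (+ 1 ℤ.+ + s) ℤ.+ N))))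
        where
        _|>_ : ∀ {x y z : ℤ} → x ≡ y → y ≡ z → x ≡ z
        _|>_ = ≡.trans
        lemma : ∀ s s′ j d N → + 6 ℤ.* (s′ ℤ.+ d ℤ.* j ℤ.+ + 1) ℤ.+ ℤ.- N ≡ + 6 ℤ.* ((+ 1 ℤ.+ s ℤ.+ (+ 1 ℤ.+ s′)) ℤ.+ d ℤ.* j) ℤ.- (+ 6 ℤ.* (+ 1 ℤ.+ s) ℤ.+ N)
        lemma = ℤ-solve
        lemma′ : ∀ j d r → + 6 ℤ.* (d ℤ.+ d ℤ.* j) ℤ.- r ≡ (+ 6 ℤ.* (+ 1 ℤ.+ j)) ℤ.* d ℤ.- r
        lemma′ = ℤ-solve

  -- For n = d e these are the two truncations of the theorem: M = n - 1 with e = J + 1, and M = (n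
  -- - 1)/2 with d = 2h + 1 and e = 2J + 1.
  Range : ℕ → ℕ → Set
  Range M J = suc M ≡ d * suc J ⊎ M ≡ h + d * J

  module _ {M J : ℕ} (range : Range M J) where
    private
      h<d : h < d
      h<d = ≡.subst (h <_) (≡.sym d≡2h+1) (s≤s (ℕₚ.m≤m+n h h))

      lower-bound : Range M J → h + d * J ≤ M
      lower-bound (inj₂ e) = ℕₚ.≤-reflexive (≡.sym e)
      lower-bound (inj₁ e) = ℕₚ.≤-pred (≡.subst (h + d * J <_) (≡.trans (≡.sym (ℕₚ.*-suc d J)) (≡.sym e)) (ℕₚ.+-monoˡ-< (d * J) h<d))

      upper-bound : Range M J → M < d * suc J
      upper-bound (inj₁ e) = ℕₚ.≤-reflexive e
      upper-bound (inj₂ ≡.refl) = ≡.subst (h + d * J <_) (≡.sym (ℕₚ.*-suc d J)) (ℕₚ.+-monoˡ-< (d * J) h<d)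

      lower : h + d * J ≤ M
      lower = lower-bound range

      upper : M < d * suc J
      upper = upper-bound range

      c₁ : suc J ≤ count z₁ (suc M)
      c₁ = count₁ M J lower

      c₆ : count z₆ M ≤ J
      c₆ = count₆ M J upper

      doubled : suc (M + M) < d * (suc J + suc J)
      doubled = ≡.subst (suc (M + M) <_) (≡.sym (ℕₚ.*-distribˡ-+ d (suc J) (suc J))) (ℕₚ.≤-trans (ℕₚ.≤-reflexive (cong suc (≡.sym (ℕₚ.+-suc M M)))) (ℕₚ.+-mono-≤ upper upper))

    -- Numbers of factors 1 - q^j with d ∣ j above and below the fraction bar of `E M m`, for N = 6m
    -- + 1, a = `α M m` and b = `β M m`. Zeros hidden in `K` are left out.
    numerator denominator : ℤ → ℕ → ℕ → ℕ
    numerator N a b = count z₁ (suc M) + count z₁ (suc M) + (count (z± N) M + count (z± (ℤ.- N)) M) + v (N ℤ.+ N)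
    denominator N a b = count z₆ M + count z₆ M + (count z₂ a + count z₂ b) + (v (N ℤ.+ + 3) + v (N ℤ.- + 3))

    c₂ : ∀ {a b} → a + b ≡ suc (M + M) → count z₂ a + count z₂ b ≤ suc (J + J)
    c₂ {a} {b} e = ℕₚ.≤-pred (ℕₚ.≤-trans (count₂ a b (suc J + suc J) (≡.subst (_< d * (suc J + suc J)) (≡.sym e) doubled)) (ℕₚ.≤-reflexive (cong suc (ℕₚ.+-suc J J))))

    -- For d ∣ N the products with exponents 6(i + 1) ± N cancel both copies of (q⁶;q⁶)_M in the
    -- count, and N ± 3 is not a multiple of d. One surplus zero comes from 2(J + 1) against at most
    -- 2J + 1, the other from 1 - x².
    excess-divisible : ∀ N a b → (+ d) ∣ℤ N → a + b ≡ suc (M + M) → 2 + denominator N a b ≤ numerator N a b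
    excess-divisible N a b d∣N e = begin
      2 + (count z₆ M + count z₆ M + (count z₂ a + count z₂ b) + (v (N ℤ.+ + 3) + v (N ℤ.- + 3)))
        ≡⟨ cong₂ (λ i j → 2 + (count z₆ M + count z₆ M + (count z₂ a + count z₂ b) + (i + j))) v₊ v₋ ⟩
      2 + (count z₆ M + count z₆ M + (count z₂ a + count z₂ b) + 0)
        ≤⟨ ℕₚ.+-monoʳ-≤ 2 (ℕₚ.+-monoˡ-≤ 0 (ℕₚ.+-monoʳ-≤ (count z₆ M + count z₆ M) (c₂ {a} {b} e))) ⟩
      2 + (count z₆ M + count z₆ M + suc (J + J) + 0)
        ≡⟨ lemma (count z₆ M) J ⟩
      suc J + suc J + (count z₆ M + count z₆ M) + 1
        ≤⟨ ℕₚ.+-monoˡ-≤ 1 (ℕₚ.+-mono-≤ (ℕₚ.+-mono-≤ c₁ c₁) (ℕₚ.≤-reflexive (cong₂ _+_ same₊ same₋))) ⟩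
      count z₁ (suc M) + count z₁ (suc M) + (count (z± N) M + count (z± (ℤ.- N)) M) + 1
        ≡⟨ cong (_+_ (count z₁ (suc M) + count z₁ (suc M) + (count (z± N) M + count (z± (ℤ.- N)) M))) (indicator-yes (_ ∣ℤ? _) (∣ℤ-sum d∣N d∣N ≡.refl)) ⟨
      numerator N a b ∎
      where
      open ℕₚ.≤-Reasoning
      lemma : ∀ c J → 2 + (c + c + suc (J + J) + 0) ≡ suc J + suc J + (c + c) + 1
      lemma = ℕ-solve
      cancel₊ : ∀ N → + 6 ≡ + 2 ℤ.* (N ℤ.+ + 3) ℤ.- (+ 2 ℤ.* N)
      cancel₊ = ℤ-solve
      cancel₋ : ∀ N → + 6 ≡ + 2 ℤ.* N ℤ.- (+ 2 ℤ.* (N ℤ.- + 3))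
      cancel₋ = ℤ-solve
      v₊ : v (N ℤ.+ + 3) ≡ 0
      v₊ = indicator-no (_ ∣ℤ? _) (λ dv → d∤6 (∣ℤ-combine (∣ℤ-times (+ 2) dv ≡.refl) (∣ℤ-times (+ 2) d∣N ≡.refl) (cancel₊ N)))
      v₋ : v (N ℤ.- + 3) ≡ 0
      v₋ = indicator-no (_ ∣ℤ? _) (λ dv → d∤6 (∣ℤ-combine (∣ℤ-times (+ 2) d∣N ≡.refl) (∣ℤ-times (+ 2) dv ≡.refl) (cancel₋ N)))
      plus : ∀ z N → z ≡ (z ℤ.+ N) ℤ.- N
      plus = ℤ-solve
      same₊ : count z₆ M ≡ count (z± N) M
      same₊ = count-cong M (λ i → indicator-⇔ (_ ∣ℤ? _) (_ ∣ℤ? _) (λ dv → ∣ℤ-sum dv d∣N ≡.refl) (λ dv → ∣ℤ-combine dv d∣N (plus (z₆ i) N)))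
      minus : ∀ z N → z ≡ (z ℤ.+ ℤ.- N) ℤ.+ N
      minus = ℤ-solve
      same₋ : count z₆ M ≡ count (z± (ℤ.- N)) M
      same₋ = count-cong M (λ i → indicator-⇔ (_ ∣ℤ? _) (_ ∣ℤ? _) (λ dv → ∣ℤ-combine dv d∣N ≡.refl) (λ dv → ∣ℤ-sum dv d∣N (minus (z₆ i) N)))

    -- The two exponents differ by 6, which d does not divide.
    v₃ : ∀ N → v (N ℤ.+ + 3) + v (N ℤ.- + 3) ≤ 1
    v₃ N with (+ d) ∣ℤ? (N ℤ.+ + 3)
    ... | no  _ = indicator-≤1 ((+ d) ∣ℤ? (N ℤ.- + 3))
    ... | yes p with (+ d) ∣ℤ? (N ℤ.- + 3)
    ...   | no  _ = ℕₚ.≤-refl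
    ...   | yes r = ⊥-elim (d∤6 (∣ℤ-combine p r (lemma N)))
      where
      lemma : ∀ N → + 6 ≡ (N ℤ.+ + 3) ℤ.- (N ℤ.- + 3)
      lemma = ℤ-solve

    -- The squares of (q;q²)_{M+1} and (q⁶;q⁶)_M already yield 2(J + 1) - 2J = 2. The strict
    -- inequality pays for the one possible pole from N ± 3.
    excess-from : ∀ N a b → count z₂ a + count z₂ b < count (z± N) M + count (z± (ℤ.- N)) M → 2 + denominator N a b ≤ numerator N a b
    excess-from N a b lt = begin
      2 + (count z₆ M + count z₆ M + C₂ + (v (N ℤ.+ + 3) + v (N ℤ.- + 3)))
        ≤⟨ ℕₚ.+-monoʳ-≤ 2 (ℕₚ.+-mono-≤ (ℕₚ.+-monoˡ-≤ C₂ (ℕₚ.+-mono-≤ c₆ c₆)) (v₃ N)) ⟩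
      2 + (J + J + C₂ + 1)
        ≡⟨ lemma J C₂ ⟩
      suc J + suc J + suc C₂
        ≤⟨ ℕₚ.+-mono-≤ (ℕₚ.+-mono-≤ c₁ c₁) lt ⟩
      count z₁ (suc M) + count z₁ (suc M) + (count (z± N) M + count (z± (ℤ.- N)) M)
        ≤⟨ ℕₚ.m≤m+n _ _ ⟩
      numerator N a b ∎
      where
      open ℕₚ.≤-Reasoning
      C₂ = count z₂ a + count z₂ b
      lemma : ∀ J c → 2 + (J + J + c + 1) ≡ suc J + suc J + suc c
      lemma = ℕ-solve

    excess : ∀ N a b → + a ≡ + b ℤ.+ N → a + b ≡ suc (M + M) → 2 + denominator N a b ≤ numerator N a b
    excess N a b a≡b+N e with (+ d) ∣ℤ? N
    ... | yes d∣N = excess-divisible N a b d∣N e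
    ... | no  d∤N with root N d∤N
    ...   | s , s′ , s+s′ , hit , hit′ = excess-from N a b (compare range)
      where
      X = count (z± N) M
      X′ = count (z± (ℤ.- N)) M
      s<d : suc s < d
      s<d = ≡.subst (suc s <_) s+s′ (ℕₚ.m<m+n (suc s) (s≤s z≤n))
      s′<d : suc s′ < d
      s′<d = ≡.subst (suc s′ <_) s+s′ (ℕₚ.m<n+m (suc s′) (s≤s z≤n))

      all-but-one : ∀ z i → i < d → (∀ j → (+ d) ∣ℤ z (i + d * j)) → J ≤ count z M
      all-but-one z i i<d hit = go J ≡.refl
        where
        go : ∀ J′ → J′ ≡ J → J′ ≤ count z M
        go zero     _      = z≤n
        go (suc J′) ≡.refl = count-≥ z i J′ M hit (ℕₚ.<-≤-trans (≡.subst (i + d * J′ <_) (≡.sym (ℕₚ.*-suc d J′)) (ℕₚ.+-monoˡ-< (d * J′) i<d)) (ℕₚ.≤-trans (ℕₚ.m≤n+m _ h) lower))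

      -- In the full range both residue classes are met J + 1 times, against at most 2J + 1. In the
      -- half range only 2J + 1 hits are certain, so the other side must be shown to stay below 2J +
      -- 1.
      compare : Range M J → count z₂ a + count z₂ b < X + X′
      compare (inj₁ full) = ℕₚ.≤-trans (s≤s (c₂ {a} {b} e)) (ℕₚ.≤-trans (ℕₚ.≤-reflexive (≡.sym (cong suc (ℕₚ.+-suc J J))))
        (ℕₚ.+-mono-≤ (count-≥ (z± N) s J M hit (below s<d)) (count-≥ (z± (ℤ.- N)) s′ J M hit′ (below s′<d))))
        where
        below : ∀ {i} → suc i < d → i + d * J < M
        below {i} i<d = ℕₚ.≤-pred (≡.subst (suc (suc (i + d * J)) ≤_) (≡.trans (≡.sym (ℕₚ.*-suc d J)) (≡.sym full)) (ℕₚ.+-monoˡ-≤ (d * J) i<d))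
      compare (inj₂ half) = ℕₚ.≤-trans (count₂-strict a b (suc (J + J)) total d∤a) (bound (ℕₚ.≤-total (suc s) h))
        where
        total : a + b ≡ d * suc (J + J)
        total = ≡.trans e (≡.trans (cong (λ M → suc (M + M)) half) (≡.trans (lemma h (d * J)) (≡.trans (cong (_+ (d * J + d * J)) (≡.sym d≡2h+1)) (expand d J))))
          where
          lemma : ∀ h x → suc (h + x + (h + x)) ≡ suc (h + h) + (x + x)
          lemma = ℕ-solve
          expand : ∀ d J → d + (d * J + d * J) ≡ d * suc (J + J)
          expand = ℕ-solve
        -- Since d divides a + b, d ∣ a would give d ∣ 2a - (a + b) = a - b = N.
        d∤a : ¬ (+ d) ∣ℤ (+ a)
        d∤a d∣a = d∤N (∣ℤ-combine (∣ℤ-sum d∣a d∣a ≡.refl) (∣ℤ-times (+ suc (J + J)) d∣d ≡.refl)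
          (≡.trans (lemma (+ a) (+ b) N a≡b+N) (cong (λ w → + a ℤ.+ + a ℤ.- w) (≡.trans (cong +_ (≡.trans total (ℕₚ.*-comm d (suc (J + J))))) (ℤₚ.pos-* (suc (J + J)) d)))))
          where
          identity : ∀ b N → N ≡ (b ℤ.+ N) ℤ.+ (b ℤ.+ N) ℤ.- ((b ℤ.+ N) ℤ.+ b)
          identity = ℤ-solve
          lemma : ∀ a b N → a ≡ b ℤ.+ N → N ≡ a ℤ.+ a ℤ.- (a ℤ.+ b)
          lemma a b N ≡.refl = identity b N
        below : ∀ {i} → suc i ≤ h → i + d * J < M
        below i<h = ≡.subst (_ ≤_) (≡.sym half) (ℕₚ.+-monoˡ-≤ (d * J) i<h)
        -- The positive residues `suc s` and `suc s′` add up to 2h + 1, so one of them is at most h.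
        -- Its class is met J + 1 times below h + d J, the other class at least J times.
        bound : suc s ≤ h ⊎ h ≤ suc s → suc (J + J) ≤ X + X′
        bound (inj₁ s<h) = ℕₚ.+-mono-≤ (count-≥ (z± N) s J M hit (below s<h)) (all-but-one (z± (ℤ.- N)) s′ (ℕₚ.<⇒≤ s′<d) hit′)
        bound (inj₂ h≤s) with suc s′ ℕₚ.≤? h
        ... | yes s′<h = ≡.subst (_≤ X + X′) (ℕₚ.+-suc J J) (ℕₚ.+-mono-≤ (all-but-one (z± N) s (ℕₚ.<⇒≤ s<d) hit) (count-≥ (z± (ℤ.- N)) s′ J M hit′ (below s′<h)))
        ... | no  s′≮h = ℕₚ.+-mono-≤ (count-≥ (z± N) s J M hit (below s<h)) (all-but-one (z± (ℤ.- N)) s′ (ℕₚ.<⇒≤ s′<d) hit′)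
          where
          s<h : suc s ≤ h
          s<h = ℕₚ.+-cancelʳ-≤ (suc h) (suc s) h (ℕₚ.≤-trans (ℕₚ.+-monoʳ-≤ (suc s) (ℕₚ.≰⇒> s′≮h)) (ℕₚ.≤-reflexive (≡.trans s+s′ (≡.trans d≡2h+1 (≡.sym (ℕₚ.+-suc h h))))))

-- Orders at a cyclotomic polynomial

module Valuation (F : Field) (q : Field.Carrier F) (q≉0 : ¬ Field._≈_ F q (Field.0# F))
  (q-not-root : ∀ n → ¬ Field._≈_ F (FieldProperties.pow F q (suc n)) (Field.1# F)) where
  open Field F
  open IntSolver commutativeRing
  open FieldProperties F
  open Powers F q q≉0
  open Summation q-not-root
  open import Relation.Binary.Reasoning.Setoid setoid

  -- What the count of orders requires of the local ring at Φ_d: 1 - q^z is a unit for d ∤ z, and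
  -- for d ∣ z, z ≠ 0, it is associated to π, by `factor` and `cofactor` together.
  record LocalRing (d : ℕ) : Set₁ where
    field
      O        : Carrier → Set
      O-resp   : ∀ {f g} → f ≈ g → O f → O g
      O-+      : ∀ {f g} → O f → O g → O (f + g)
      O-*      : ∀ {f g} → O f → O g → O (f * g)
      O-1      : O 1#
      O--1     : O (- 1#)
      O-qz     : ∀ z → O (qz z)
      unit⁻¹   : ∀ z → ¬ (+ d) ∣ℤ z → O ((1# - qz z) ⁻¹)
      π        : Carrier
      π≉0      : ¬ π ≈ 0#
      factor   : ∀ z → (+ d) ∣ℤ z → ∃ λ o → O o × 1# - qz z ≈ π * o
      cofactor : ∀ z → z ≢ + 0 → (+ d) ∣ℤ z → O (π * (1# - qz z) ⁻¹)

  inverse-cong : ∀ {f g} → ¬ f ≈ 0# → f ≈ g → f ⁻¹ ≈ g ⁻¹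
  inverse-cong {f} f≉0 e = inverse-unique (trans (*-congʳ (sym e)) (*-inverse f f≉0))

  pow-q² : ∀ i → pow q² i ≈ qz (+ 2 ℤ.* + i)
  pow-q² i = trans (c-qz i) (qz-≡ (lemma (+ i)))
    where
    lemma : ∀ i → i ℤ.+ i ≡ + 2 ℤ.* i
    lemma = ℤ-solve

  pow-q⁶ : ∀ i → pow q⁶ i ≈ qz (+ 6 ℤ.* + i)
  pow-q⁶ zero    = refl
  pow-q⁶ (suc i) = trans (*-cong (pow-q⁶ i) (sym qz6)) (trans (sym (qz-+ (+ 6 ℤ.* + i) (+ 6))) (qz-≡ (lemma (+ i))))
    where
    lemma : ∀ i → + 6 ℤ.* i ℤ.+ + 6 ≡ + 6 ℤ.* (+ 1 ℤ.+ i)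
    lemma = ℤ-solve

  module InLocalRing {d h : ℕ} (d≡2h+1 : d ≡ suc (h ℕ.+ h)) (d∤6 : ¬ (+ d) ∣ℤ (+ 6))
    (u k : ℤ) (6u≡1+kd : + 6 ℤ.* u ≡ + 1 ℤ.+ k ℤ.* + d) (R : LocalRing d) where
    open Counting d h d≡2h+1 d∤6 u k 6u≡1+kd
    open LocalRing R

    -- f has order at least n - e at π.
    record V (n e : ℕ) (f : Carrier) : Set where
      constructor order
      field
        o        : Carrier
        integral : O o
        equation : f * pow π e ≈ pow π n * o

    V-O : ∀ {f} → O f → V 0 0 f
    V-O {f} of = order f of (trans (*-identityʳ f) (sym (*-identityˡ f)))

    V-resp : ∀ {n e f g} → f ≈ g → V n e f → V n e g
    V-resp eq (order o oo e) = order o oo (trans (*-congʳ (sym eq)) e)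

    V-* : ∀ {n e f n′ e′ g} → V n e f → V n′ e′ g → V (n ℕ.+ n′) (e ℕ.+ e′) (f * g)
    V-* {n} {e} {f} {n′} {e′} {g} (order o oo eq) (order o′ oo′ eq′) = order (o * o′) (O-* oo oo′) (begin
      f * g * pow π (e ℕ.+ e′)              ≈⟨ *-congˡ (pow-+ π e e′) ⟩
      f * g * (pow π e * pow π e′)          ≈⟨ solve 4 (λ f g a b → f :* g :* (a :* b) := f :* a :* (g :* b)) refl f g _ _ ⟩
      f * pow π e * (g * pow π e′)          ≈⟨ *-cong eq eq′ ⟩
      pow π n * o * (pow π n′ * o′)         ≈⟨ solve 4 (λ a o b o′ → a :* o :* (b :* o′) := a :* b :* (o :* o′)) refl _ o _ o′ ⟩
      pow π n * pow π n′ * (o * o′)         ≈⟨ *-congʳ (pow-+ π n n′) ⟨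
      pow π (n ℕ.+ n′) * (o * o′)           ∎)

    O-0 : O 0#
    O-0 = O-resp (-‿inverseʳ 1#) (O-+ O-1 O--1)

    O-neg : ∀ {f} → O f → O (- f)
    O-neg {f} of = O-resp (solve 1 (λ f → (:- con (+ 1)) :* f := :- f) refl f) (O-* O--1 of)

    O-1-qz : ∀ z → O (1# - qz z)
    O-1-qz z = O-+ O-1 (O-neg (O-qz z))

    V-numerator : ∀ z → V (v z) 0 (1# - qz z)
    V-numerator z with (+ d) ∣ℤ? z
    ... | no  _   = V-O (O-1-qz z)
    ... | yes d∣z = let (o , oo , e) = factor z d∣z in order o oo (trans (*-identityʳ _) (trans e (*-congʳ (sym (*-identityˡ π)))))

    V-denominator : ∀ z → z ≢ + 0 → V 0 (v z) ((1# - qz z) ⁻¹)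
    V-denominator z z≢0 with (+ d) ∣ℤ? z
    ... | no  d∤z = V-O (unit⁻¹ z d∤z)
    ... | yes d∣z = order _ (cofactor z z≢0 d∣z) (trans (*-congˡ (*-identityˡ π)) (trans (*-comm _ _) (sym (*-identityˡ _))))

    V-poch : ∀ z {f b} k → (∀ i → f * pow b i ≈ qz (z i)) → V (count z k) 0 (poch f b k)
    V-poch z zero    e = V-O O-1
    V-poch z (suc k) e = V-* (V-poch z k e) (V-resp (1-cong (sym (e k))) (V-numerator (z k)))

    V-poch⁻¹ : ∀ z {f b} k → (∀ i → f * pow b i ≈ qz (z i)) → (∀ i → z i ≢ + 0) → V 0 (count z k) (poch f b k ⁻¹)
    V-poch⁻¹ z {f} {b} zero    e z≢0 = V-resp (inverse-unique (*-identityˡ 1#)) (V-O O-1)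
    V-poch⁻¹ z {f} {b} (suc k) e z≢0 = V-resp (inverse-unique eq) (V-* (V-poch⁻¹ z {f} {b} k e z≢0) (V-denominator (z k) (z≢0 k)))
      where
      eq : poch f b k * (1# - f * pow b k) * (poch f b k ⁻¹ * (1# - qz (z k)) ⁻¹) ≈ 1#
      eq = trans (solve 4 (λ a b c d → a :* b :* (c :* d) := a :* c :* (b :* d)) refl _ _ _ _)
        (trans (*-cong (*-inverse _ (poch≉0 k (λ i → z i , z≢0 i , e i))) (trans (*-congʳ (1-cong (e k))) (*-inverse _ (1-qz≉0 (z k) (z≢0 k))))) (*-identityˡ 1#))

    N : ℤ → ℤ
    N m = + 6 ℤ.* m ℤ.+ + 1

    O-σ : ∀ m → O (σ m)
    O-σ m = O-* (sign m) (O-qz (exponent m))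
      where
      power : ∀ n → O (pow (- 1#) n)
      power zero    = O-1
      power (suc n) = O-* (power n) O--1
      sign : ∀ m → O (sgn m)
      sign (+ n)    = power n
      sign -[1+ n ] = power (suc n)

    O-K : O K
    O-K = O-* (O-* (O-1-qz (+ 4)) (O-1-qz -[1+ 1 ])) (O-* r r)
      where
      r : O ((1# - q) ⁻¹)
      r = O-resp (inverse-cong (1-qz≉0 (+ 1) (λ ())) (1-cong qz1)) (unit⁻¹ (+ 1) (λ d∣1 → d∤6 (∣ℤ-times (+ 6) d∣1 ≡.refl)))

    V-A : ∀ k → V (count z₁ k) 0 (A k)
    V-A k = V-poch z₁ k (λ i → trans (*-comm q _) (trans (*-cong (pow-q² i) (sym qz1)) (sym (qz-+ (+ 2 ℤ.* + i) (+ 1)))))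

    V-w : ∀ k → V 0 (count z₆ k) (w k)
    V-w k = V-poch⁻¹ z₆ {q⁶} {q⁶} k (λ i → trans (*-comm q⁶ _) (trans (*-cong (pow-q⁶ i) (sym qz6)) (trans (sym (qz-+ (+ 6 ℤ.* + i) (+ 6))) (qz-≡ (lemma (+ i))))))
      (λ i e → ℕₚ.1+n≢0 (≡.trans (ℕₚ.+-comm 1 i) (ℕₚ.*-cancelˡ-≡ (i ℕ.+ 1) 0 6 (ℤₚ.+-injective (≡.trans (ℤₚ.pos-* 6 (i ℕ.+ 1)) e)))))
      where
      lemma : ∀ i → + 6 ℤ.* i ℤ.+ + 6 ≡ + 6 ℤ.* (i ℤ.+ + 1)
      lemma = ℤ-solve

    V-I : ∀ k → V 0 (count z₂ k) (I (+ k))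
    V-I k = V-poch⁻¹ z₂ {q²} {q²} k (λ i → trans (*-comm q² _) (trans (*-cong (pow-q² i) (sym qz2)) (trans (sym (qz-+ (+ 2 ℤ.* + i) (+ 2))) (qz-≡ (lemma (+ i))))))
      (λ i e → ℕₚ.1+n≢0 (≡.trans (ℕₚ.+-comm 1 i) (ℕₚ.*-cancelˡ-≡ (i ℕ.+ 1) 0 2 (ℤₚ.+-injective (≡.trans (ℤₚ.pos-* 2 (i ℕ.+ 1)) e)))))
      where
      lemma : ∀ i → + 2 ℤ.* i ℤ.+ + 2 ≡ + 2 ℤ.* (i ℤ.+ + 1)
      lemma = ℤ-solve

    V-shifted : ∀ n k → V (count (z± n) k) 0 (poch (q⁶ * qz n) q⁶ k)
    V-shifted n k = V-poch (z± n) k (λ i → trans (*-cong (*-congʳ (sym qz6)) (pow-q⁶ i)) (trans (*-congʳ (sym (qz-+ (+ 6) n)))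
        (trans (sym (qz-+ (+ 6 ℤ.+ n) (+ 6 ℤ.* + i))) (qz-≡ (lemma (+ i) n)))))
      where
      lemma : ∀ i n → + 6 ℤ.+ n ℤ.+ + 6 ℤ.* i ≡ + 6 ℤ.* (i ℤ.+ + 1) ℤ.+ n
      lemma = ℤ-solve

    V-ρ : ∀ m → V (v (N m ℤ.+ N m) ℕ.+ 0) (v (N m ℤ.+ + 3) ℕ.+ v (N m ℤ.- + 3)) (ρ m)
    V-ρ m = V-* (V-* (V-O (O-σ m)) (V-resp (1-cong (qz-+ (N m) (N m))) (V-numerator (N m ℤ.+ N m))))
      (V-* (≡.subst (λ z → V 0 (v (N m ℤ.+ + 3)) ((1# - qz z) ⁻¹)) (plus m) (V-denominator (N m ℤ.+ + 3) (λ e → 6m+4≢0 m (≡.trans (≡.sym (plus m)) e))))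
           (≡.subst (λ z → V 0 (v (N m ℤ.- + 3)) ((1# - qz z) ⁻¹)) (minus m) (V-denominator (N m ℤ.- + 3) (λ e → 6m-2≢0 m (≡.trans (≡.sym (minus m)) e)))))
      where
      plus : ∀ m → + 6 ℤ.* m ℤ.+ + 1 ℤ.+ + 3 ≡ + 6 ℤ.* m ℤ.+ + 4
      plus = ℤ-solve
      minus : ∀ m → + 6 ℤ.* m ℤ.+ + 1 ℤ.- + 3 ≡ + 6 ℤ.* m ℤ.+ -[1+ 1 ]
      minus = ℤ-solve

    π²∣ : Carrier → Set
    π²∣ f = ∃ λ o → O o × f ≈ π * π * o

    π²∣-resp : ∀ {f g} → f ≈ g → π²∣ f → π²∣ g
    π²∣-resp eq (o , oo , e) = o , oo , trans (sym eq) e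

    π²∣-0 : ∀ {f} → f ≈ 0# → π²∣ f
    π²∣-0 e = 0# , O-0 , trans e (sym (zeroʳ _))

    π²∣-+ : ∀ {f g} → π²∣ f → π²∣ g → π²∣ (f + g)
    π²∣-+ (o , oo , e) (o′ , oo′ , e′) = o + o′ , O-+ oo oo′ , trans (+-cong e e′) (sym (distribˡ _ o o′))

    pow-π≉0 : ∀ e → ¬ pow π e ≈ 0#
    pow-π≉0 zero    = 1≉0
    pow-π≉0 (suc e) = *-nonzero (pow-π≉0 e) π≉0

    V⇒π²∣ : ∀ {n e f} → 2 ℕ.+ e ≤ n → V n e f → π²∣ f
    V⇒π²∣ {n} {e} {f} 2+e≤n (order o oo eq) with ℕₚ.m≤n⇒∃[o]m+o≡n 2+e≤n
    ... | r , ≡.refl = pow π r * o , O-* (power r) oo , *-cancelˡ (pow-π≉0 e) (begin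
      pow π e * f                            ≈⟨ *-comm _ f ⟩
      f * pow π e                            ≈⟨ eq ⟩
      pow π (2 ℕ.+ e ℕ.+ r) * o              ≈⟨ *-congʳ (*-congʳ (*-congʳ (pow-+ π e r))) ⟩
      pow π e * pow π r * π * π * o          ≈⟨ solve 4 (λ a b p o → a :* b :* p :* p :* o := a :* (p :* p :* (b :* o))) refl _ _ π o ⟩
      pow π e * (π * π * (pow π r * o))      ∎)
      where
      -- π is the product of 1 - q^d and π / (1 - q^d), both of which are integral.
      O-π : O π
      O-π = O-resp (trans (solve 3 (λ a p r → a :* (p :* r) := p :* (a :* r)) refl _ π _)
               (trans (*-congˡ (*-inverse _ (1-qz≉0 (+ d) d≢0))) (*-identityʳ π))) (O-* (O-1-qz (+ d)) (cofactor (+ d) d≢0 d∣d))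
        where
        d≢0 : + d ≢ + 0
        d≢0 z = ℕₚ.1+n≢0 (≡.trans (≡.sym d≡2h+1) (ℤₚ.+-injective z))
      power : ∀ r → O (pow π r)
      power zero    = O-1
      power (suc r) = O-* (power r) O-π

    -- If `α M m` or `β M m` is negative, a reciprocal `I` is 0 and so is the term. Otherwise the
    -- orders of the factors add up to the two counts compared in `excess`.
    π²∣E : ∀ {M J} → Range M J → ∀ m → π²∣ (E M m)
    π²∣E {M} {J} range m = go (α M m) (β M m) ≡.refl ≡.refl
      where
      sum : ∀ M m → M ℤ.+ (+ 3 ℤ.* m ℤ.+ + 1) ℤ.+ (M ℤ.- + 3 ℤ.* m) ≡ + 1 ℤ.+ (M ℤ.+ M)
      sum = ℤ-solve
      difference : ∀ M m → M ℤ.+ (+ 3 ℤ.* m ℤ.+ + 1) ≡ M ℤ.- + 3 ℤ.* m ℤ.+ (+ 6 ℤ.* m ℤ.+ + 1)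
      difference = ℤ-solve
      vanish : I (α M m) * I (β M m) ≈ 0# → E M m ≈ 0#
      vanish e = trans (*-congˡ (trans (*-congʳ (trans (*-congˡ e) (zeroʳ _))) (zeroˡ _))) (zeroʳ _)
      go : ∀ a b → α M m ≡ a → β M m ≡ b → π²∣ (E M m)
      go -[1+ a ] b        ea eb = π²∣-0 (vanish (trans (*-congʳ (I-negative a ea)) (zeroˡ _)))
      go (+ a)    -[1+ b ] ea eb = π²∣-0 (vanish (trans (*-congˡ (I-negative b eb)) (zeroʳ _)))
      go (+ a)    (+ b)    ea eb = V⇒π²∣ {n} {e} (≡.subst₂ _≤_ (≡.cong (ℕ._+_ 2) (≡.sym den)) (≡.sym num) ineq)
        (V-* (V-* (V-* (V-O O-K) (V-* (V-A (suc M)) (V-A (suc M)))) (V-* (V-w M) (V-w M)))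
             (V-* (V-* (V-* (V-shifted (N m) M) (V-shifted (ℤ.- N m) M))
                       (V-* (≡.subst (λ z → V 0 (count z₂ a) (I z)) (≡.sym ea) (V-I a)) (≡.subst (λ z → V 0 (count z₂ b) (I z)) (≡.sym eb) (V-I b))))
                  (V-ρ m)))
        where
        c₁ = count z₁ (suc M)
        c₆ = count z₆ M
        c₊ = count (z± (N m)) M
        c₋ = count (z± (ℤ.- N m)) M
        v± = v (N m ℤ.+ + 3) ℕ.+ v (N m ℤ.- + 3)
        n = (0 ℕ.+ (c₁ ℕ.+ c₁) ℕ.+ 0) ℕ.+ ((c₊ ℕ.+ c₋) ℕ.+ 0 ℕ.+ (v (N m ℤ.+ N m) ℕ.+ 0))
        e = (0 ℕ.+ (c₆ ℕ.+ c₆)) ℕ.+ (0 ℕ.+ (count z₂ a ℕ.+ count z₂ b) ℕ.+ v±)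
        num : n ≡ numerator range (N m) a b
        num = lemma c₁ c₊ c₋ (v (N m ℤ.+ N m))
          where
          lemma : ∀ c p r v → (0 ℕ.+ (c ℕ.+ c) ℕ.+ 0) ℕ.+ ((p ℕ.+ r) ℕ.+ 0 ℕ.+ (v ℕ.+ 0)) ≡ c ℕ.+ c ℕ.+ (p ℕ.+ r) ℕ.+ v
          lemma = ℕ-solve
        den : e ≡ denominator range (N m) a b
        den = lemma c₆ (count z₂ a) (count z₂ b) v±
          where
          lemma : ∀ c p r v → (0 ℕ.+ (c ℕ.+ c)) ℕ.+ (0 ℕ.+ (p ℕ.+ r) ℕ.+ v) ≡ c ℕ.+ c ℕ.+ (p ℕ.+ r) ℕ.+ v
          lemma = ℕ-solve
        ineq = excess range (N m) a b (≡.trans (≡.sym ea) (≡.trans (difference (+ M) m) (≡.cong (ℤ._+ N m) eb)))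
                 (ℤₚ.+-injective (≡.trans (≡.cong₂ ℤ._+_ (≡.sym ea) (≡.sym eb)) (sum (+ M) m)))

    π²∣partialSum : ∀ {M J} → Range M J → π²∣ (partialSum t M)
    π²∣partialSum {M} range = π²∣-resp (sym (expansion M)) (go M)
      where
      go : ∀ L → π²∣ (sumℤ L (E M))
      go zero    = π²∣E range (+ 0)
      go (suc L) = π²∣-+ (go L) (π²∣-+ (π²∣E range (+ suc L)) (π²∣E range -[1+ L ]))

-- The congruence

inverse-of-6 : ∀ {d} → Coprime d 6 → ∃ λ u → ∃ λ k → + 6 ℤ.* u ≡ + 1 ℤ.+ k ℤ.* + d
inverse-of-6 {d} cop with coprime-Bézout cop
... | Bézout.+- x y e = ℤ.- (+ y) , ℤ.- (+ x) , ≡.trans (≡.trans (lemma (+ y) (+ 6)) (≡.cong (ℤ._-_ (+ 1)) (≡.trans (≡.cong (ℤ._+_ (+ 1)) (≡.sym (ℤₚ.pos-* y 6))) (≡.trans (≡.cong +_ e) (ℤₚ.pos-* x d)))))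
        (≡.cong (ℤ._+_ (+ 1)) (ℤₚ.neg-distribˡ-* (+ x) (+ d)))
  where
  lemma : ∀ y s → s ℤ.* (ℤ.- y) ≡ + 1 ℤ.- (+ 1 ℤ.+ y ℤ.* s)
  lemma = ℤ-solve
... | Bézout.-+ x y e = + y , + x , ≡.trans (ℤₚ.*-comm (+ 6) (+ y)) (≡.trans (≡.sym (ℤₚ.pos-* y 6)) (≡.trans (≡.cong +_ (≡.sym e)) (≡.cong (ℤ._+_ (+ 1)) (ℤₚ.pos-* x d))))

parity : ∀ d → ∃ λ h → d ≡ h ℕ.+ h ⊎ d ≡ suc (h ℕ.+ h)
parity zero    = 0 , inj₁ ≡.refl
parity (suc d) with parity d
... | h , inj₁ ≡.refl = h , inj₂ ≡.refl
... | h , inj₂ ≡.refl = suc h , inj₁ (≡.cong suc (≡.sym (ℕₚ.+-suc h h)))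

odd : ∀ {n} → Coprime n 6 → ∃ λ h → n ≡ suc (h ℕ.+ h)
odd {n} cop with parity n
... | h , inj₂ e = h , e
... | h , inj₁ ≡.refl with cop (ℕ∣.divides h (≡.trans (≡.cong (ℕ._+_ h) (≡.sym (ℕₚ.+-identityʳ h))) (ℕₚ.*-comm 2 h)) , ℕ∣.divides 3 ≡.refl)
...   | ()

coprime-divisor : ∀ {d n m} → d ∣ n → Coprime n m → Coprime d m
coprime-divisor d∣n cop (i∣d , i∣m) = cop (ℕ∣.∣-trans i∣d d∣n , i∣m)

-- From d (2J + 1) = 2 (h + d J) + 1 for d = 2h + 1.
half-range : ∀ {M} d h e J → suc (2 ℕ.* M) ≡ d ℕ.* e → d ≡ suc (h ℕ.+ h) → e ≡ suc (J ℕ.+ J) → M ≡ h ℕ.+ d ℕ.* J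
half-range {M} d h e J 2M+1≡de d≡ e≡ = ℕₚ.*-cancelˡ-≡ M _ 2 (ℕₚ.suc-injective (begin
  suc (2 ℕ.* M)                              ≡⟨ 2M+1≡de ⟩
  d ℕ.* e                                    ≡⟨ ≡.cong (ℕ._*_ d) e≡ ⟩
  d ℕ.* suc (J ℕ.+ J)                        ≡⟨ expand d J ⟩
  d ℕ.+ 2 ℕ.* (d ℕ.* J)                      ≡⟨ ≡.cong (ℕ._+ 2 ℕ.* (d ℕ.* J)) d≡ ⟩
  suc (h ℕ.+ h) ℕ.+ 2 ℕ.* (d ℕ.* J)          ≡⟨ collect h (d ℕ.* J) ⟩
  suc (2 ℕ.* (h ℕ.+ d ℕ.* J))                ∎))
  where
  open ≡.≡-Reasoning
  expand : ∀ d J → d ℕ.* suc (J ℕ.+ J) ≡ d ℕ.+ 2 ℕ.* (d ℕ.* J)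
  expand = ℕ-solve
  collect : ∀ h x → suc (h ℕ.+ h) ℕ.+ 2 ℕ.* x ≡ suc (2 ℕ.* (h ℕ.+ x))
  collect = ℕ-solve

-- Values of formal fractions in the field

module Evaluation (F : Field) (embedding : Embedding F) where
  open Field F
  open Embedding embedding
  open IntSolver commutativeRing using (solve; con; _:+_; _:*_; _:-_; :-_; _:=_)
  open FieldProperties F
  open import Relation.Binary.Reasoning.Setoid setoid

  ι-neg : ∀ a → ι (negₚ a) ≈ - ι a
  ι-neg a = begin
    ι (negₚ a)                    ≈⟨ solve 2 (λ n a → n := (n :+ a) :- a) refl _ (ι a) ⟩
    ι (negₚ a) + ι a - ι a        ≈⟨ +-congʳ (trans (sym (ι-+ (negₚ a) a)) (trans (ι-cong (PR.-‿inverseˡ a)) ι-0)) ⟩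
    0# - ι a                      ≈⟨ +-identityˡ _ ⟩
    - ι a                         ∎

  ι-- : ∀ a b → ι (a -ₚ b) ≈ ι a - ι b
  ι-- a b = trans (ι-+ a (negₚ b)) (+-congˡ (ι-neg b))

  ι-reflects : ∀ {a b} → ι a ≈ ι b → a ≋ b
  ι-reflects {a} {b} e = difference-zero⁻¹ (ι-injective (trans (ι-- a b) (trans (+-congʳ e) (-‿inverseʳ (ι b)))))

  ι≉0 : ∀ {a} → ¬ a ≋ [] → ¬ ι a ≈ 0#
  ι≉0 a≢0 e = a≢0 (ι-injective e)

  X : Carrier
  X = ι (X^ 1)

  X^-nonzero : ∀ n → ¬ X^ n ≋ []
  X^-nonzero n e with ≡.trans (≡.sym (proj₁ (X^-monic n))) (at e n)
  ... | ()

  X≉0 : ¬ X ≈ 0#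
  X≉0 = ι≉0 (X^-nonzero 1)

  pow-X : ∀ n → pow X n ≈ ι (X^ n)
  pow-X zero    = sym ι-1
  pow-X (suc n) = trans (*-congʳ (pow-X n)) (trans (*-comm _ _) (trans (sym (ι-* (X^ 1) (X^ n))) (ι-cong (≋-sym (X^-+ 1 n)))))

  X-not-root : ∀ n → ¬ pow X (suc n) ≈ 1#
  X-not-root n e with at (ι-reflects (trans (sym (pow-X (suc n))) (trans e (sym ι-1)))) 0
  ... | ()

  open Powers F X X≉0
  open Summation X-not-root
  open Valuation F X X≉0 X-not-root

  1-qz-ι : ∀ n → 1# - qz (+ n) ≈ - ι (X^-1 n)
  1-qz-ι n = trans (1-cong (pow-X n)) (trans (solve 2 (λ a o → o :- a := :- (a :- o)) refl (ι (X^ n)) 1#)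
    (-‿cong (trans (+-congˡ (-‿cong (sym ι-1))) (sym (ι-- (X^ n) 1ₚ)))))

  -- A formal fraction may have denominator 0; having a value includes a proof that it does not.
  record Value (f : Frac) (v : Carrier) : Set where
    constructor value
    field
      den≢0    : ¬ Frac.den f ≋ []
      equation : v * ι (Frac.den f) ≈ ι (Frac.num f)

  Value-resp : ∀ {f v v′} → v ≈ v′ → Value f v → Value f v′
  Value-resp e (value d eq) = value d (trans (*-congʳ (sym e)) eq)

  Value-fromPoly : ∀ a → Value (fromPoly a) (ι a)
  Value-fromPoly a = value (X^-nonzero 0) (trans (*-congˡ ι-1) (*-identityʳ _))

  Value-1 : Value 1f 1#
  Value-1 = Value-resp ι-1 (Value-fromPoly 1ₚ)

  Value-+ : ∀ {f g u v} → Value f u → Value g v → Value (f +f g) (u + v)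
  Value-+ {a / b} {c / d} {u} {v} (value b≢0 e) (value d≢0 e′) = value (*ₚ-nonzero b≢0 d≢0) (begin
    (u + v) * ι (b *ₚ d)                       ≈⟨ *-congˡ (ι-* b d) ⟩
    (u + v) * (ι b * ι d)                      ≈⟨ solve 4 (λ u v b d → (u :+ v) :* (b :* d) := u :* b :* d :+ v :* d :* b) refl u v (ι b) (ι d) ⟩
    u * ι b * ι d + v * ι d * ι b              ≈⟨ +-cong (*-congʳ e) (*-congʳ e′) ⟩
    ι a * ι d + ι c * ι b                      ≈⟨ +-cong (ι-* a d) (ι-* c b) ⟨
    ι (a *ₚ d) + ι (c *ₚ b)                    ≈⟨ ι-+ _ _ ⟨
    ι (a *ₚ d +ₚ c *ₚ b)                       ∎)

  Value-- : ∀ {f g u v} → Value f u → Value g v → Value (f -f g) (u - v)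
  Value-- {a / b} {c / d} {u} {v} (value b≢0 e) (value d≢0 e′) = value (*ₚ-nonzero b≢0 d≢0) (begin
    (u - v) * ι (b *ₚ d)                       ≈⟨ *-congˡ (ι-* b d) ⟩
    (u - v) * (ι b * ι d)                      ≈⟨ solve 4 (λ u v b d → (u :- v) :* (b :* d) := u :* b :* d :- v :* d :* b) refl u v (ι b) (ι d) ⟩
    u * ι b * ι d - v * ι d * ι b              ≈⟨ +-cong (*-congʳ e) (-‿cong (*-congʳ e′)) ⟩
    ι a * ι d - ι c * ι b                      ≈⟨ +-cong (ι-* a d) (-‿cong (ι-* c b)) ⟨
    ι (a *ₚ d) - ι (c *ₚ b)                    ≈⟨ ι-- _ _ ⟨
    ι (a *ₚ d -ₚ c *ₚ b)                       ∎)

  Value-* : ∀ {f g u v} → Value f u → Value g v → Value (f *f g) (u * v)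
  Value-* {a / b} {c / d} {u} {v} (value b≢0 e) (value d≢0 e′) = value (*ₚ-nonzero b≢0 d≢0) (begin
    u * v * ι (b *ₚ d)                         ≈⟨ *-congˡ (ι-* b d) ⟩
    u * v * (ι b * ι d)                        ≈⟨ solve 4 (λ u v b d → u :* v :* (b :* d) := u :* b :* (v :* d)) refl u v (ι b) (ι d) ⟩
    u * ι b * (v * ι d)                        ≈⟨ *-cong e e′ ⟩
    ι a * ι c                                  ≈⟨ ι-* a c ⟨
    ι (a *ₚ c)                                 ∎)

  Value-÷ : ∀ {f g u v} → ¬ v ≈ 0# → Value f u → Value g v → Value (f ÷f g) (u * v ⁻¹)
  Value-÷ {a / b} {c / d} {u} {v} v≉0 (value b≢0 e) (value d≢0 e′) = value (*ₚ-nonzero b≢0 c≢0) (begin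
    u * v ⁻¹ * ι (b *ₚ c)                      ≈⟨ *-congˡ (trans (ι-* b c) (*-congˡ (sym e′))) ⟩
    u * v ⁻¹ * (ι b * (v * ι d))               ≈⟨ solve 5 (λ u i b v d → u :* i :* (b :* (v :* d)) := (v :* i) :* (u :* b :* d)) refl u (v ⁻¹) (ι b) v (ι d) ⟩
    v * v ⁻¹ * (u * ι b * ι d)                 ≈⟨ trans (*-congʳ (*-inverse v v≉0)) (*-identityˡ _) ⟩
    u * ι b * ι d                              ≈⟨ *-congʳ e ⟩
    ι a * ι d                                  ≈⟨ ι-* a d ⟨
    ι (a *ₚ d)                                 ∎)
    where
    c≢0 : ¬ c ≋ []
    c≢0 z = *-nonzero v≉0 (ι≉0 d≢0) (trans e′ (trans (ι-cong z) ι-0))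

  Value-^ : ∀ {f u} k → Value f u → Value (f ^f k) (pow u k)
  Value-^ zero    r = Value-1
  Value-^ (suc k) r = Value-* (Value-^ k r) r

  Value-poch : ∀ {f g u b} k → Value f u → Value g b → Value (Defs.poch f g k) (poch u b k)
  Value-poch zero    r s = Value-1
  Value-poch (suc k) r s = Value-* (Value-poch k r s) (Value-- Value-1 (Value-* r (Value-^ k s)))

  Value-qpow : ∀ z → Value (qpow z) (qz z)
  Value-qpow (+ n)    = Value-resp (sym (pow-X n)) (Value-fromPoly (X^ n))
  Value-qpow -[1+ n ] = value (X^-nonzero (suc n)) (trans (*-congˡ (sym (pow-X (suc n))))
    (trans (*-comm _ _) (trans (pow-inverse qp≈1 (suc n)) (sym ι-1))))

  -- Multiplication by q - 1 telescopes the sum. The offset s and the function g are there for the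
  -- induction, since the tail of the index list starts one step later.
  qint-telescope : ∀ s j (g : ℕ → ℕ) → (∀ i → g i ≡ s ℕ.+ i) →
    X^-1 1 *ₚ foldr (λ i acc → X^ i +ₚ acc) 0ₚ (applyUpTo g j) ≋ X^ (s ℕ.+ j) -ₚ X^ s
  qint-telescope s zero g eq = ≋-trans (PR.zeroʳ (X^-1 1)) (≋-sym (≋-trans (PR.+-congʳ (PR.reflexive (≡.cong X^ (ℕₚ.+-identityʳ s)))) (PR.-‿inverseʳ (X^ s))))
  qint-telescope s (suc j) g eq = ≋-trans (PR.distribˡ (X^-1 1) (X^ (g 0)) _) (≋-trans
    (PR.+-cong (≋-trans (PR.*-congˡ {X^-1 1} (PR.reflexive (≡.cong X^ (≡.trans (eq 0) (ℕₚ.+-identityʳ s))))) first)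
      (≋-trans (qint-telescope (suc s) j (λ i → g (suc i)) (λ i → ≡.trans (eq (suc i)) (ℕₚ.+-suc s i)))
        (PR.+-congʳ (PR.reflexive (≡.cong X^ (≡.sym (ℕₚ.+-suc s j)))))))
    (PS.solve 3 (λ a b c → (b PS.:- c) PS.:+ (a PS.:- b) PS.:= a PS.:- c) ≋-refl (X^ (s ℕ.+ suc j)) (X^ (suc s)) (X^ s)))
    where
    first : X^-1 1 *ₚ X^ s ≋ X^ (suc s) -ₚ X^ s
    first = ≋-trans (PS.solve 2 (λ x y → (x PS.:- PS.con (+ 1)) PS.:* y PS.:= x PS.:* y PS.:- y) ≋-refl (X^ 1) (X^ s)) (PR.+-congʳ (≋-sym (X^-+ 1 s)))

  X^-1-qint : ∀ j → X^-1 1 *ₚ qint j ≋ X^-1 j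
  X^-1-qint j = qint-telescope 0 j (λ i → i) (λ _ → ≡.refl)

  ι-qint : ∀ j → ι (qint j) ≈ (1# - qz (+ j)) * (1# - X) ⁻¹
  ι-qint j = *-cancelˡ 1-q≉0 (begin
    (1# - X) * ι (qint j)                 ≈⟨ *-congʳ (trans (1-cong (sym qz1)) (1-qz-ι 1)) ⟩
    - ι (X^-1 1) * ι (qint j)             ≈⟨ solve 2 (λ a b → (:- a) :* b := :- (a :* b)) refl _ _ ⟩
    - (ι (X^-1 1) * ι (qint j))           ≈⟨ -‿cong (trans (sym (ι-* (X^-1 1) (qint j))) (ι-cong (X^-1-qint j))) ⟩
    - ι (X^-1 j)                          ≈⟨ 1-qz-ι j ⟨
    1# - qz (+ j)                         ≈⟨ *-identityˡ _ ⟨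
    1# * (1# - qz (+ j))                  ≈⟨ *-congʳ (*-inverse _ 1-q≉0) ⟨
    (1# - X) * (1# - X) ⁻¹ * (1# - qz (+ j)) ≈⟨ solve 3 (λ a i z → a :* i :* z := a :* (z :* i)) refl _ _ _ ⟩
    (1# - X) * ((1# - qz (+ j)) * (1# - X) ⁻¹) ∎)

  c⁴-qz : ∀ k → qz (+ (8 ℕ.* k ℕ.+ 1)) ≈ c k * (c k * (c k * c k)) * X
  c⁴-qz k = trans (qz-≡ (≡.cong +_ (lemma k))) (trans (qz-+ (+ (k ℕ.+ k ℕ.+ (k ℕ.+ k ℕ.+ (k ℕ.+ k ℕ.+ (k ℕ.+ k))))) (+ 1))
    (*-cong (trans (qz-+ (+ (k ℕ.+ k)) (+ (k ℕ.+ k ℕ.+ (k ℕ.+ k ℕ.+ (k ℕ.+ k))))) (*-cong c′ (trans (qz-+ (+ (k ℕ.+ k)) (+ (k ℕ.+ k ℕ.+ (k ℕ.+ k)))) (*-cong c′ (trans (qz-+ (+ (k ℕ.+ k)) (+ (k ℕ.+ k))) (*-cong c′ c′)))))) qz1))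
    where
    c′ = sym (c-qz k)
    lemma : ∀ k → 8 ℕ.* k ℕ.+ 1 ≡ k ℕ.+ k ℕ.+ (k ℕ.+ k ℕ.+ (k ℕ.+ k ℕ.+ (k ℕ.+ k))) ℕ.+ 1
    lemma = ℕ-solve

  Value-term : ∀ k → Value (term k) (t k)
  Value-term k = Value-resp eq (Value-÷ (Q≉0 k)
    (Value-* (Value-* (Value-* (Value-* (Value-fromPoly (qint (8 ℕ.* k ℕ.+ 1))) (Value-^ 2 (Value-poch k X₁ X₂))) (Value-poch (2 ℕ.* k) X₁ X₂)) (Value-poch k X₋₃ X₆))
      (Value-qpow (+ (2 ℕ.* k))))
    (Value-* (Value-* (Value-* (Value-poch (2 ℕ.* k) X₂ X₂) (Value-poch k X₆ X₆)) (Value-poch k X₋₃ X₂)) (Value-poch k X₆ X₂)))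
    where
    X₁ = Value-resp qz1 (Value-qpow (+ 1))
    X₂ = Value-resp qz2 (Value-qpow (+ 2))
    X₆ = Value-resp qz6 (Value-qpow (+ 6))
    X₋₃ = Value-resp qz-3 (Value-qpow -[1+ 2 ])
    eq : ι (qint (8 ℕ.* k ℕ.+ 1)) * pow (A k) 2 * poch X q² (2 ℕ.* k) * poch p³ q⁶ k * qz (+ (2 ℕ.* k)) * Q k ⁻¹ ≈ t k
    eq = trans (*-congʳ (*-cong (*-congʳ (*-congʳ (*-congʳ (trans (ι-qint (8 ℕ.* k ℕ.+ 1)) (*-congʳ (1-cong (c⁴-qz k))))))) (trans (qz-≡ (≡.cong (λ i → + (k ℕ.+ i)) (ℕₚ.+-identityʳ k))) (sym (c-qz k)))))
      (solve 7 (λ g r a b d c i → g :* r :* (con (+ 1) :* a :* a) :* b :* d :* c :* i := g :* r :* (a :* a) :* (b :* d) :* c :* i) refl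
        (1# - c k * (c k * (c k * c k)) * X) ((1# - X) ⁻¹) (A k) (poch X q² (2 ℕ.* k)) (poch p³ q⁶ k) (c k) (Q k ⁻¹))

  Value-sumTo : ∀ M → Value (sumTo M term) (partialSum t M)
  Value-sumTo zero    = Value-term 0
  Value-sumTo (suc M) = Value-+ (Value-sumTo M) (Value-term (suc M))

  inverse-negate : ∀ z → z ≢ + 0 → (1# - qz z) ⁻¹ ≈ - qz (ℤ.- z) * (1# - qz (ℤ.- z)) ⁻¹
  inverse-negate z z≢0 = sym (inverse-unique (begin
    (1# - qz z) * (- qz (ℤ.- z) * i)          ≈⟨ solve 4 (λ o a b i → (o :- a) :* ((:- b) :* i) := (a :* b :- o :* b) :* i) refl 1# (qz z) (qz (ℤ.- z)) i ⟩
    (qz z * qz (ℤ.- z) - 1# * qz (ℤ.- z)) * i ≈⟨ *-congʳ (+-cong (qz-neg z) (-‿cong (*-identityˡ _))) ⟩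
    (1# - qz (ℤ.- z)) * i                     ≈⟨ *-inverse _ (1-qz≉0 (ℤ.- z) (λ e → z≢0 (ℤₚ.neg-injective e))) ⟩
    1#                                        ∎))
    where i = (1# - qz (ℤ.- z)) ⁻¹

  factor-negate : ∀ z → 1# - qz z ≈ - qz z * (1# - qz (ℤ.- z))
  factor-negate z = sym (trans (solve 3 (λ o a b → (:- a) :* (o :- b) := a :* b :- a :* o) refl 1# (qz z) (qz (ℤ.- z))) (+-cong (qz-neg z) (-‿cong (*-identityʳ _))))

  -- The local ring at the d-th cyclotomic polynomial

  module At {n d₀} (Φ : Cyclotomic n) (d₀<n : d₀ < n) where
    open Cyclotomic Φ
    private
      d = suc d₀
      P = f d
      cof = _∣′_.quotient (f-∣ d₀ d₀<n)
      Pc : P *ₚ cof ≋ X^-1 d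
      Pc = _∣′_.equality (f-∣ d₀ d₀<n)

    -- The localization of ℚ[q] at the prime factors of the d-th cyclotomic polynomial.
    record O (g : Carrier) : Set where
      constructor integral
      field
        N Y      : Poly
        unitY    : UnitMod P Y
        equation : g * ι Y ≈ ι N

    O-poly : ∀ a → O (ι a)
    O-poly a = integral a 1ₚ unit-1 (trans (*-congˡ ι-1) (*-identityʳ _))

    O-resp : ∀ {f g} → f ≈ g → O f → O g
    O-resp e (integral N Y u eq) = integral N Y u (trans (*-congʳ (sym e)) eq)

    O-1 : O 1#
    O-1 = O-resp ι-1 (O-poly 1ₚ)

    O--1 : O (- 1#)
    O--1 = O-resp (trans (ι-neg 1ₚ) (-‿cong ι-1)) (O-poly (negₚ 1ₚ))

    O-+ : ∀ {f g} → O f → O g → O (f + g)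
    O-+ {f} {g} (integral N Y u eq) (integral N′ Y′ u′ eq′) = integral (N *ₚ Y′ +ₚ N′ *ₚ Y) (Y *ₚ Y′) (unit-* u u′) (begin
      (f + g) * ι (Y *ₚ Y′)              ≈⟨ *-congˡ (ι-* Y Y′) ⟩
      (f + g) * (ι Y * ι Y′)             ≈⟨ solve 4 (λ f g y z → (f :+ g) :* (y :* z) := f :* y :* z :+ g :* z :* y) refl f g (ι Y) (ι Y′) ⟩
      f * ι Y * ι Y′ + g * ι Y′ * ι Y    ≈⟨ +-cong (*-congʳ eq) (*-congʳ eq′) ⟩
      ι N * ι Y′ + ι N′ * ι Y            ≈⟨ +-cong (ι-* N Y′) (ι-* N′ Y) ⟨
      ι (N *ₚ Y′) + ι (N′ *ₚ Y)          ≈⟨ ι-+ _ _ ⟨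
      ι (N *ₚ Y′ +ₚ N′ *ₚ Y)             ∎)

    O-* : ∀ {f g} → O f → O g → O (f * g)
    O-* {f} {g} (integral N Y u eq) (integral N′ Y′ u′ eq′) = integral (N *ₚ N′) (Y *ₚ Y′) (unit-* u u′) (begin
      f * g * ι (Y *ₚ Y′)                ≈⟨ *-congˡ (ι-* Y Y′) ⟩
      f * g * (ι Y * ι Y′)               ≈⟨ solve 4 (λ f g y z → f :* g :* (y :* z) := f :* y :* (g :* z)) refl f g (ι Y) (ι Y′) ⟩
      f * ι Y * (g * ι Y′)               ≈⟨ *-cong eq eq′ ⟩
      ι N * ι N′                         ≈⟨ ι-* N N′ ⟨
      ι (N *ₚ N′)                        ∎)

    unit-≋ : ∀ {Y Z} → Y ≋ Z → UnitMod P Z → UnitMod P Y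
    unit-≋ {Y} e u = unit-factor (1ₚ , ≋-trans (PR.*-identityʳ Y) e) u

    -- P divides q^d - 1, so q · q^(d-1) is 1 modulo P.
    unit-X^ : ∀ m → UnitMod P (X^ m)
    unit-X^ zero    = unit-1
    unit-X^ (suc m) = unit-≋ (X^-+ 1 m) (unit-* unit-X (unit-X^ m))
      where
      unit-X : UnitMod P (X^ 1)
      unit-X = unit-factor (X^ d₀ , ≋-sym (X^-+ 1 d₀)) record
        { v = 1ₚ ; w = negₚ cof ; m = + 1 ; m≢0 = λ ()
        ; inv = ≋-trans (PS.solve 3 (λ x c p → PS.con (+ 1) PS.:* x PS.:+ (PS.:- c) PS.:* p PS.:= x PS.:- p PS.:* c) ≋-refl (X^ d) cof P)
                  (≋-trans (PR.+-congˡ {X^ d} (PR.-‿cong Pc)) (PS.solve 1 (λ x → x PS.:- (x PS.:- PS.con (+ 1)) PS.:= PS.con (+ 1)) ≋-refl (X^ d))) }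

    -- Modulo q^d - 1, hence modulo P, the sum is the non-zero integer j + 1, which is invertible
    -- over ℚ.
    unit-geometric : ∀ j → UnitMod P (geometric d (suc j))
    unit-geometric j = record
      { v = 1ₚ ; w = negₚ (r *ₚ cof) ; m = + suc j ; m≢0 = λ ()
      ; inv = ≋-trans (PS.solve 4 (λ g r c p → PS.con (+ 1) PS.:* g PS.:+ (PS.:- (r PS.:* c)) PS.:* p PS.:= g PS.:- r PS.:* (p PS.:* c)) ≋-refl (geometric d (suc j)) r cof P)
                (≋-trans (PR.+-cong (proj₂ mod) (PR.-‿cong (PR.*-congˡ {r} Pc))) (PS.solve 2 (λ c x → c PS.:+ x PS.:- x PS.:= c) ≋-refl (C (+ suc j)) (r *ₚ X^-1 d))) }
      where
      mod = geometric-mod d (suc j)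
      r = proj₁ mod

    O-qz : ∀ z → O (qz z)
    O-qz (+ n)    = O-resp (sym (pow-X n)) (O-poly (X^ n))
    O-qz -[1+ n ] = integral 1ₚ (X^ (suc n)) (unit-X^ (suc n)) (trans (*-congˡ (sym (pow-X (suc n)))) (trans (*-comm _ _) (trans (pow-inverse qp≈1 (suc n)) (sym ι-1))))

    O-neg : ∀ {g} → O g → O (- g)
    O-neg {g} og = O-resp (solve 1 (λ g → (:- con (+ 1)) :* g := :- g) refl g) (O-* O--1 og)

    unit⁻¹ : ∀ z → ¬ (+ d) ∣ℤ z → O ((1# - qz z) ⁻¹)
    unit⁻¹ (+ i) d∤i = integral (negₚ 1ₚ) (X^-1 i) (unit d₀ d₀<n i (λ d∣i → d∤i (ℤ∣.∣ᵤ⇒∣ d∣i))) (begin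
      (1# - qz (+ i)) ⁻¹ * ι (X^-1 i)          ≈⟨ *-congˡ (trans (solve 1 (λ a → a := :- (:- a)) refl _) (-‿cong (sym (1-qz-ι i)))) ⟩
      (1# - qz (+ i)) ⁻¹ * - (1# - qz (+ i))   ≈⟨ solve 2 (λ a b → b :* (:- a) := :- (a :* b)) refl _ _ ⟩
      - ((1# - qz (+ i)) * (1# - qz (+ i)) ⁻¹) ≈⟨ -‿cong (trans (*-inverse _ (1-qz≉0 (+ i) (λ e → d∤i (≡.subst ((+ d) ∣ℤ_) (≡.sym e) (divides (+ 0) ≡.refl))))) (sym ι-1)) ⟩
      - ι 1ₚ                                   ≈⟨ ι-neg 1ₚ ⟨
      ι (negₚ 1ₚ)                              ∎)
    unit⁻¹ -[1+ i ] d∤z = O-resp (sym (inverse-negate -[1+ i ] (λ ())))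
      (O-* (O-neg (O-qz (+ suc i))) (unit⁻¹ (+ suc i) (λ d∣ → d∤z (∣ℤ-times -[1+ 0 ] d∣ (≡.cong -[1+_] (≡.sym (ℕₚ.+-identityʳ i)))))))

    -- With 1 - q^d in place of Φ_d, the quotients (1 - q^(jd)) / π are plain geometric sums; Φ_d is
    -- recovered as a factor in `π-ι`.
    π : Carrier
    π = 1# - qz (+ d)

    π-ι : π ≈ - (ι P * ι cof)
    π-ι = trans (1-qz-ι d) (-‿cong (trans (ι-cong (≋-sym Pc)) (ι-* P cof)))

    multiple : ∀ j → 1# - qz (+ (j ℕ.* d)) ≈ π * ι (geometric d j)
    multiple j = begin
      1# - qz (+ (j ℕ.* d))              ≈⟨ 1-qz-ι (j ℕ.* d) ⟩
      - ι (X^-1 (j ℕ.* d))               ≈⟨ -‿cong (trans (ι-cong (≋-sym (geometric-* d j))) (ι-* (X^-1 d) (geometric d j))) ⟩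
      - (ι (X^-1 d) * ι (geometric d j)) ≈⟨ solve 2 (λ a b → :- (a :* b) := (:- a) :* b) refl _ _ ⟩
      - ι (X^-1 d) * ι (geometric d j)   ≈⟨ *-congʳ (sym (1-qz-ι d)) ⟩
      π * ι (geometric d j)              ∎

    factor-ℕ : ∀ i → d ∣ i → ∃ λ o → O o × 1# - qz (+ i) ≈ π * o
    factor-ℕ i (ℕ∣.divides j ≡.refl) = ι (geometric d j) , O-poly _ , multiple j

    factor : ∀ z → (+ d) ∣ℤ z → ∃ λ o → O o × 1# - qz z ≈ π * o
    factor (+ i)    d∣z = factor-ℕ i (ℤ∣.∣⇒∣ᵤ d∣z)
    factor -[1+ i ] d∣z with factor-ℕ (suc i) (ℤ∣.∣⇒∣ᵤ d∣z)
    ... | o , oo , e = - qz -[1+ i ] * o , O-* (O-neg (O-qz -[1+ i ])) oo , trans (factor-negate -[1+ i ])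
            (trans (*-congˡ e) (solve 3 (λ a p o → a :* (p :* o) := p :* (a :* o)) refl _ π o))

    cofactor-ℕ : ∀ i → i ≢ 0 → d ∣ i → O (π * (1# - qz (+ i)) ⁻¹)
    cofactor-ℕ i i≢0 (ℕ∣.divides zero    ≡.refl) = ⊥-elim (i≢0 ≡.refl)
    cofactor-ℕ i i≢0 (ℕ∣.divides (suc j) ≡.refl) = integral 1ₚ (geometric d (suc j)) (unit-geometric j) (begin
      π * i⁻ * ι (geometric d (suc j))     ≈⟨ solve 3 (λ p i g → p :* i :* g := p :* g :* i) refl π i⁻ _ ⟩
      π * ι (geometric d (suc j)) * i⁻     ≈⟨ *-congʳ (sym (multiple (suc j))) ⟩
      (1# - qz (+ (suc j ℕ.* d))) * i⁻     ≈⟨ *-inverse _ (1-qz≉0 (+ (suc j ℕ.* d)) (λ ())) ⟩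
      1#                                   ≈⟨ ι-1 ⟨
      ι 1ₚ                                 ∎)
      where i⁻ = (1# - qz (+ (suc j ℕ.* d))) ⁻¹

    cofactor : ∀ z → z ≢ + 0 → (+ d) ∣ℤ z → O (π * (1# - qz z) ⁻¹)
    cofactor (+ i)    z≢0 d∣z = cofactor-ℕ i (λ e → z≢0 (≡.cong +_ e)) (ℤ∣.∣⇒∣ᵤ d∣z)
    cofactor -[1+ i ] z≢0 d∣z = O-resp (trans (solve 3 (λ a p i → a :* (p :* i) := p :* (a :* i)) refl _ π _) (*-congˡ (sym (inverse-negate -[1+ i ] z≢0))))
      (O-* (O-neg (O-qz (+ suc i))) (cofactor-ℕ (suc i) (λ ()) (ℤ∣.∣⇒∣ᵤ d∣z)))

    localRing : LocalRing d
    localRing = record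
      { O = O ; O-resp = O-resp ; O-+ = O-+ ; O-* = O-* ; O-1 = O-1 ; O--1 = O--1 ; O-qz = O-qz ; unit⁻¹ = unit⁻¹
      ; π = π ; π≉0 = 1-qz≉0 (+ d) (λ ()) ; factor = factor ; cofactor = cofactor }

    -- Here S = N / D = A / B. Writing o = W / Y gives Y A = P² · cof² W B, and Y can be cancelled
    -- because it is invertible modulo P.
    square-∣-numerator : ∀ {S o N D A B} → O o → S ≈ π * π * o → ¬ D ≋ [] → S * ι D ≈ ι N → A *ₚ D ≋ N *ₚ B → P *ₚ P ∣′ A
    square-∣-numerator {S} {o} {N} {D} {A} {B} (integral W Y u eq) S≈ D≢0 SD AD = unit-cancel² {P} {Y} (monic d₀ d₀<n) u
      (cof *ₚ cof *ₚ W *ₚ B , *ₚ-cancelˡ D≢0 (ι-reflects (begin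
        ι (D *ₚ (P *ₚ P *ₚ (cof *ₚ cof *ₚ W *ₚ B)))
          ≈⟨ trans (ι-* D _) (*-congˡ (trans (ι-* (P *ₚ P) _) (*-cong (ι-* P P) (trans (ι-* (cof *ₚ cof *ₚ W) B) (*-congʳ (trans (ι-* (cof *ₚ cof) W) (*-cong (ι-* cof cof) (sym eq)))))))) ⟩
        ι D * (ι P * ι P * (ι cof * ι cof * (o * ι Y) * ι B))
          ≈⟨ solve 6 (λ D P c o Y B → D :* (P :* P :* (c :* c :* (o :* Y) :* B)) := (:- (P :* c)) :* (:- (P :* c)) :* o :* D :* Y :* B) refl (ι D) (ι P) (ι cof) o (ι Y) (ι B) ⟩
        - (ι P * ι cof) * - (ι P * ι cof) * o * ι D * ι Y * ι B
          ≈⟨ *-congʳ (*-congʳ (*-congʳ (trans (*-congʳ (*-cong (sym π-ι) (sym π-ι))) (sym S≈)))) ⟩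
        S * ι D * ι Y * ι B
          ≈⟨ *-congʳ (*-congʳ SD) ⟩
        ι N * ι Y * ι B
          ≈⟨ solve 3 (λ N Y B → N :* Y :* B := N :* B :* Y) refl _ _ _ ⟩
        ι N * ι B * ι Y
          ≈⟨ *-congʳ (trans (sym (ι-* N B)) (trans (ι-cong (≋-sym AD)) (ι-* A D))) ⟩
        ι A * ι D * ι Y
          ≈⟨ solve 3 (λ A D Y → A :* D :* Y := D :* (Y :* A)) refl _ _ _ ⟩
        ι D * (ι Y * ι A)
          ≈⟨ trans (ι-* D _) (*-congˡ (ι-* Y A)) ⟨
        ι (D *ₚ (Y *ₚ A)) ∎)))

  -- From the divisors of n to the square of [n]

  module Congruence (n₀ M : ℕ) (cop : Coprime (suc n₀) 6) (M≡ : M ≡ n₀ ⊎ 2 ℕ.* M ≡ n₀)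
    {N D : Poly} (D≢0 : ¬ D ≋ []) (sum : partialSum t M * ι D ≈ ι N) (R : Reduced N D) (Φ : Cyclotomic (suc n₀)) where
    private
      module R = Reduced R
      n = suc n₀
    open Cyclotomic Φ

    local : ∀ d₀ → suc d₀ ∣ n → 1 < suc d₀ → f (suc d₀) *ₚ f (suc d₀) ∣′ R.N
    local d₀ d∣n 1<d = from-range (odd copd) (inverse-of-6 copd) d∣n
      where
      d = suc d₀
      d₀<n : d₀ < n
      d₀<n = ℕ∣.∣⇒≤ d∣n
      copd : Coprime d 6
      copd = coprime-divisor d∣n cop
      d∤6 : ¬ (+ d) ∣ℤ (+ 6)
      d∤6 dv = ℕₚ.<⇒≢ 1<d (≡.sym (copd (ℕ∣.∣-refl , ℤ∣.∣⇒∣ᵤ dv)))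
      module L = At Φ d₀<n
      from-range : (∃ λ h → d ≡ suc (h ℕ.+ h)) → (∃ λ u → ∃ λ k → + 6 ℤ.* u ≡ + 1 ℤ.+ k ℤ.* + d) → d ∣ n → f d *ₚ f d ∣′ R.N
      from-range (h , d≡) (u , k , 6u≡) (ℕ∣.divides e n≡ed) = conclude (range M≡)
        where
        open Counting d h d≡ d∤6 u k 6u≡ using (Range)
        open InLocalRing {d} {h} d≡ d∤6 u k 6u≡ L.localRing using (π²∣partialSum)
        conclude : (∃ λ J → Range M J) → f d *ₚ f d ∣′ R.N
        conclude (J , r) = let (o , oo , eq) = π²∣partialSum r in L.square-∣-numerator oo eq D≢0 sum R.fraction
        n≡de : n ≡ d ℕ.* e
        n≡de = ≡.trans n≡ed (ℕₚ.*-comm e d)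
        e-odd : ∃ λ J → e ≡ suc (J ℕ.+ J)
        e-odd = odd (coprime-divisor (ℕ∣.divides d n≡de) cop)
        range : (M ≡ n₀ ⊎ 2 ℕ.* M ≡ n₀) → ∃ λ J → Range M J
        range (inj₁ M≡n₀) = full e n≡de
          where
          full : ∀ e → n ≡ d ℕ.* e → ∃ λ J → Range M J
          full zero    n≡ = ⊥-elim (ℕₚ.1+n≢0 (≡.trans n≡ (ℕₚ.*-zeroʳ d)))
          full (suc J) n≡ = J , inj₁ (≡.trans (≡.cong suc M≡n₀) n≡)
        range (inj₂ 2M≡n₀) = proj₁ e-odd , inj₂ (half-range d h e (proj₁ e-odd) (≡.trans (≡.cong suc 2M≡n₀) n≡de) d≡ (proj₂ e-odd))

    x1 = X^-1 1
    -- The extra (q - 1)² supplies the factor for d = 1, which the local argument does not cover. It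
    -- cancels in `divisible`, where (q^n - 1)² = (q - 1)² [n]².
    each : ∀ d₀ → suc d₀ ∣ n → f (suc d₀) *ₚ f (suc d₀) ∣′ R.N *ₚ (x1 *ₚ x1)
    each zero _ with f-∣ 0 (s≤s z≤n)
    ... | g , e = R.N *ₚ (g *ₚ g) , ≋-trans (PS.solve 3 (λ f N g → f PS.:* f PS.:* (N PS.:* (g PS.:* g)) PS.:= N PS.:* ((f PS.:* g) PS.:* (f PS.:* g))) ≋-refl (f 1) R.N g)
            (PR.*-congˡ {R.N} (PR.*-cong e e))
    each (suc d₀) d∣n = ∣′-*ʳ (x1 *ₚ x1) (local (suc d₀) d∣n (s≤s (s≤s z≤n)))

    divisible : qint n *ₚ qint n ∣′ R.N
    divisible = g , *ₚ-cancelˡ (*ₚ-nonzero x1≢0 x1≢0) (≋-trans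
            (PS.solve 3 (λ x i g → x PS.:* x PS.:* (i PS.:* i PS.:* g) PS.:= (x PS.:* i) PS.:* (x PS.:* i) PS.:* g) ≋-refl x1 (qint n) g)
            (≋-trans (PR.*-congʳ {g} (PR.*-cong (X^-1-qint n) (X^-1-qint n))) (≋-trans (_∣′_.equality square) (PR.*-comm R.N (x1 *ₚ x1)))))
      where
      square = square-∣ n₀ Φ each
      g = _∣′_.quotient square
      x1≢0 : ¬ x1 ≋ []
      x1≢0 = monic-nonzero {x1} (X^-1-monic 0)

  congruence : (n M : ℕ) → 0 < n → Coprime n 6 → (M ≡ n ∸ 1 ⊎ 2 ℕ.* M ≡ n ∸ 1) → sumTo M term ≡ 0f [modₚ qint n *ₚ qint n ]
  congruence (suc n₀) M _ cop M≡ = finish (reduced _ _ (Value.den≢0 difference)) (cyclotomic (suc n₀))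
    where
    difference : Value (sumTo M term -f 0f) (partialSum t M)
    difference = Value-resp (trans (+-congˡ (trans (-‿cong ι-0) (solve 0 (:- con (+ 0) := con (+ 0)) refl))) (+-identityʳ _))
      (Value-- (Value-sumTo M) (Value-fromPoly 0ₚ))
    finish : Reduced (Frac.num (sumTo M term -f 0f)) (Frac.den (sumTo M term -f 0f)) → Cyclotomic (suc n₀) → sumTo M term ≡ 0f [modₚ qint (suc n₀) *ₚ qint (suc n₀) ]
    finish R Φ = R.N , R.D , (λ e → R.D≢0 (mk e)) , at R.fraction , R.coprime , (_∣′_.quotient div , at (_∣′_.equality div))
      where
      module R = Reduced R
      div = Congruence.divisible n₀ M cop M≡ (Value.den≢0 difference) (Value.equation difference) R Φ

module Theorem = Evaluation FractionField.fractionField FractionField.embedding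

open import Data.Nat using (_*_)

theorem7p4 : (n M : ℕ) → 0 < n → Coprime n 6
    → (M ≡ n ∸ 1 ⊎ 2 * M ≡ n ∸ 1)
    → sumTo M term ≡ 0f [modₚ qint n *ₚ qint n ]
theorem7p4 = Theorem.congruence
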